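{- There is a fixed parameter tractable algorithm that, given a graph $G$ on $n$ vertices and a positive integer $k$, computes a good $k$-partition of $G$ or concludes that none exists. The algorithm runs in $O(k^2n^2+(6k)^{2k})$ time.
   Context: Graphs are finite, undirected and simple, with non-empty vertex set. For disjoint vertex sets $A,B$, $d(A,B)$ is the number of edges between $A$ and $B$. A good $k$-partition of $G=(V,E)$ is a partition of $V$ into $k$ non-empty classes that can be ordered as $P_1,\dots,P_k$ so that $d(\bigcup_{j=1}^{i-1}P_j,P_i)$ is odd for each $2\le i\le k$. (A graph with a good $k$-partition is called $k$-dual-critical.) The algorithm's parameter is $k$. -}

module Defs where

open import Data.Bool using (Bool; false; _∧_; if_then_else_)
open import Data.Fin as Fin using (Fin; toℕ; fromℕ<; remQuot)
open import Data.Fin.Permutation using (Permutation′; _⟨$⟩ʳ_; _⟨$⟩ˡ_)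
open import Data.Fin.Subset using (Subset)
open import Data.Nat using (ℕ; suc; _+_; _*_; _∸_; _^_; _≤_; _<?_; _≡ᵇ_; _<ᵇ_; NonZero)
open import Data.Nat.Divisibility using (_∣_)
open import Data.Nat.Properties using (+-0-commutativeMonoid)
open import Data.Product using (_×_; _,_; ∃-syntax; Σ-syntax)
open import Data.Sum using (_⊎_)
open import Data.Unit using (⊤)
open import Data.Vec using (lookup; tabulate)
open import Function.Definitions using (StrictlySurjective)
open import Relation.Binary.PropositionalEquality using (_≡_; _≢_)
open import Relation.Nullary using (¬_; yes; no; does)
open import Algebra.Properties.CommutativeMonoid.Sum +-0-commutativeMonoid using (sum)

bit : Bool → ℕ
bit b = if b then 1 else 0

------------------------------------------------------------------------
-- Graphs and good partitions

record Graph (n : ℕ) : Set where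
  field
    adj     : Fin n → Fin n → Bool
    adj-sym : ∀ u v → adj u v ≡ adj v u
    no-loop : ∀ v → adj v v ≡ false

open Graph public

-- Each edge between A and B is counted once because A and B are disjoint
-- wherever d is used.
d : ∀ {n} → Graph n → Subset n → Subset n → ℕ
d G A B = sum λ u → sum λ v → bit (lookup A u ∧ lookup B v ∧ adj G u v)

-- A partition into k non-empty classes is given by a surjection
-- P : Fin n → Fin k sending each vertex to the name of its class.
class : ∀ {n k} → (Fin n → Fin k) → Fin k → Subset n
class P c = tabulate λ v → does (P v Fin.≟ c)

-- The permutation π lists the class names in order; earlier P π i is the
-- union of the classes π 0 , … , π (i - 1).
earlier : ∀ {n k} → (Fin n → Fin k) → Permutation′ k → Fin k → Subset n
earlier P π i = tabulate λ v → does ((π ⟨$⟩ˡ P v) Fin.<? i)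

Odd : ℕ → Set
Odd m = ¬ (2 ∣ m)

GoodOrdering : ∀ {n k} → Graph n → (Fin n → Fin k) → Permutation′ k → Set
GoodOrdering G P π =
  ∀ i → toℕ i ≢ 0 → Odd (d G (earlier P π i) (class P (π ⟨$⟩ʳ i)))

IsGoodPartition : ∀ {n k} → Graph n → (Fin n → Fin k) → Set
IsGoodPartition G P =
  StrictlySurjective _≡_ P × (∃[ π ] GoodOrdering G P π)

------------------------------------------------------------------------
-- A word RAM, programmed in a structured language.  A program uses the
-- finitely many scalar variables and zero-initialised arrays that it names.

data Op : Set where
  add sub mul less equal : Op

apply : Op → ℕ → ℕ → ℕ
apply add   a b = a + b
apply sub   a b = a ∸ b
apply mul   a b = a * b
apply less  a b = bit (a <ᵇ b)
apply equal a b = bit (a ≡ᵇ b)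

data Exp : Set where
  lit : ℕ → Exp
  var : ℕ → Exp
  _⁅_⁆ : ℕ → Exp → Exp
  op  : Op → Exp → Exp → Exp

infix 4 _:=_ _⁅_⁆:=_
infixr 3 _⨾_

data Cmd : Set where
  skip         : Cmd
  _:=_         : ℕ → Exp → Cmd
  _⁅_⁆:=_      : ℕ → Exp → Exp → Cmd
  _⨾_          : Cmd → Cmd → Cmd
  branch       : Exp → Cmd → Cmd → Cmd
  while        : Exp → Cmd → Cmd

record State : Set where
  constructor state
  field
    vars : ℕ → ℕ
    arrs : ℕ → ℕ → ℕ

open State public

update : ∀ {A : Set} → (ℕ → A) → ℕ → A → ℕ → A
update f x a y = if y ≡ᵇ x then a else f y

setVar : ℕ → ℕ → State → State
setVar x a σ = state (update (vars σ) x a) (arrs σ)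

setArr : ℕ → ℕ → ℕ → State → State
setArr x i a σ = state (vars σ) (update (arrs σ) x (update (arrs σ x) i a))

eval : State → Exp → ℕ
eval σ (lit a)      = a
eval σ (var x)      = vars σ x
eval σ (x ⁅ e ⁆)    = arrs σ x (eval σ e)
eval σ (op o e₁ e₂) = apply o (eval σ e₁) (eval σ e₂)

-- Every value arising in the evaluation fits in a machine word, W being the
-- largest word.  Without this, unit-cost arithmetic on unbounded numbers
-- would make the machine unrealistically strong.
Fits : ℕ → State → Exp → Set
Fits W σ e = eval σ e ≤ W × Parts e
  where
  Parts : Exp → Set
  Parts (lit a)      = ⊤
  Parts (var x)      = ⊤
  Parts (x ⁅ e ⁆)    = Fits W σ e
  Parts (op o e₁ e₂) = Fits W σ e₁ × Fits W σ e₂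

-- Run W c σ σ′ t : started in σ, c halts in σ′ after t steps without
-- overflowing.  Expressions are charged to the command containing them:
-- those of a fixed program have bounded size, so this changes running
-- times by at most a constant factor.
data Run (W : ℕ) : Cmd → State → State → ℕ → Set where
  run-skip : ∀ {σ} → Run W skip σ σ 1
  run-var  : ∀ {σ x e} → Fits W σ e →
             Run W (x := e) σ (setVar x (eval σ e) σ) 1
  run-arr  : ∀ {σ x i e} → Fits W σ i → Fits W σ e →
             Run W (x ⁅ i ⁆:= e) σ (setArr x (eval σ i) (eval σ e) σ) 1
  run-seq  : ∀ {σ₁ σ₂ σ₃ c₁ c₂ t₁ t₂} →
             Run W c₁ σ₁ σ₂ t₁ → Run W c₂ σ₂ σ₃ t₂ →
             Run W (c₁ ⨾ c₂) σ₁ σ₃ (t₁ + t₂)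
  run-then : ∀ {σ σ′ e c₁ c₂ t} → Fits W σ e → eval σ e ≢ 0 →
             Run W c₁ σ σ′ t → Run W (branch e c₁ c₂) σ σ′ (suc t)
  run-else : ∀ {σ σ′ e c₁ c₂ t} → Fits W σ e → eval σ e ≡ 0 →
             Run W c₂ σ σ′ t → Run W (branch e c₁ c₂) σ σ′ (suc t)
  run-stop : ∀ {σ e c} → Fits W σ e → eval σ e ≡ 0 →
             Run W (while e c) σ σ 1
  run-loop : ∀ {σ₁ σ₂ σ₃ e c t₁ t₂} → Fits W σ₁ e → eval σ₁ e ≢ 0 →
             Run W c σ₁ σ₂ t₁ → Run W (while e c) σ₂ σ₃ t₂ →
             Run W (while e c) σ₁ σ₃ (suc (t₁ + t₂))

------------------------------------------------------------------------
-- The computational problem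

-- Row-major: cell toℕ u * n + toℕ v is 1 if u and v are adjacent, else 0.
adjacencyMatrix : ∀ {n} → Graph n → ℕ → ℕ
adjacencyMatrix {n} G m with m <? n * n
... | no  _ = 0
... | yes p = let (u , v) = remQuot {n} n (fromℕ< p) in bit (adj G u v)

-- Input: variable 0 holds n, variable 1 holds k, array 0 the graph.
input : ∀ {n} → Graph n → ℕ → State
input {n} G k = state (update (update (λ _ → 0) 1 k) 0 n)
                      (update (λ _ _ → 0) 0 (adjacencyMatrix G))

-- Output: variable 0 holds 0 for "none exists", or 1 and then array 1 holds
-- the class of each vertex.
Correct : ∀ {n} → Graph n → ℕ → State → Set
Correct {n} G k σ =
    (vars σ 0 ≡ 0 × ¬ (∃[ P ] IsGoodPartition {n} {k} G P))
  ⊎ (vars σ 0 ≡ 1 × (∃[ P ] (IsGoodPartition {n} {k} G P ×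
                             (∀ v → arrs σ 1 (toℕ v) ≡ toℕ (P v)))))

-- Words have c · log₂ (n + k) bits for some constant c.
FindsGoodPartitionWithin : Cmd → (ℕ → ℕ → ℕ) → Set
FindsGoodPartitionWithin p T =
  ∃[ c ] ∀ n k → .{{NonZero n}} → .{{NonZero k}} → (G : Graph n) →
    ∃[ σ ] ∃[ t ] (Run ((n + k) ^ c) p (input G k) σ t × t ≤ T n k × Correct G k σ)

-- Time bounds take the number n of vertices and the parameter k, both positive.
-- Every function ℕ → ℕ definable here is computable.
FixedParameterTractable : (ℕ → ℕ → ℕ) → Set
FixedParameterTractable T =
  Σ[ f ∈ (ℕ → ℕ) ] ∃[ c ] ∀ n k → .{{NonZero n}} → .{{NonZero k}} → T n k ≤ f k * n ^ c

_∈O_ : (ℕ → ℕ → ℕ) → (ℕ → ℕ → ℕ) → Set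
T ∈O g = ∃[ C ] ∀ n k → .{{NonZero n}} → .{{NonZero k}} → T n k ≤ C * g n k

-- Count modulo 2.  For X ⊆ S let B X S be the sum over X of the degrees in
-- S; it is the parity of the cut between X and S \ X, because edges inside X
-- count twice.  So a good k-partition is a sequence of k - 1 removals of sets
-- X with B X S odd, starting from the whole vertex set.  Each such X can be
-- shrunk to one or two of its vertices: the others can join the next class
-- or form a class of their own.  Hence it suffices to try sequences of k - 1
-- pairs of vertices.
--
-- To have few vertices to try, first remove greedily a set Y of at most
-- 2 (k - 1) vertices, one or two at a time, until a chain is complete or the
-- rest is a clique of odd vertices together with isolated ones.  True twins
-- are interchangeable, so pairs of twin classes are tried, Y's classes first
-- and at most 6 k - 1 in all.  If this cap is reached, then at least 2 k of
-- the classes lie in the clique or at least 2 k among the isolated vertices,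
-- and they are told apart by their neighbourhoods in Y.  Averaging over the
-- subsets X of Y yields a first removal X after which half of these isolated
-- vertices become odd, or half of the pairs into which these vertices of the
-- clique are grouped get different parities and give two removals each; so
-- no answer is missed.

module Submission where

open import Defs
open import Data.Nat using (ℕ; _+_; _*_; _^_)
open import Data.Product using (_×_; Σ-syntax)
open import Data.Bool using (Bool; true; false; T; not; _∧_; _∨_; _xor_; if_then_else_)
open import Data.Bool.Properties using (∧-identityʳ; ∧-zeroʳ; ∧-assoc; ∧-distribˡ-xor; ∧-distribʳ-xor; xor-same; xor-identityʳ; xor-assoc; xor-comm; not-involutive)
open import Data.Bool.Solver using (module xor-∧-Solver)
open import Data.Empty using (⊥; ⊥-elim)
open import Data.Fin as Fin using (Fin; toℕ; fromℕ<; combine; remQuot)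
open import Data.Fin.Permutation as Perm using (_⟨$⟩ʳ_; _⟨$⟩ˡ_; inverseˡ; inverseʳ)
open import Data.Fin.Properties using (toℕ-combine; remQuot-combine; toℕ-fromℕ<; fromℕ<-toℕ; toℕ<n; toℕ-injective)
open import Data.List as List using (List; []; _∷_; length)
open import Data.List.Properties using (length-map)
open import Data.List.Relation.Unary.All as All using (All; []; _∷_)
import Data.List.Relation.Unary.All.Properties as AllP
open import Data.List.Relation.Unary.AllPairs as AllPairs using (AllPairs; []; _∷_)
open import Data.Nat
open import Data.Nat.Divisibility using (_∣_; divides)
open import Data.Nat.Properties
open import Data.Nat.Tactic.RingSolver using (solve-∀)
open import Data.Product using (_,_; proj₁; proj₂; ∃-syntax)
open import Data.Sum using (_⊎_; inj₁; inj₂)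
open import Data.Unit using (⊤; tt)
open import Data.Vec using (lookup)
open import Data.Vec.Properties using (lookup∘tabulate)
open import Function using (_∘_; case_of_)
open import Relation.Binary.Definitions using (tri<; tri≈; tri>)
open import Relation.Binary.PropositionalEquality
open import Relation.Nullary using (¬_; yes; no; Dec; does)
open import Algebra.Properties.CommutativeMonoid.Sum +-0-commutativeMonoid using (sum)
open xor-∧-Solver using () renaming (solve to xor-solve; _:+_ to _⊕_; _:*_ to _⊗_; _:=_ to infix 4 _⊜_)

-- Parity sums

-- Removals are symmetric differences, so that degrees and cuts are linear over the field with two
-- elements and `B` is an alternating form.
--
-- When X is shrunk, let P be the class cut off next and A what remains after it. The leftover of X
-- can join P if it is even against A, and can form a class if it is odd against A and even against
-- P. Only a leftover odd against both is fatal, and two vertices suffice to avoid it.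
--
-- The averaging has to respect a constraint: the first removal must itself be an odd cut. This is
-- one linear equation; it is solved for a vertex that is odd in the whole graph, and it also turns
-- the parities in question into linear forms without constant term.
--
-- The search knows only class numbers. This is enough because twins share the parity of their
-- closed neighbourhoods at every stage, even after a representative has been removed, whereas the
-- degrees of a present and a removed twin differ. A sequence has 2 (k - 1) digits in a base of at
-- most 6 k, so the bound keeps a factor (6 k) ^ 2 for the quadratic work of checking one sequence.

⨁ : ℕ → (ℕ → Bool) → Bool
⨁ zero    f = false
⨁ (suc m) f = ⨁ m f xor f m

xor-interchange : ∀ p q r s → (p xor q) xor (r xor s) ≡ (p xor r) xor (q xor s)
xor-interchange = xor-solve 4 (λ p q r s → (p ⊕ q) ⊕ (r ⊕ s) ⊜ (p ⊕ r) ⊕ (q ⊕ s)) refl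

⨁-cong : ∀ m {f g} → (∀ i → i < m → f i ≡ g i) → ⨁ m f ≡ ⨁ m g
⨁-cong zero    f≡g = refl
⨁-cong (suc m) f≡g = cong₂ _xor_ (⨁-cong m λ i i<m → f≡g i (m<n⇒m<1+n i<m)) (f≡g m ≤-refl)

⨁-false : ∀ m {f} → (∀ i → i < m → f i ≡ false) → ⨁ m f ≡ false
⨁-false zero    f≡0 = refl
⨁-false (suc m) f≡0 =
  cong₂ _xor_ (⨁-false m λ i i<m → f≡0 i (m<n⇒m<1+n i<m)) (f≡0 m ≤-refl)

⨁-xor : ∀ m f g → ⨁ m (λ i → f i xor g i) ≡ ⨁ m f xor ⨁ m g
⨁-xor zero    f g = refl
⨁-xor (suc m) f g =
  trans (cong (_xor (f m xor g m)) (⨁-xor m f g)) (xor-interchange (⨁ m f) (⨁ m g) (f m) (g m))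

∧-⨁ : ∀ m b f → b ∧ ⨁ m f ≡ ⨁ m (λ i → b ∧ f i)
∧-⨁ zero    b f = ∧-zeroʳ b
∧-⨁ (suc m) b f = trans (∧-distribˡ-xor b (⨁ m f) (f m)) (cong (_xor (b ∧ f m)) (∧-⨁ m b f))

⨁-true : ∀ m {f} → ⨁ m f ≡ true → ∃[ i ] i < m × f i ≡ true
⨁-true (suc m) {f} eq with f m in fm
... | true = m , ≤-refl , fm
... | false with i , i<m , fi ← ⨁-true m (trans (sym (xor-identityʳ _)) eq) = i , m<n⇒m<1+n i<m , fi

⨁-single : ∀ m {f} j → j < m → (∀ i → i < m → i ≢ j → f i ≡ false) → ⨁ m f ≡ f j
⨁-single (suc m) {f} j j<m off with j ≟ m
... | yes refl = cong (_xor f m) (⨁-false m λ i i<m → off i (m<n⇒m<1+n i<m) (<⇒≢ i<m))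
... | no j≢m =
  trans (cong₂ _xor_ (⨁-single m j (≤∧≢⇒< (s≤s⁻¹ j<m) j≢m) λ i i<m → off i (m<n⇒m<1+n i<m))
                     (off m ≤-refl (j≢m ∘ sym)))
        (xor-identityʳ _)

-- The handshake argument: the entries at (i , j) and (j , i) cancel. In the induction the new row
-- equals the new column, and the new diagonal entry vanishes.
⨁-symmetric : ∀ m (h : ℕ → ℕ → Bool) → (∀ i j → h i j ≡ h j i) → (∀ i → h i i ≡ false) →
              ⨁ m (λ i → ⨁ m (h i)) ≡ false
⨁-symmetric zero    h h-sym h-diag = refl
⨁-symmetric (suc m) h h-sym h-diag = begin
  ⨁ m (λ i → ⨁ m (h i) xor h i m) xor (⨁ m (h m) xor h m m)
    ≡⟨ cong₂ _xor_ (⨁-xor m (λ i → ⨁ m (h i)) (λ i → h i m))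
                   (cong₂ _xor_ (⨁-cong m λ i _ → h-sym m i) (h-diag m)) ⟩
  (⨁ m (λ i → ⨁ m (h i)) xor ⨁ m (λ i → h i m)) xor (⨁ m (λ i → h i m) xor false)
    ≡⟨ cong (λ z → (z xor ⨁ m (λ i → h i m)) xor (⨁ m (λ i → h i m) xor false))
            (⨁-symmetric m h h-sym h-diag) ⟩
  ⨁ m (λ i → h i m) xor (⨁ m (λ i → h i m) xor false)
    ≡⟨ cong (⨁ m (λ i → h i m) xor_) (xor-identityʳ _) ⟩
  ⨁ m (λ i → h i m) xor ⨁ m (λ i → h i m)
    ≡⟨ xor-same (⨁ m λ i → h i m) ⟩
  false ∎
  where open ≡-Reasoning

∧-true : ∀ {p q} → p ∧ q ≡ true → p ≡ true × q ≡ true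
∧-true {true} {true} _ = refl , refl

-- Sets of vertices are functions ℕ → Bool, of which only the values below
-- the number of vertices matter.

infixl 6 _△_
_△_ : (ℕ → Bool) → (ℕ → Bool) → ℕ → Bool
(S △ X) v = S v xor X v

⟦_⟧ : ℕ → ℕ → Bool
⟦ t ⟧ v = v ≡ᵇ t

≡ᵇ-refl : ∀ m → (m ≡ᵇ m) ≡ true
≡ᵇ-refl zero    = refl
≡ᵇ-refl (suc m) = ≡ᵇ-refl m

≡ᵇ-sound : ∀ i j → (i ≡ᵇ j) ≡ true → i ≡ j
≡ᵇ-sound i j eq = ≡ᵇ⇒≡ i j (subst T (sym eq) tt)

≢⇒≡ᵇ : ∀ {i j} → i ≢ j → (i ≡ᵇ j) ≡ false
≢⇒≡ᵇ {i} {j} i≢j with i ≡ᵇ j in eq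
... | true  = ⊥-elim (i≢j (≡ᵇ-sound i j eq))
... | false = refl

bit≤1 : ∀ b → bit b ≤ 1
bit≤1 true  = ≤-refl
bit≤1 false = z≤n

<ᵇ-true : ∀ {i j} → i < j → (i <ᵇ j) ≡ true
<ᵇ-true {i} {j} i<j with i <ᵇ j | <⇒<ᵇ i<j
... | true | _ = refl

<ᵇ-false : ∀ {i j} → ¬ (i < j) → (i <ᵇ j) ≡ false
<ᵇ-false {i} {j} i≮j with i <ᵇ j in eq
... | true  = ⊥-elim (i≮j (<ᵇ⇒< i j (subst T (sym eq) tt)))
... | false = refl

<ᵇ-suc : ∀ i j → (i <ᵇ suc j) ≡ (i <ᵇ j) xor (i ≡ᵇ j)
<ᵇ-suc zero    zero    = refl
<ᵇ-suc zero    (suc j) = refl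
<ᵇ-suc (suc i) zero    = refl
<ᵇ-suc (suc i) (suc j) = <ᵇ-suc i j

xor-cancel : ∀ p q → (p xor q) xor q ≡ p
xor-cancel p q = trans (xor-assoc p q q) (trans (cong (p xor_) (xor-same q)) (xor-identityʳ p))

xor-agree : ∀ {p q} → ¬ (p xor q ≡ true) → p ≡ q
xor-agree {true}  {true}  _ = refl
xor-agree {false} {false} _ = refl
xor-agree {true}  {false} ¬e = ⊥-elim (¬e refl)
xor-agree {false} {true}  ¬e = ⊥-elim (¬e refl)

xor-differ : ∀ {p q} → p ≢ q → p xor q ≡ true
xor-differ {true}  {true}  p≢q = ⊥-elim (p≢q refl)
xor-differ {false} {false} p≢q = ⊥-elim (p≢q refl)
xor-differ {true}  {false} _   = refl
xor-differ {false} {true}  _   = refl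

-- Satisfying half of a list of linear forms

tally : {A : Set} → (A → ℕ) → List A → ℕ
tally f []       = 0
tally f (x ∷ xs) = f x + tally f xs

tally-cong : ∀ {A : Set} {f g : A → ℕ} {xs} → All (λ x → f x ≡ g x) xs → tally f xs ≡ tally g xs
tally-cong []       = refl
tally-cong (e ∷ es) = cong₂ _+_ e (tally-cong es)

+-interchange : ∀ p q r s → (p + q) + (r + s) ≡ (p + r) + (q + s)
+-interchange p q r s = begin
  (p + q) + (r + s) ≡⟨ +-assoc p q (r + s) ⟩
  p + (q + (r + s)) ≡⟨ cong (p +_) (trans (sym (+-assoc q r s)) (trans (cong (_+ s) (+-comm q r)) (+-assoc r q s))) ⟩
  p + (r + (q + s)) ≡⟨ sym (+-assoc p r (q + s)) ⟩
  (p + r) + (q + s) ∎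
  where open ≡-Reasoning

tally-+ : ∀ {A : Set} (f g : A → ℕ) xs → tally (λ x → f x + g x) xs ≡ tally f xs + tally g xs
tally-+ f g []       = refl
tally-+ f g (x ∷ xs) =
  trans (cong (f x + g x +_) (tally-+ f g xs)) (+-interchange (f x) (g x) (tally f xs) (tally g xs))

dot : ℕ → (ℕ → Bool) → (ℕ → Bool) → Bool
dot m X v = ⨁ m λ w → X w ∧ v w

-- The number of assignments of the first m coordinates that satisfy the
-- affine form with linear part v and constant part o.
solutions : ℕ → (ℕ → Bool) → Bool → ℕ
solutions zero    v o = bit o
solutions (suc m) v o = solutions m v o + solutions m v (v m xor o)

solutions-not : ∀ m v o → solutions m v o + solutions m v (not o) ≡ 2 ^ m
solutions-not zero    v false = refl
solutions-not zero    v true  = refl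
solutions-not (suc m) v o with v m
... | false = begin
  s + s + (s′ + s′) ≡⟨ +-interchange s s s′ s′ ⟩
  (s + s′) + (s + s′) ≡⟨ cong₂ _+_ (solutions-not m v o) (trans (solutions-not m v o) (sym (+-identityʳ _))) ⟩
  2 ^ suc m ∎
  where open ≡-Reasoning
        s = solutions m v o
        s′ = solutions m v (not o)
... | true = cong₂ _+_ (solutions-not m v o) (trans (solutions-not m v (not o)) (sym (+-identityʳ _)))

-- A coordinate with coefficient `true` pairs up the assignments so that exactly one of each pair
-- satisfies the form. Coordinates with coefficient `false` merely double the count, and the
-- constant form `true` is satisfied always.
half-solutions : ∀ m v o → o ≡ true ⊎ (∃[ w ] w < m × v w ≡ true) → 2 ^ m ≤ 2 * solutions m v o
half-solutions zero    v true _ = s≤s z≤n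
half-solutions zero    v false (inj₁ ())
half-solutions zero    v false (inj₂ (_ , () , _))
half-solutions (suc m) v o nz with v m in vm
... | true = *-monoʳ-≤ 2 (≤-reflexive (sym (solutions-not m v o)))
... | false = begin
  2 ^ suc m              ≤⟨ *-monoʳ-≤ 2 (half-solutions m v o (below nz)) ⟩
  2 * (2 * solutions m v o) ≡⟨ cong (2 *_) (cong (solutions m v o +_) (+-identityʳ _)) ⟩
  2 * (solutions m v o + solutions m v o) ∎
  where
  open ≤-Reasoning
  below : o ≡ true ⊎ (∃[ w ] w < suc m × v w ≡ true) → o ≡ true ⊎ (∃[ w ] w < m × v w ≡ true)
  below (inj₁ e) = inj₁ e
  below (inj₂ (w , w<1+m , vw)) = inj₂ (w , ≤∧≢⇒< (s≤s⁻¹ w<1+m) (λ { refl → case trans (sym vm) vw of λ () }) , vw)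

module _ {A : Set} (vec : A → ℕ → Bool) where

  -- The method of conditional expectations: divided by `2 ^ m`, the left side is the expected
  -- number of satisfied forms under a random assignment. Fixing the last coordinate moves its
  -- coefficient into the constant (`off₁`), and the better of the two values does at least as well
  -- as their mean.
  average : ∀ m xs (off : A → Bool) →
            ∃[ X ] tally (λ x → solutions m (vec x) (off x)) xs
                   ≤ 2 ^ m * tally (λ x → bit (dot m X (vec x) xor off x)) xs
  average zero xs off = (λ _ → false) , ≤-reflexive (sym (+-identityʳ _))
  average (suc m) xs off =
    pick-larger (≤-total (total X₁ off₁) (total X₀ off))
    where
    off₁ : A → Bool
    off₁ x = vec x m xor off x
    X₀ = proj₁ (average m xs off)
    X₁ = proj₁ (average m xs off₁)
    total : (ℕ → Bool) → (A → Bool) → ℕ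
    total X off′ = tally (λ x → bit (dot m X (vec x) xor off′ x)) xs
    extend : Bool → (ℕ → Bool) → ℕ → Bool
    extend b X w = if w ≡ᵇ m then b else X w
    lhs : tally (λ x → solutions (suc m) (vec x) (off x)) xs ≤ 2 ^ m * total X₀ off + 2 ^ m * total X₁ off₁
    lhs = ≤-trans (≤-reflexive (tally-+ (λ x → solutions m (vec x) (off x)) (λ x → solutions m (vec x) (off₁ x)) xs))
                  (+-mono-≤ (proj₂ (average m xs off)) (proj₂ (average m xs off₁)))
    unchanged : ∀ b X v → dot m (extend b X) v ≡ dot m X v
    unchanged b X v = ⨁-cong m λ w w<m → cong (λ z → (if z then b else X w) ∧ v w) (≢⇒≡ᵇ {w} {m} (<⇒≢ w<m))
    last-bit : ∀ b X → extend b X m ≡ b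
    last-bit b X = cong (if_then b else X m) (≡ᵇ-refl m)
    value : ∀ b X v o → dot (suc m) (extend b X) v xor o ≡ dot m X v xor ((b ∧ v m) xor o)
    value b X v o =
      trans (cong₂ (λ p q → (p xor (q ∧ v m)) xor o) (unchanged b X v) (last-bit b X))
            (xor-assoc (dot m X v) (b ∧ v m) o)
    double : ∀ p q r → p ≤ q → r ≤ 2 ^ m * p + 2 ^ m * q → r ≤ 2 ^ suc m * q
    double p q r p≤q r≤ = begin
      r                        ≤⟨ r≤ ⟩
      2 ^ m * p + 2 ^ m * q    ≤⟨ +-monoˡ-≤ (2 ^ m * q) (*-monoʳ-≤ (2 ^ m) p≤q) ⟩
      2 ^ m * q + 2 ^ m * q    ≡⟨ sym (*-distribʳ-+ q (2 ^ m) (2 ^ m)) ⟩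
      (2 ^ m + 2 ^ m) * q      ≡⟨ cong (λ z → (2 ^ m + z) * q) (sym (+-identityʳ (2 ^ m))) ⟩
      2 ^ suc m * q            ∎
      where open ≤-Reasoning
    pick-larger : total X₁ off₁ ≤ total X₀ off ⊎ total X₀ off ≤ total X₁ off₁ →
      ∃[ X ] tally (λ x → solutions (suc m) (vec x) (off x)) xs
             ≤ 2 ^ suc m * tally (λ x → bit (dot (suc m) X (vec x) xor off x)) xs
    pick-larger (inj₁ ≤₀) = extend false X₀ , (begin
      _ ≤⟨ double _ _ _ ≤₀ (≤-trans lhs (≤-reflexive (+-comm (2 ^ m * total X₀ off) _))) ⟩
      2 ^ suc m * total X₀ off
        ≡⟨ cong (2 ^ suc m *_) (tally-cong (All.universal (λ x → cong bit (sym (value false X₀ (vec x) (off x)))) xs)) ⟩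
      _ ∎)
      where open ≤-Reasoning
    pick-larger (inj₂ ≤₁) = extend true X₁ , (begin
      _ ≤⟨ double _ _ _ ≤₁ lhs ⟩
      2 ^ suc m * total X₁ off₁
        ≡⟨ cong (2 ^ suc m *_) (tally-cong (All.universal (λ x → cong bit (sym (value true X₁ (vec x) (off x)))) xs)) ⟩
      _ ∎)
      where open ≤-Reasoning

  half : ∀ m xs (off : A → Bool) →
         All (λ x → off x ≡ true ⊎ (∃[ w ] w < m × vec x w ≡ true)) xs →
         ∃[ X ] length xs ≤ 2 * tally (λ x → bit (dot m X (vec x) xor off x)) xs
  half m xs off nz = proj₁ avg , *-cancelˡ-≤ (2 ^ m) {{m^n≢0 2 m}} (begin
    2 ^ m * length xs      ≤⟨ each xs nz ⟩
    2 * tally (λ x → solutions m (vec x) (off x)) xs ≤⟨ *-monoʳ-≤ 2 (proj₂ avg) ⟩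
    2 * (2 ^ m * s (proj₁ avg))   ≡⟨ trans (sym (*-assoc 2 (2 ^ m) (s (proj₁ avg))))
                             (trans (cong (_* s (proj₁ avg)) (*-comm 2 (2 ^ m))) (*-assoc (2 ^ m) 2 (s (proj₁ avg)))) ⟩
    2 ^ m * (2 * s (proj₁ avg))   ∎)
    where
    open ≤-Reasoning
    avg = average m xs off
    s : (ℕ → Bool) → ℕ
    s X = tally (λ x → bit (dot m X (vec x) xor off x)) xs
    each : ∀ ys → All (λ x → off x ≡ true ⊎ (∃[ w ] w < m × vec x w ≡ true)) ys →
           2 ^ m * length ys ≤ 2 * tally (λ x → solutions m (vec x) (off x)) ys
    each []       []       = ≤-trans (≤-reflexive (*-zeroʳ (2 ^ m))) z≤n
    each (y ∷ ys) (p ∷ ps) = begin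
      2 ^ m * suc (length ys) ≡⟨ *-suc (2 ^ m) (length ys) ⟩
      2 ^ m + 2 ^ m * length ys ≤⟨ +-mono-≤ (half-solutions m (vec y) (off y) p) (each ys ps) ⟩
      2 * solutions m (vec y) (off y) + 2 * tally (λ x → solutions m (vec x) (off x)) ys
        ≡⟨ sym (*-distribˡ-+ 2 (solutions m (vec y) (off y)) _) ⟩
      _ ∎

-- The equation dot m X τ ≡ true is solved for the coordinate t₀.
half-with : ∀ {A : Set} (vec : A → ℕ → Bool) m xs τ t₀ → t₀ < m → τ t₀ ≡ true →
            All (λ x → ∃[ w ] w < m × vec x w ≡ true) xs →
            ∃[ X ] dot m X τ ≡ true × length xs ≤ 2 * tally (λ x → bit (dot m X (vec x))) xs
half-with {A} vec m xs τ t₀ t₀<m τt₀ nz = adjust (half (λ x w → vec x w xor (vec x t₀ ∧ τ w)) m xs (λ x → vec x t₀) (All.map (λ {x} → nonzero x) nz))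
  where
  -- `half` is applied to the forms `vec x` with the constraint substituted for coordinate t₀: their
  -- coefficient at t₀ is `false` and their constant is `vec x t₀`. `X′` then flips t₀ exactly when
  -- the constraint fails, and on `X′` the original form takes the value of the substituted one.
  X′ : (ℕ → Bool) → ℕ → Bool
  X′ X w = X w xor (not (dot m X τ) ∧ ⟦ t₀ ⟧ w)
  nonzero : ∀ x → (∃[ w ] w < m × vec x w ≡ true) →
            vec x t₀ ≡ true ⊎ (∃[ w ] w < m × vec x w xor (vec x t₀ ∧ τ w) ≡ true)
  nonzero x (w , w<m , eq) with vec x t₀
  ... | true  = inj₁ refl
  ... | false = inj₂ (w , w<m , trans (xor-identityʳ _) eq)
  complement : ∀ p → p xor (not p ∧ true) ≡ true
  complement false = refl
  complement true  = refl
  regroup : ∀ p q r → (p xor (q ∧ r)) xor q ≡ p xor (not r ∧ q)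
  regroup false false false = refl
  regroup false false true  = refl
  regroup false true  false = refl
  regroup false true  true  = refl
  regroup true  false false = refl
  regroup true  false true  = refl
  regroup true  true  false = refl
  regroup true  true  true  = refl
  expand : ∀ X v b → dot m X (λ w → v w xor (b ∧ τ w)) ≡ dot m X v xor (b ∧ dot m X τ)
  expand X v b =
    trans (⨁-cong m λ w _ → distribute (X w) (v w) b (τ w))
          (trans (⨁-xor m (λ w → X w ∧ v w) (λ w → b ∧ (X w ∧ τ w)))
                 (cong (dot m X v xor_) (sym (∧-⨁ m b (λ w → X w ∧ τ w)))))
    where
    distribute : ∀ p q r s → p ∧ (q xor (r ∧ s)) ≡ (p ∧ q) xor (r ∧ (p ∧ s))
    distribute = xor-solve 4 (λ p q r s → p ⊗ (q ⊕ (r ⊗ s)) ⊜ (p ⊗ q) ⊕ (r ⊗ (p ⊗ s))) refl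
  dot-X′ : ∀ X v → dot m (X′ X) v ≡ dot m X v xor (not (dot m X τ) ∧ v t₀)
  dot-X′ X v =
    trans (⨁-cong m λ w _ → distribute (X w) c (⟦ t₀ ⟧ w) (v w))
          (trans (⨁-xor m (λ w → X w ∧ v w) (λ w → c ∧ (⟦ t₀ ⟧ w ∧ v w)))
                 (cong (dot m X v xor_) (trans (sym (∧-⨁ m c (λ w → ⟦ t₀ ⟧ w ∧ v w)))
                   (cong (c ∧_) (trans (⨁-single m t₀ t₀<m λ w _ w≢t₀ → cong (_∧ v w) (≢⇒≡ᵇ {w} {t₀} w≢t₀))
                                       (cong (_∧ v t₀) (≡ᵇ-refl t₀)))))))
    where
    c = not (dot m X τ)
    distribute : ∀ p c q s → (p xor (c ∧ q)) ∧ s ≡ (p ∧ s) xor (c ∧ (q ∧ s))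
    distribute = xor-solve 4 (λ p c q s → (p ⊕ (c ⊗ q)) ⊗ s ⊜ (p ⊗ s) ⊕ (c ⊗ (q ⊗ s))) refl
  adjust : (∃[ X ] length xs ≤ 2 * tally (λ x → bit (dot m X (λ w → vec x w xor (vec x t₀ ∧ τ w)) xor vec x t₀)) xs) →
           ∃[ X ] dot m X τ ≡ true × length xs ≤ 2 * tally (λ x → bit (dot m X (vec x))) xs
  adjust (X , bound) =
    X′ X
    , trans (dot-X′ X τ) (trans (cong (λ z → dot m X τ xor (not (dot m X τ) ∧ z)) τt₀) (complement (dot m X τ)))
    , ≤-trans bound (≤-reflexive (cong (2 *_) (tally-cong (All.universal (λ x → cong bit
        (trans (cong (_xor vec x t₀) (expand X (vec x) (vec x t₀)))
               (trans (regroup (dot m X (vec x)) (vec x t₀) (dot m X τ)) (sym (dot-X′ X (vec x)))))) xs))))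

-- Counting below a bound, and splitting lists

count : ℕ → (ℕ → Bool) → ℕ
count zero    f = 0
count (suc m) f = count m f + bit (f m)

count-cong : ∀ m {f g} → (∀ i → i < m → f i ≡ g i) → count m f ≡ count m g
count-cong zero    f≡g = refl
count-cong (suc m) f≡g = cong₂ (λ p q → p + bit q) (count-cong m λ i i<m → f≡g i (m<n⇒m<1+n i<m)) (f≡g m ≤-refl)

count-zero : ∀ m {f} → (∀ i → i < m → f i ≡ false) → count m f ≡ 0
count-zero zero    _   = refl
count-zero (suc m) f≡0 = cong₂ (λ p q → p + bit q) (count-zero m λ i i<m → f≡0 i (m<n⇒m<1+n i<m)) (f≡0 m ≤-refl)

count-remove : ∀ m {f} j → j < m → f j ≡ true → count m f ≡ suc (count m (f △ ⟦ j ⟧))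
count-remove (suc m) {f} j j<1+m fj with j ≟ m
... | yes refl = trans (cong₂ (λ p q → p + bit q) (count-cong m λ i i<m →
                   sym (trans (cong (f i xor_) (≢⇒≡ᵇ {i} {m} (<⇒≢ i<m))) (xor-identityʳ (f i)))) fj)
                 (trans (+-comm _ 1) (cong suc (sym (trans (cong (λ z → count m (f △ ⟦ m ⟧) + bit z)
                   (cong₂ _xor_ fj (≡ᵇ-refl m))) (+-identityʳ _)))))
... | no j≢m = cong₂ _+_ (count-remove m j (≤∧≢⇒< (s≤s⁻¹ j<1+m) j≢m) fj)
                 (cong bit (sym (trans (cong (f m xor_) (≢⇒≡ᵇ {m} {j} (j≢m ∘ sym))) (xor-identityʳ (f m)))))

count-insert : ∀ m {f} j → j < m → f j ≡ false → count m (f △ ⟦ j ⟧) ≡ suc (count m f)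
count-insert m {f} j j<m fj = trans (count-remove m j j<m (cong₂ _xor_ fj (≡ᵇ-refl j)))
  (cong suc (count-cong m λ i _ → xor-cancel (f i) (⟦ j ⟧ i)))

count-⊆ : ∀ m {f g} → (∀ i → i < m → f i ≡ true → g i ≡ true) → count m f ≤ count m g
count-⊆ zero    f⊆g = z≤n
count-⊆ (suc m) {f} {g} f⊆g = +-mono-≤ (count-⊆ m λ i i<m → f⊆g i (m<n⇒m<1+n i<m)) (last (f m) (g m) (f⊆g m ≤-refl))
  where
  last : ∀ p q → (p ≡ true → q ≡ true) → bit p ≤ bit q
  last false q     _ = z≤n
  last true  true  _ = ≤-refl
  last true  false p⇒q = case p⇒q refl of λ ()

length≤count : ∀ m {f} xs → AllPairs _≢_ xs → All (λ x → x < m × f x ≡ true) xs → length xs ≤ count m f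
length≤count m []       _          _                   = z≤n
length≤count m {f} (x ∷ xs) (x∉xs ∷ xs!) ((x<m , fx) ∷ xs∈) =
  ≤-trans (s≤s (length≤count m xs xs! (All.zipWith still (x∉xs , xs∈))))
          (≤-reflexive (sym (count-remove m x x<m fx)))
  where
  still : ∀ {y} → (x ≢ y) × (y < m × f y ≡ true) → y < m × (f △ ⟦ x ⟧) y ≡ true
  still {y} (x≢y , y<m , fy) = y<m , trans (cong₂ _xor_ fy (≢⇒≡ᵇ {y} {x} (x≢y ∘ sym))) refl

-- The polymorphic component carries any property of all of `xs` over to the chosen element and to
-- the others, so that a caller can transfer properties that are unknown here. `split-by` uses the
-- same device.
take-out : ∀ {R : ℕ → ℕ → Set} → (∀ {x y} → R x y → R y x) → (f : ℕ → Bool) → ∀ xs → AllPairs R xs →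
  All (λ x → f x ≡ false) xs ⊎
  (∃[ e ] ∃[ ys ] f e ≡ true × (∀ {Q : ℕ → Set} → All Q xs → Q e × All Q ys)
                × All (R e) ys × AllPairs R ys × length xs ≡ suc (length ys))
take-out R-sym f []       _          = inj₁ []
take-out R-sym f (x ∷ xs) (x# ∷ xs#) with f x in fx
... | true  = inj₂ (x , xs , fx , (λ { (q ∷ qs) → q , qs }) , x# , xs# , refl)
... | false with take-out R-sym f xs xs#
...   | inj₁ none = inj₁ (fx ∷ none)
...   | inj₂ (e , ys , fe , restrict , e# , ys# , len) =
  inj₂ (e , x ∷ ys , fe , (λ { (q ∷ qs) → proj₁ (restrict qs) , q ∷ proj₂ (restrict qs) })
       , R-sym (proj₁ (restrict x#)) ∷ e# , proj₂ (restrict x#) ∷ ys# , cong suc len)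

pairs : List ℕ → List (ℕ × ℕ)
pairs (x ∷ y ∷ xs) = (x , y) ∷ pairs xs
pairs _            = []

length≤pairs : ∀ xs → length xs ≤ suc (2 * length (pairs xs))
length≤pairs []           = z≤n
length≤pairs (_ ∷ [])     = s≤s z≤n
length≤pairs (_ ∷ _ ∷ xs) =
  ≤-trans (s≤s (s≤s (length≤pairs xs))) (≤-reflexive (cong suc (sym (*-suc 2 (length (pairs xs))))))

pairs-All : ∀ {R : ℕ → ℕ → Set} {P : ℕ → Set} {xs} → All P xs → AllPairs R xs →
            All (λ (x , y) → P x × P y × R x y) (pairs xs)
pairs-All []             _                       = []
pairs-All (_ ∷ [])       _                       = []
pairs-All (px ∷ py ∷ ps) ((xy ∷ _) ∷ (_ ∷ ps#)) = (px , py , xy) ∷ pairs-All ps ps#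

pairs-All₂ : ∀ {Q : ℕ → Set} {xs} → All Q xs → All (λ (x , y) → Q x × Q y) (pairs xs)
pairs-All₂ []           = []
pairs-All₂ (_ ∷ [])     = []
pairs-All₂ (p ∷ q ∷ qs) = (p , q) ∷ pairs-All₂ qs

pairs-AllPairs : ∀ {R : ℕ → ℕ → Set} {xs} → AllPairs R xs →
  AllPairs (λ (x , y) (x′ , y′) → (R x x′ × R x y′) × (R y x′ × R y y′)) (pairs xs)
pairs-AllPairs []                      = []
pairs-AllPairs (_ ∷ [])                = []
pairs-AllPairs ((_ ∷ x#) ∷ (y# ∷ xs#)) =
  All.zipWith (λ p → p) (pairs-All₂ x# , pairs-All₂ y#) ∷ pairs-AllPairs xs#

split-by : ∀ {R : ℕ → ℕ → Set} (f : ℕ → Bool) xs → AllPairs R xs →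
  ∃[ ys ] ∃[ zs ] (∀ {Q : ℕ → Set} → All Q xs → All Q ys × All Q zs) ×
                  (AllPairs R ys × All (λ y → f y ≡ true) ys) ×
                  (AllPairs R zs × All (λ z → f z ≡ false) zs) ×
                  length xs ≡ length ys + length zs
split-by f []       _          = [] , [] , (λ _ → [] , []) , ([] , []) , ([] , []) , refl
split-by f (x ∷ xs) (x# ∷ xs#) with split-by f xs xs# | f x in fx
... | ys , zs , restrict , (ys# , fys) , (zs# , fzs) , len | true =
  x ∷ ys , zs , (λ { (q ∷ qs) → q ∷ proj₁ (restrict qs) , proj₂ (restrict qs) })
  , (proj₁ (restrict x#) ∷ ys# , fx ∷ fys) , (zs# , fzs) , cong suc len
... | ys , zs , restrict , (ys# , fys) , (zs# , fzs) , len | false =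
  ys , x ∷ zs , (λ { (q ∷ qs) → proj₁ (restrict qs) , q ∷ proj₂ (restrict qs) })
  , (ys# , fys) , (proj₂ (restrict x#) ∷ zs# , fx ∷ fzs) , trans (cong suc len) (sym (+-suc (length ys) (length zs)))

tally-map : ∀ {A C : Set} (f : C → ℕ) (g : A → C) xs → tally f (List.map g xs) ≡ tally (λ x → f (g x)) xs
tally-map f g []       = refl
tally-map f g (x ∷ xs) = cong (f (g x) +_) (tally-map f g xs)

AllPairs-with : ∀ {R R′ : ℕ → ℕ → Set} {Q : ℕ → Set} → (∀ {x y} → R x y → Q x → Q y → R′ x y) →
                ∀ {xs} → AllPairs R xs → All Q xs → AllPairs R′ xs
AllPairs-with f []         _        = []
AllPairs-with f (x# ∷ xs#) (q ∷ qs) = All.zipWith (λ (r , q′) → f r q q′) (x# , qs) ∷ AllPairs-with f xs# qs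

-- Defined by recursion so that `dbl (suc l)` reduces to two successors: round l of a sequence owns
-- the positions `dbl l` and `suc (dbl l)` by computation.
dbl : ℕ → ℕ
dbl zero    = zero
dbl (suc l) = suc (suc (dbl l))

dbl≡+ : ∀ l → dbl l ≡ l + l
dbl≡+ zero    = refl
dbl≡+ (suc l) = cong suc (trans (cong suc (dbl≡+ l)) (sym (+-suc l l)))

dbl-mono-≤ : ∀ {l m} → l ≤ m → dbl l ≤ dbl m
dbl-mono-≤ z≤n     = z≤n
dbl-mono-≤ (s≤s p) = s≤s (s≤s (dbl-mono-≤ p))

count-≤ : ∀ m f → count m f ≤ m
count-≤ zero    f = z≤n
count-≤ (suc m) f with f m
... | true  = ≤-trans (≤-reflexive (+-comm (count m f) 1)) (s≤s (count-≤ m f))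
... | false = ≤-trans (≤-reflexive (+-identityʳ _)) (m≤n⇒m≤1+n (count-≤ m f))

-- A monotone `f` is determined by the place where it switches, and the number of its `true` levels
-- from 1 to m tells this place. It recovers from the class number of a vertex whether the vertex
-- survives the first l rounds.
count-threshold : ∀ m f → (∀ l → f l ≡ true → f (suc l) ≡ true) → f 0 ≡ false →
                  ∀ l → l ≤ m → (count m (f ∘ suc) <ᵇ suc (m ∸ l)) ≡ not (f l)
count-threshold m f up f0 l l≤m with f l in fl
... | false = <ᵇ-true (s≤s (upper m l≤m))
  where
  stays : ∀ i → i ≤′ l → f i ≡ false
  stays i ≤′-refl = fl
  stays i i≤l with f i in fi
  ... | false = refl
  ... | true  = case trans (sym fl) (later i≤l fi) of λ ()
    where
    later : ∀ {i j} → i ≤′ j → f i ≡ true → f j ≡ true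
    later ≤′-refl       e = e
    later (≤′-step i≤j) e = up _ (later i≤j e)
  low : ∀ j → j ≤ l → count j (f ∘ suc) ≡ 0
  low zero    _   = refl
  low (suc j) j<l = trans (cong₂ (λ p q → p + bit q) (low j (<⇒≤ j<l)) (stays (suc j) (≤⇒≤′ j<l))) refl
  upper : ∀ m → l ≤ m → count m (f ∘ suc) ≤ m ∸ l
  upper m l≤m with m≤n⇒m<n∨m≡n l≤m
  ... | inj₂ refl = ≤-trans (≤-reflexive (low l ≤-refl)) z≤n
  upper (suc m) l≤m | inj₁ l<1+m = begin
    count m (f ∘ suc) + bit (f (suc m)) ≤⟨ +-mono-≤ (upper m (s≤s⁻¹ l<1+m)) (bit≤1 (f (suc m))) ⟩
    (m ∸ l) + 1                         ≡⟨ trans (+-comm (m ∸ l) 1) (sym (+-∸-assoc 1 (s≤s⁻¹ l<1+m))) ⟩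
    suc m ∸ l                           ∎
    where
    open ≤-Reasoning
... | true = <ᵇ-false (≤⇒≯ (lower l l≤m fl))
  where
  later : ∀ {i j} → i ≤′ j → f i ≡ true → f j ≡ true
  later ≤′-refl       e = e
  later (≤′-step i≤j) e = up _ (later i≤j e)
  lower : ∀ l → l ≤ m → f l ≡ true → suc (m ∸ l) ≤ count m (f ∘ suc)
  lower zero    _   e = case trans (sym f0) e of λ ()
  lower (suc l) l<m e = go m l<m
    where
    go : ∀ m → suc l ≤ m → suc (m ∸ suc l) ≤ count m (f ∘ suc)
    go (suc m) (s≤s l≤m) with m≤n⇒m<n∨m≡n l≤m
    ... | inj₂ refl = begin
      suc (l ∸ l) ≡⟨ cong suc (n∸n≡0 l) ⟩
      1           ≡⟨ cong bit (sym e) ⟩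
      bit (f (suc l)) ≤⟨ m≤n+m _ _ ⟩
      count l (f ∘ suc) + bit (f (suc l)) ∎
      where open ≤-Reasoning
    go (suc m) (s≤s l≤m) | inj₁ l<m = begin
      suc (m ∸ l)             ≡⟨ cong suc (+-∸-assoc 1 l<m) ⟩
      suc (suc (m ∸ suc l))   ≤⟨ s≤s (go m l<m) ⟩
      suc (count m (f ∘ suc)) ≡⟨ +-comm 1 _ ⟩
      count m (f ∘ suc) + 1   ≡⟨ cong (λ z → count m (f ∘ suc) + bit z) (sym (later (≤⇒≤′ (s≤s (<⇒≤ l<m))) e)) ⟩
      count m (f ∘ suc) + bit (f (suc m)) ∎
      where open ≤-Reasoning

update-other : ∀ {A : Set} (f : ℕ → A) x v y → (y ≡ᵇ x) ≡ false → update f x v y ≡ f y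
update-other f x v y e = cong (if_then v else f y) e

update-same : ∀ {A : Set} (f : ℕ → A) x v → update f x v x ≡ v
update-same f x v = cong (if_then v else f x) (≡ᵇ-refl x)

-- Cuts modulo 2 as an alternating bilinear form

module Parity
  (n : ℕ) (a : ℕ → ℕ → Bool)
  (a-sym : ∀ u v → a u v ≡ a v u)
  (a-irr : ∀ v → a v v ≡ false)
  (a-out : ∀ u v → n ≤ u → a u v ≡ false) where

  infix 4 _≐_
  _≐_ : (ℕ → Bool) → (ℕ → Bool) → Set
  S ≐ S′ = ∀ v → v < n → S v ≡ S′ v

  infix 4 _⊑_
  _⊑_ : (ℕ → Bool) → (ℕ → Bool) → Set
  X ⊑ S = ∀ v → v < n → X v ≡ true → S v ≡ true

  deg : (ℕ → Bool) → ℕ → Bool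
  deg S v = ⨁ n λ w → S w ∧ a v w

  -- For X ⊑ S the edges inside X are counted twice, so that B X S is the
  -- parity of the cut between X and S △ X.
  B : (ℕ → Bool) → (ℕ → Bool) → Bool
  B X S = ⨁ n λ v → X v ∧ deg S v

  deg-cong : ∀ {S S′} v → S ≐ S′ → deg S v ≡ deg S′ v
  deg-cong v S≐S′ = ⨁-cong n λ w w<n → cong (_∧ a v w) (S≐S′ w w<n)

  deg-△ : ∀ S X v → deg (S △ X) v ≡ deg S v xor deg X v
  deg-△ S X v = trans (⨁-cong n λ w _ → ∧-distribʳ-xor (a v w) (S w) (X w))
                      (⨁-xor n (λ w → S w ∧ a v w) (λ w → X w ∧ a v w))

  deg-ghost : ∀ S v → n ≤ v → deg S v ≡ false
  deg-ghost S v n≤v = ⨁-false n λ w _ → trans (cong (S w ∧_) (a-out v w n≤v)) (∧-zeroʳ (S w))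

  deg-single : ∀ t v → deg ⟦ t ⟧ v ≡ a v t
  deg-single t v with t <? n
  ... | yes t<n = trans (⨁-single n t t<n λ w _ w≢t → cong (_∧ a v w) (≢⇒≡ᵇ {w} {t} w≢t))
                        (cong (_∧ a v t) (≡ᵇ-refl t))
  ... | no t≮n =
    trans (⨁-false n λ w w<n → cong (_∧ a v w) (≢⇒≡ᵇ {w} {t} λ { refl → t≮n w<n }))
          (sym (trans (a-sym v t) (a-out t v (≮⇒≥ t≮n))))

  B-cong : ∀ {X X′ S S′} → X ≐ X′ → S ≐ S′ → B X S ≡ B X′ S′
  B-cong X≐X′ S≐S′ = ⨁-cong n λ v v<n → cong₂ _∧_ (X≐X′ v v<n) (deg-cong v S≐S′)

  B-△ˡ : ∀ X Y S → B (X △ Y) S ≡ B X S xor B Y S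
  B-△ˡ X Y S = trans (⨁-cong n λ v _ → ∧-distribʳ-xor (deg S v) (X v) (Y v))
                     (⨁-xor n (λ v → X v ∧ deg S v) (λ v → Y v ∧ deg S v))

  B-△ʳ : ∀ X S Y → B X (S △ Y) ≡ B X S xor B X Y
  B-△ʳ X S Y =
    trans (⨁-cong n λ v _ → trans (cong (X v ∧_) (deg-△ S Y v)) (∧-distribˡ-xor (X v) (deg S v) (deg Y v)))
          (⨁-xor n (λ v → X v ∧ deg S v) (λ v → X v ∧ deg Y v))

  B-self : ∀ X → B X X ≡ false
  B-self X =
    trans (⨁-cong n λ v _ → ∧-⨁ n (X v) (λ w → X w ∧ a v w))
          (⨁-symmetric n (λ v w → X v ∧ X w ∧ a v w)
            (λ v w → trans (cong (λ z → X v ∧ X w ∧ z) (a-sym v w)) (swap (X v) (X w) (a w v)))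
            (λ v → trans (cong (λ z → X v ∧ X v ∧ z) (a-irr v))
                         (trans (cong (X v ∧_) (∧-zeroʳ (X v))) (∧-zeroʳ (X v)))))
    where
    swap : ∀ p q r → p ∧ q ∧ r ≡ q ∧ p ∧ r
    swap = xor-solve 3 (λ p q r → p ⊗ (q ⊗ r) ⊜ q ⊗ (p ⊗ r)) refl

  -- Polarisation: expanding the vanishing `B (Y △ X) (Y △ X)` leaves just the two mixed terms.
  B-sym : ∀ X Y → B X Y ≡ B Y X
  B-sym X Y = cancel (begin
    B X Y xor B Y X
      ≡⟨ cong₂ _xor_ (sym (xor-identityʳ (B X Y))) refl ⟩
    (B X Y xor false) xor B Y X
      ≡⟨ cong₂ (λ p q → (B X Y xor p) xor q) (sym (B-self X)) (sym (trans (cong (_xor B Y X) (B-self Y)) refl)) ⟩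
    (B X Y xor B X X) xor (B Y Y xor B Y X)
      ≡⟨ cong₂ _xor_ (sym (B-△ʳ X Y X)) (sym (B-△ʳ Y Y X)) ⟩
    B X (Y △ X) xor B Y (Y △ X)
      ≡⟨ rearrange (B X (Y △ X)) (B Y (Y △ X)) ⟩
    B Y (Y △ X) xor B X (Y △ X)
      ≡⟨ sym (B-△ˡ Y X (Y △ X)) ⟩
    B (Y △ X) (Y △ X)
      ≡⟨ B-self (Y △ X) ⟩
    false ∎)
    where
    open ≡-Reasoning
    cancel : ∀ {p q} → p xor q ≡ false → p ≡ q
    cancel {false} {false} _ = refl
    cancel {true}  {true}  _ = refl
    rearrange : ∀ p q → p xor q ≡ q xor p
    rearrange = xor-solve 2 (λ p q → p ⊕ q ⊜ q ⊕ p) refl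

  B-singleˡ : ∀ t S → B ⟦ t ⟧ S ≡ deg S t
  B-singleˡ t S with t <? n
  ... | yes t<n = trans (⨁-single n t t<n λ w _ w≢t → cong (_∧ deg S w) (≢⇒≡ᵇ {w} {t} w≢t))
                        (cong (_∧ deg S t) (≡ᵇ-refl t))
  ... | no t≮n =
    trans (⨁-false n λ w w<n → cong (_∧ deg S w) (≢⇒≡ᵇ {w} {t} λ { refl → t≮n w<n }))
          (sym (deg-ghost S t (≮⇒≥ t≮n)))

  B-true : ∀ {X S} → B X S ≡ true → ∃[ t ] t < n × X t ≡ true × deg S t ≡ true
  B-true eq with t , t<n , both ← ⨁-true n eq = t , t<n , ∧-true both

  -- Chain U S r: starting from S, one can cut off r sets consisting of
  -- vertices in U, each by an odd cut; this is a good (r + 1)-partition of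
  -- S listed from its last class.

  data Chain (U : ℕ → Set) : (ℕ → Bool) → ℕ → Set where
    []  : ∀ {S} → Chain U S 0
    cut : ∀ {S r} X → X ⊑ S → (∀ v → v < n → X v ≡ true → U v) → B X S ≡ true →
          Chain U (S △ X) r → Chain U S (suc r)

  △-cong : ∀ {S S′ X X′} → S ≐ S′ → X ≐ X′ → S △ X ≐ S′ △ X′
  △-cong S≐S′ X≐X′ v v<n = cong₂ _xor_ (S≐S′ v v<n) (X≐X′ v v<n)

  Chain-cong : ∀ {U S S′ r} → S ≐ S′ → Chain U S r → Chain U S′ r
  Chain-cong S≐S′ [] = []
  Chain-cong S≐S′ (cut X X⊑S X⊆U odd rest) =
    cut X (λ v v<n Xv → trans (sym (S≐S′ v v<n)) (X⊑S v v<n Xv)) X⊆U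
        (trans (sym (B-cong (λ _ _ → refl) S≐S′)) odd)
        (Chain-cong (△-cong S≐S′ (λ _ _ → refl)) rest)

  Chain-mono : ∀ {U U′ S r} → (∀ v → v < n → U v → U′ v) → Chain U S r → Chain U′ S r
  Chain-mono U⊆U′ [] = []
  Chain-mono U⊆U′ (cut X X⊑S X⊆U odd rest) =
    cut X X⊑S (λ v v<n Xv → U⊆U′ v v<n (X⊆U v v<n Xv)) odd (Chain-mono U⊆U′ rest)

  -- The set of the final cut is left with the remaining vertices, which form the first class.
  Chain-pred : ∀ {U S r} → Chain U S (suc r) → Chain U S r
  Chain-pred (cut X X⊑S X⊆U odd [])                = []
  Chain-pred (cut X X⊑S X⊆U odd rest@(cut _ _ _ _ _)) = cut X X⊑S X⊆U odd (Chain-pred rest)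

  Chain-≤ : ∀ {U S r s} → r ≤′ s → Chain U S s → Chain U S r
  Chain-≤ ≤′-refl       c = c
  Chain-≤ (≤′-step r≤s) c = Chain-≤ r≤s (Chain-pred c)

  -- Shrinking each cut to one or two vertices

  In : (ℕ → Set) → (ℕ → Bool) → ℕ → Set
  In U S t = t < n × S t ≡ true × U t

  -- The second vertex n stands for the absence of a second vertex.
  Pick : (ℕ → Set) → (ℕ → Bool) → ℕ → ℕ → Set
  Pick U S t u = In U S t × (u ≡ n ⊎ In U S u) × deg S t xor deg S u ≡ true

  data Picks (U : ℕ → Set) : (ℕ → Bool) → ℕ → Set where
    []   : ∀ {S} → Picks U S 0
    pick : ∀ {S r} t u → Pick U S t u → Picks U (S △ ⟦ t ⟧ △ ⟦ u ⟧) r → Picks U S (suc r)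

  module _ {U : ℕ → Set} {S : ℕ → Bool} {X P : ℕ → Bool} {r : ℕ}
           (X⊑S : X ⊑ S) (X⊆U : ∀ v → v < n → X v ≡ true → U v)
           (P⊑ : P ⊑ S △ X) (P⊆U : ∀ v → v < n → P v ≡ true → U v)
           (P-odd : B P (S △ X) ≡ true)
           (rest : Chain U (S △ X △ P) r) where

    private
      A = S △ X △ P

    -- The part X △ Y of X that stays behind joins the class P below it, or
    -- becomes a class of its own.
    keep-rest : ∀ Y → Y ⊑ X → B (X △ Y) A ≡ false ⊎ B (X △ Y) P ≡ false → Chain U (S △ Y) (suc r)
    keep-rest Y Y⊑X even with B (X △ Y) A in RA | B (X △ Y) P in RP
    keep-rest Y Y⊑X (inj₁ ()) | true | true
    keep-rest Y Y⊑X (inj₂ ()) | true | true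
    ... | false | _ = cut (P △ (X △ Y)) incl use odd (Chain-cong same rest)
      where
      incl : P △ (X △ Y) ⊑ S △ Y
      incl v v<n eq with S v | X v | P v | Y v | X⊑S v v<n | P⊑ v v<n | Y⊑X v v<n
      ... | true  | _ | _ | false | _ | _ | _ = refl
      ... | true  | true  | true  | true | _ | p | _ = p refl
      ... | true  | false | _ | true | _ | _ | y = case y refl of λ ()
      ... | false | true  | _ | _ | x | _ | _ = case x refl of λ ()
      ... | false | false | true | _ | _ | p | _ = case p refl of λ ()
      ... | false | false | false | true | _ | _ | y = case y refl of λ ()
      use : ∀ v → v < n → (P △ (X △ Y)) v ≡ true → U v
      use v v<n eq with P v in Pv | X v in Xv | Y v in Yv
      ... | true  | _    | _    = P⊆U v v<n Pv
      ... | false | true | _    = X⊆U v v<n Xv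
      ... | false | false | true = case trans (sym Xv) (Y⊑X v v<n Yv) of λ ()
      odd : B (P △ (X △ Y)) (S △ Y) ≡ true
      odd = begin
        B (P △ (X △ Y)) (S △ Y)
          ≡⟨ B-cong (λ _ _ → refl) (λ v _ → split (S v) (X v) (P v) (Y v)) ⟩
        B (P △ (X △ Y)) (A △ (P △ (X △ Y)))
          ≡⟨ B-△ʳ (P △ (X △ Y)) A (P △ (X △ Y)) ⟩
        B (P △ (X △ Y)) A xor B (P △ (X △ Y)) (P △ (X △ Y))
          ≡⟨ cong₂ _xor_ (B-△ˡ P (X △ Y) A) (B-self (P △ (X △ Y))) ⟩
        (B P A xor B (X △ Y) A) xor false
          ≡⟨ cong₂ (λ p q → (p xor q) xor false) PA RA ⟩
        true ∎
        where
        open ≡-Reasoning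
        split : ∀ s x p y → s xor y ≡ ((s xor x) xor p) xor (p xor (x xor y))
        split = xor-solve 4 (λ s x p y → s ⊕ y ⊜ ((s ⊕ x) ⊕ p) ⊕ (p ⊕ (x ⊕ y))) refl
        PA : B P A ≡ true
        PA = trans (B-△ʳ P (S △ X) P) (cong₂ _xor_ P-odd (B-self P))
      same : A ≐ S △ Y △ (P △ (X △ Y))
      same v _ = eq (S v) (X v) (P v) (Y v)
        where
        eq : ∀ s x p y → (s xor x) xor p ≡ (s xor y) xor (p xor (x xor y))
        eq = xor-solve 4 (λ s x p y → (s ⊕ x) ⊕ p ⊜ (s ⊕ y) ⊕ (p ⊕ (x ⊕ y))) refl
    -- Here X △ Y is odd against A and even against P, hence odd against A △ P, which is all that
    -- remains once it is cut off. It becomes a class of its own; the chain is then one cut too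
    -- long, and `Chain-pred` shortens it.
    ... | true | false =
      cut (X △ Y) incl (λ v v<n eq → X⊆U v v<n (⊑X v v<n eq)) odd
          (Chain-cong same (Chain-pred (cut P P⊑ P⊆U P-odd rest)))
      where
      ⊑X : X △ Y ⊑ X
      ⊑X v v<n eq with X v | Y v | Y⊑X v v<n
      ... | true  | _    | _ = refl
      ... | false | true | y = y refl
      incl : X △ Y ⊑ S △ Y
      incl v v<n eq with S v | X v | Y v | X⊑S v v<n | Y⊑X v v<n
      ... | true  | _ | false | _ | _ = refl
      ... | true  | false | true | _ | y = case y refl of λ ()
      ... | true  | true | true | _ | y = eq
      ... | false | true | _ | x | _ = case x refl of λ ()
      ... | false | false | true | _ | y = case y refl of λ ()
      odd : B (X △ Y) (S △ Y) ≡ true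
      odd = begin
        B (X △ Y) (S △ Y)
          ≡⟨ B-cong (λ _ _ → refl) (λ v _ → split (S v) (X v) (P v) (Y v)) ⟩
        B (X △ Y) (A △ P △ (X △ Y))
          ≡⟨ B-△ʳ (X △ Y) (A △ P) (X △ Y) ⟩
        B (X △ Y) (A △ P) xor B (X △ Y) (X △ Y)
          ≡⟨ cong₂ _xor_ (B-△ʳ (X △ Y) A P) (B-self (X △ Y)) ⟩
        (B (X △ Y) A xor B (X △ Y) P) xor false
          ≡⟨ cong₂ (λ p q → (p xor q) xor false) RA RP ⟩
        true ∎
        where
        open ≡-Reasoning
        split : ∀ s x p y → s xor y ≡ (((s xor x) xor p) xor p) xor (x xor y)
        split = xor-solve 4 (λ s x p y → s ⊕ y ⊜ (((s ⊕ x) ⊕ p) ⊕ p) ⊕ (x ⊕ y)) refl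
      same : S △ X ≐ S △ Y △ (X △ Y)
      same v _ = eq (S v) (X v) (Y v)
        where
        eq : ∀ s x y → s xor x ≡ (s xor y) xor (x xor y)
        eq = xor-solve 3 (λ s x y → s ⊕ x ⊜ (s ⊕ y) ⊕ (x ⊕ y)) refl

    private
      pair : ℕ → ℕ → ℕ → Bool
      pair t u = ⟦ t ⟧ △ ⟦ u ⟧

      single-eq : ∀ Q t → B (X △ pair t n) Q ≡ B X Q xor deg Q t
      single-eq Q t = trans (B-△ˡ X (pair t n) Q) (cong (B X Q xor_) (trans (B-△ˡ ⟦ t ⟧ ⟦ n ⟧ Q)
        (trans (cong₂ _xor_ (B-singleˡ t Q) (trans (B-singleˡ n Q) (deg-ghost Q n ≤-refl))) (xor-identityʳ _))))

      pair-eq : ∀ Q t u → B (X △ pair t u) Q ≡ B X Q xor (deg Q t xor deg Q u)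
      pair-eq Q t u = trans (B-△ˡ X (pair t u) Q) (cong (B X Q xor_) (trans (B-△ˡ ⟦ t ⟧ ⟦ u ⟧ Q)
        (cong₂ _xor_ (B-singleˡ t Q) (B-singleˡ u Q))))

      pair⊑ : ∀ {t u} → X t ≡ true → u ≡ n ⊎ X u ≡ true → pair t u ⊑ X
      pair⊑ {t} {u} Xt Xu v v<n eq with v ≡ᵇ t in vt
      ... | true rewrite ≡ᵇ-sound v t vt = Xt
      ... | false rewrite ≡ᵇ-sound v u eq with Xu
      ...   | inj₁ refl = ⊥-elim (<-irrefl refl v<n)
      ...   | inj₂ Xu′  = Xu′

    Shrunk : Set
    Shrunk = ∃[ t ] ∃[ u ] Pick U S t u × Chain U (S △ (⟦ t ⟧ △ ⟦ u ⟧)) (suc r)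

    private
      in-X : ∀ {t} → t < n → X t ≡ true → In U S t
      in-X t<n Xt = t<n , X⊑S _ t<n Xt , X⊆U _ t<n Xt

      take-one : ∀ t → t < n → X t ≡ true → deg S t ≡ true →
                 B X A xor deg A t ≡ false ⊎ B X P xor deg P t ≡ false → Shrunk
      take-one t t<n Xt St even =
        t , n , (in-X t<n Xt , inj₁ refl , trans (cong₂ _xor_ St (deg-ghost S n ≤-refl)) refl)
        , keep-rest (pair t n) (pair⊑ Xt (inj₁ refl)) (ev even)
        where
        ev : B X A xor deg A t ≡ false ⊎ B X P xor deg P t ≡ false →
             B (X △ pair t n) A ≡ false ⊎ B (X △ pair t n) P ≡ false
        ev (inj₁ e) = inj₁ (trans (single-eq A t) e)
        ev (inj₂ e) = inj₂ (trans (single-eq P t) e)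

      take-two : ∀ t u → t < n → X t ≡ true → deg S t ≡ true → u < n → X u ≡ true → deg S u ≡ false →
                 B X A xor (deg A t xor deg A u) ≡ false ⊎ B X P xor (deg P t xor deg P u) ≡ false → Shrunk
      take-two t u t<n Xt St u<n Xu Su even =
        t , u , (in-X t<n Xt , inj₂ (in-X u<n Xu) , cong₂ _xor_ St Su)
        , keep-rest (pair t u) (pair⊑ Xt (inj₂ Xu)) (ev even)
        where
        ev : B X A xor (deg A t xor deg A u) ≡ false ⊎ B X P xor (deg P t xor deg P u) ≡ false →
             B (X △ pair t u) A ≡ false ⊎ B (X △ pair t u) P ≡ false
        ev (inj₁ e) = inj₁ (trans (pair-eq A t u) e)
        ev (inj₂ e) = inj₂ (trans (pair-eq P t u) e)

    private
      absorb : ∀ p → true xor p ≡ true → true xor (p xor true) ≡ false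
      absorb false _ = refl

      meets : B X S ≡ true → B X A ≡ true ⊎ B X P ≡ true
      meets odd with B X A in XA | B X P in XP
      ... | true  | _     = inj₁ refl
      ... | false | true  = inj₂ refl
      ... | false | false = case trans (sym odd) even of λ ()
        where
        even : B X S ≡ false
        even = begin
          B X S                          ≡⟨ B-cong (λ _ _ → refl) (λ v _ → split (S v) (X v) (P v)) ⟩
          B X (A △ P △ X)                ≡⟨ B-△ʳ X (A △ P) X ⟩
          B X (A △ P) xor B X X          ≡⟨ cong₂ _xor_ (B-△ʳ X A P) (B-self X) ⟩
          (B X A xor B X P) xor false    ≡⟨ cong₂ (λ p q → (p xor q) xor false) XA XP ⟩
          false ∎
          where
          open ≡-Reasoning
          split : ∀ s x p → s ≡ (((s xor x) xor p) xor p) xor x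
          split = xor-solve 3 (λ s x p → s ⊜ (((s ⊕ x) ⊕ p) ⊕ p) ⊕ x) refl

      via-A : ∀ t → t < n → X t ≡ true → deg S t ≡ true → B X A xor deg A t ≡ true → B X A ≡ true → Shrunk
      via-A t t<n Xt St eA XA with u , u<n , Xu , Au ← B-true XA with deg S u in Su
      ... | true  = take-one u u<n Xu Su (inj₁ (cong₂ _xor_ XA Au))
      ... | false = take-two t u t<n Xt St u<n Xu Su
                      (inj₁ (trans (cong₂ (λ p q → p xor (deg A t xor q)) XA Au)
                                   (absorb (deg A t) (trans (cong (_xor deg A t) (sym XA)) eA))))

      via-P : ∀ t → t < n → X t ≡ true → deg S t ≡ true → B X P xor deg P t ≡ true → B X P ≡ true → Shrunk
      via-P t t<n Xt St eP XP with u , u<n , Xu , Pu ← B-true XP with deg S u in Su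
      ... | true  = take-one u u<n Xu Su (inj₂ (cong₂ _xor_ XP Pu))
      ... | false = take-two t u t<n Xt St u<n Xu Su
                      (inj₂ (trans (cong₂ (λ p q → p xor (deg P t xor q)) XP Pu)
                                   (absorb (deg P t) (trans (cong (_xor deg P t) (sym XP)) eP))))

    -- Let t be an odd vertex of X. Cutting off t alone fails only if X without t is odd against
    -- both A and P. Since `B X S` is the sum of `B X A` and `B X P`, X itself is odd against one of
    -- them, say A. Then t is even against A, and some u in X is odd against A. Cutting off u if it
    -- is odd in S, and t together with u otherwise, leaves a part of X that is even against A.
    shrink-two : B X S ≡ true → Shrunk
    shrink-two odd = start (B-true odd) (meets odd)
      where
      start : (∃[ t ] t < n × X t ≡ true × deg S t ≡ true) → B X A ≡ true ⊎ B X P ≡ true → Shrunk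
      start (t , t<n , Xt , St) meet with B X A xor deg A t in eA | B X P xor deg P t in eP | meet
      ... | false | _     | _       = take-one t t<n Xt St (inj₁ eA)
      ... | true  | false | _       = take-one t t<n Xt St (inj₂ eP)
      ... | true  | true  | inj₁ XA = via-A t t<n Xt St eA XA
      ... | true  | true  | inj₂ XP = via-P t t<n Xt St eP XP

  -- If no cut follows, the rest of X can simply stay behind, so that any odd vertex of X will do.
  shrink : ∀ {U S r} → Chain U S (suc r) →
           ∃[ t ] ∃[ u ] Pick U S t u × Chain U (S △ (⟦ t ⟧ △ ⟦ u ⟧)) r
  shrink {S = S} (cut X X⊑S X⊆U odd []) with t , t<n , Xt , St ← B-true odd =
    t , n , ((t<n , X⊑S t t<n Xt , X⊆U t t<n Xt) , inj₁ refl , cong₂ _xor_ St (deg-ghost S n ≤-refl)) , []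
  shrink (cut X X⊑S X⊆U odd (cut P P⊑ P⊆U P-odd rest)) = shrink-two X⊑S X⊆U P⊑ P⊆U P-odd rest odd

  Chain⇒Picks : ∀ {U S} r → Chain U S r → Picks U S r
  Chain⇒Picks zero    c = []
  Chain⇒Picks {S = S} (suc r) c with t , u , p , rest ← shrink c =
    pick t u p (Chain⇒Picks r (Chain-cong (λ v _ → sym (xor-assoc (S v) (⟦ t ⟧ v) (⟦ u ⟧ v))) rest))

  -- Long chains from independent sets and cliques

  everything : ℕ → Bool
  everything _ = true

  -- The closed neighbourhood of u, because no vertex is adjacent to itself. True twins are the
  -- vertices for which these sets agree.
  near : ℕ → ℕ → Bool
  near u w = a u w xor (u ≡ᵇ w)

  deg-remove : ∀ S t v → deg (S △ ⟦ t ⟧) v ≡ deg S v xor a v t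
  deg-remove S t v = trans (deg-△ S ⟦ t ⟧ v) (cong (deg S v xor_) (deg-single t v))

  remove-other : ∀ {S t v} → v ≢ t → S v ≡ true → (S △ ⟦ t ⟧) v ≡ true
  remove-other {S} {t} {v} v≢t Sv = trans (cong₂ _xor_ Sv (≢⇒≡ᵇ {v} {t} v≢t)) refl

  single⊑ : ∀ {S t} → S t ≡ true → ⟦ t ⟧ ⊑ S
  single⊑ {S} {t} St v v<n eq = trans (cong S (≡ᵇ-sound v t eq)) St

  cut-single : ∀ {U S r} t → In U S t → deg S t ≡ true → Chain U (S △ ⟦ t ⟧) r → Chain U S (suc r)
  cut-single {U} {S} t (t<n , St , Ut) odd =
    cut ⟦ t ⟧ (single⊑ {S} {t} St) (λ v _ eq → subst U (sym (≡ᵇ-sound v t eq)) Ut) (trans (B-singleˡ t S) odd)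

  Apart Joined : ℕ → ℕ → Set
  Apart u v  = u ≢ v × a u v ≡ false
  Joined u v = u ≢ v × a u v ≡ true

  Joined-sym : ∀ {u v} → Joined u v → Joined v u
  Joined-sym (u≢v , e) = u≢v ∘ sym , trans (a-sym _ _) e

  -- Cutting off a vertex does not affect the degrees of vertices not adjacent to it, so all the odd
  -- ones can be cut off one by one.
  independent-chain : ∀ {U} xs S → AllPairs Apart xs → All (In U S) xs →
                      Chain U S (tally (λ x → bit (deg S x)) xs)
  independent-chain []       S _          _          = []
  independent-chain {U} (x ∷ xs) S (x# ∷ xs#) (Sx ∷ Sxs) with deg S x in odd
  ... | false = independent-chain xs S xs# Sxs
  ... | true  =
    cut-single x Sx odd (subst (Chain U (S △ ⟦ x ⟧)) (tally-cong (All.map same x#))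
      (independent-chain xs (S △ ⟦ x ⟧) xs# (All.zipWith keep (x# , Sxs))))
    where
    same : ∀ {y} → Apart x y → bit (deg (S △ ⟦ x ⟧) y) ≡ bit (deg S y)
    same {y} (_ , e) = cong bit (trans (deg-remove S x y)
      (trans (cong (deg S y xor_) (trans (a-sym y x) e)) (xor-identityʳ _)))
    keep : ∀ {y} → Apart x y × In U S y → In U (S △ ⟦ x ⟧) y
    keep {y} ((x≢y , _) , y<n , Sy , Uy) = y<n , remove-other {S} (x≢y ∘ sym) Sy , Uy

  JoinedPairs : ℕ × ℕ → ℕ × ℕ → Set
  JoinedPairs (x , y) (x′ , y′) = (Joined x x′ × Joined x y′) × (Joined y x′ × Joined y y′)

  InPair : (ℕ → Set) → (ℕ → Bool) → ℕ × ℕ → Set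
  InPair U S (x , y) = In U S x × In U S y × Joined x y

  odd-pair : (ℕ → Bool) → ℕ × ℕ → ℕ
  odd-pair S (x , y) = bit (deg S x xor deg S y)

  -- The even vertex y becomes odd when its neighbour x goes. Every vertex of the later pairs loses
  -- both x and y as neighbours, so the parities of these pairs are undisturbed.
  two-cuts : ∀ {U S} x y ps → In U S x → In U S y → Joined x y →
    deg S x ≡ true → deg S y ≡ false → All (JoinedPairs (x , y)) ps → All (InPair U S) ps →
    (∀ S′ → All (InPair U S′) ps → Chain U S′ (2 * tally (odd-pair S′) ps)) →
    Chain U S (2 * suc (tally (odd-pair S) ps))
  two-cuts {U} {S} x y ps Sx (y<n , Sy , Uy) (x≢y , xy) ex ey p# Sps chains =
    subst (Chain U S) (sym (*-suc 2 (tally (odd-pair S) ps)))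
      (cut-single x Sx ex (cut-single y (y<n , remove-other {S} (x≢y ∘ sym) Sy , Uy)
        (trans (deg-remove S x y) (cong₂ _xor_ ey (trans (a-sym y x) xy)))
        (subst (λ l → Chain U S′ (2 * l)) (tally-cong (All.map same p#))
          (chains S′ (All.zipWith keep (p# , Sps))))))
    where
    S′ = S △ ⟦ x ⟧ △ ⟦ y ⟧
    one : ∀ {z} → Joined x z → Joined y z → deg S′ z ≡ deg S z
    one {z} (_ , xz) (_ , yz) = trans (deg-remove (S △ ⟦ x ⟧) y z)
      (trans (cong₂ _xor_ (trans (deg-remove S x z) (cong (deg S z xor_) (trans (a-sym z x) xz)))
                          (trans (a-sym z y) yz))
             (xor-cancel (deg S z) true))
    same : ∀ {q} → JoinedPairs (x , y) q → odd-pair S′ q ≡ odd-pair S q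
    same ((xx′ , xy′) , (yx′ , yy′)) = cong₂ (λ p q → bit (p xor q)) (one xx′ yx′) (one xy′ yy′)
    in′ : ∀ {z} → Joined x z → Joined y z → In U S z → In U S′ z
    in′ {z} (x≢z , _) (y≢z , _) (z<n , Sz , Uz) =
      z<n , remove-other {S △ ⟦ x ⟧} (y≢z ∘ sym) (remove-other {S} (x≢z ∘ sym) Sz) , Uz
    keep : ∀ {q} → JoinedPairs (x , y) q × InPair U S q → InPair U S′ q
    keep (((xx′ , xy′) , (yx′ , yy′)) , (Sx′ , Sy′ , x′y′)) = in′ xx′ yx′ Sx′ , in′ xy′ yy′ Sy′ , x′y′

  -- In a clique the removal of an odd vertex makes an even one odd, so that
  -- a pair with different parities yields two cuts.
  clique-chain : ∀ {U} ps S → AllPairs JoinedPairs ps → All (InPair U S) ps →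
                 Chain U S (2 * tally (odd-pair S) ps)
  clique-chain []             S _          _ = []
  clique-chain {U} ((x , y) ∷ ps) S (p# ∷ ps#) ((Sx , Sy , xy) ∷ Sps) with deg S x in ex | deg S y in ey
  ... | false | false = clique-chain ps S ps# Sps
  ... | true  | true  = clique-chain ps S ps# Sps
  ... | true  | false = two-cuts x y ps Sx Sy xy ex ey p# Sps (λ S′ → clique-chain ps S′ ps#)
  ... | false | true  =
    two-cuts y x ps Sy Sx (Joined-sym xy) ey ex (All.map (λ (p , q) → q , p) p#) Sps (λ S′ → clique-chain ps S′ ps#)

  -- The vertex t₀ fixes the parity of the first cut X without affecting the
  -- units p, half of which become odd.
  first-cut : ∀ (Y : ℕ → Bool) t₀ ps → t₀ < n → deg everything t₀ ≡ true →
    All (λ (x , y) →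
      (deg everything x xor deg everything y ≡ false → ∃[ w ] w < n × Y w ≡ true × a w x xor a w y ≡ true) ×
      (deg everything x xor deg everything y ≡ true → a t₀ x xor a t₀ y ≡ false)) ps →
    ∃[ X ] (∀ w → X w ≡ true → Y w ≡ true ⊎ w ≡ t₀) × B X everything ≡ true
         × length ps ≤ 2 * tally (odd-pair (everything △ X)) ps
  first-cut Y t₀ ps t₀<n odd₀ hyps = adjust (half-with vec n ps (λ w → Z w ∧ deg everything w) t₀ t₀<n τt₀
                                               (All.map (λ {p} → nonzero p) hyps))
    where
    Z : ℕ → Bool
    Z w = Y w ∨ (w ≡ᵇ t₀)
    off : ℕ × ℕ → Bool
    off (x , y) = deg everything x xor deg everything y
    -- After the cut X the parities of x and y differ by `off` plus the sum of `a w x xor a w y`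
    -- over w in X. As X has to satisfy `B X everything ≡ true`, the constant `off` may be replaced
    -- by `off ∧ B X everything`, which is linear in X. `Z` masks the vertices that X may use.
    vec : ℕ × ℕ → ℕ → Bool
    vec (x , y) w = Z w ∧ ((a w x xor a w y) xor (off (x , y) ∧ deg everything w))
    ∨-right : ∀ p → p ∨ true ≡ true
    ∨-right false = refl
    ∨-right true  = refl
    Zt₀ : Z t₀ ≡ true
    Zt₀ = trans (cong (Y t₀ ∨_) (≡ᵇ-refl t₀)) (∨-right (Y t₀))
    τt₀ : Z t₀ ∧ deg everything t₀ ≡ true
    τt₀ = cong₂ _∧_ Zt₀ odd₀
    -- A unit of equal parities is told apart by a vertex of Y. For a unit of different parities the
    -- coefficient at t₀ is `true`, because t₀ is odd and does not tell x and y apart.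
    nonzero : ∀ p → (off p ≡ false → ∃[ w ] w < n × Y w ≡ true × a w (proj₁ p) xor a w (proj₂ p) ≡ true) ×
                    (off p ≡ true → a t₀ (proj₁ p) xor a t₀ (proj₂ p) ≡ false) →
              ∃[ w ] w < n × vec p w ≡ true
    nonzero p (even , odd) with off p
    ... | false with w , w<n , Yw , e ← even refl =
      w , w<n , cong₂ _∧_ (cong (_∨ (w ≡ᵇ t₀)) Yw) (trans (cong (_xor false) e) refl)
    ... | true = t₀ , t₀<n , cong₂ _∧_ Zt₀ (cong₂ _xor_ (odd refl) odd₀)
    adjust : (∃[ X ] dot n X (λ w → Z w ∧ deg everything w) ≡ true
                   × length ps ≤ 2 * tally (λ p → bit (dot n X (vec p))) ps) →
             ∃[ X ] (∀ w → X w ≡ true → Y w ≡ true ⊎ w ≡ t₀) × B X everything ≡ true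
                  × length ps ≤ 2 * tally (odd-pair (everything △ X)) ps
    adjust (X₀ , constraint , bound) =
      X , support , BX , ≤-trans bound (≤-reflexive (cong (2 *_) (tally-cong (All.universal (cong bit ∘ value) ps))))
      where
      X : ℕ → Bool
      X w = X₀ w ∧ Z w
      support : ∀ w → X w ≡ true → Y w ≡ true ⊎ w ≡ t₀
      support w eq with Y w | w ≡ᵇ t₀ in w≡t₀ | proj₂ (∧-true {X₀ w} eq)
      ... | true  | _    | _ = inj₁ refl
      ... | false | true | _ = inj₂ (≡ᵇ-sound w t₀ w≡t₀)
      BX : B X everything ≡ true
      BX = trans (⨁-cong n λ w _ → ∧-assoc (X₀ w) (Z w) (deg everything w)) constraint
      value : ∀ p → dot n X₀ (vec p) ≡ deg (everything △ X) (proj₁ p) xor deg (everything △ X) (proj₂ p)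
      value (x , y) = begin
        dot n X₀ (vec (x , y))
          ≡⟨ ⨁-cong n (λ w _ → trans (distribute (X₀ w) (Z w) (a w x) (a w y) o (deg everything w))
               (cong₂ (λ p q → (X w ∧ p xor X w ∧ q) xor (o ∧ (X w ∧ deg everything w))) (a-sym w x) (a-sym w y))) ⟩
        ⨁ n (λ w → (X w ∧ a x w xor X w ∧ a y w) xor (o ∧ (X w ∧ deg everything w)))
          ≡⟨ trans (⨁-xor n (λ w → X w ∧ a x w xor X w ∧ a y w) (λ w → o ∧ (X w ∧ deg everything w)))
               (cong₂ _xor_ (⨁-xor n (λ w → X w ∧ a x w) (λ w → X w ∧ a y w))
                            (sym (∧-⨁ n o (λ w → X w ∧ deg everything w)))) ⟩
        (deg X x xor deg X y) xor (o ∧ B X everything)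
          ≡⟨ cong (λ z → (deg X x xor deg X y) xor (o ∧ z)) BX ⟩
        (deg X x xor deg X y) xor (o ∧ true)
          ≡⟨ regroup (deg X x) (deg X y) (deg everything x) (deg everything y) ⟩
        (deg everything x xor deg X x) xor (deg everything y xor deg X y)
          ≡⟨ cong₂ _xor_ (sym (deg-△ everything X x)) (sym (deg-△ everything X y)) ⟩
        deg (everything △ X) x xor deg (everything △ X) y ∎
        where
        open ≡-Reasoning
        o = off (x , y)
        distribute : ∀ p z q r o t → p ∧ (z ∧ ((q xor r) xor (o ∧ t))) ≡
                                     ((p ∧ z) ∧ q xor (p ∧ z) ∧ r) xor (o ∧ ((p ∧ z) ∧ t))
        distribute = xor-solve 6 (λ p z q r o t → p ⊗ (z ⊗ ((q ⊕ r) ⊕ (o ⊗ t))) ⊜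
                                (((p ⊗ z) ⊗ q) ⊕ ((p ⊗ z) ⊗ r)) ⊕ (o ⊗ ((p ⊗ z) ⊗ t))) refl
        regroup : ∀ p q r s → (p xor q) xor ((r xor s) ∧ true) ≡ (r xor p) xor (s xor q)
        regroup p q r s = trans (cong ((p xor q) xor_) (∧-identityʳ (r xor s))) (regroup′ p q r s)
          where
          regroup′ : ∀ p q r s → (p xor q) xor (r xor s) ≡ (r xor p) xor (s xor q)
          regroup′ = xor-solve 4 (λ p q r s → (p ⊕ q) ⊕ (r ⊕ s) ⊜ (r ⊕ p) ⊕ (s ⊕ q)) refl

  -- Many twin classes contain a chain

  Distinct : ℕ → ℕ → Set
  Distinct u v = u ≢ v × (∃[ w ] w < n × near u w ≢ near v w)

  Distinct-sym : ∀ {u v} → Distinct u v → Distinct v u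
  Distinct-sym (u≢v , w , w<n , ne) = u≢v ∘ sym , w , w<n , ne ∘ sym

  NonIsolated : ℕ → Set
  NonIsolated v = ∃[ w ] w < n × a v w ≡ true

  -- What is left of the vertex set, after the removal of Y, is a clique of
  -- odd vertices together with isolated ones.
  record Stuck (Y : ℕ → Bool) : Set where
    field
      odd-vertex  : ∀ u v → u < n → v < n → Y u ≡ false → Y v ≡ false →
                    deg (everything △ Y) u ≡ true → u ≢ v → a u v ≡ deg (everything △ Y) v
      even-vertex : ∀ u v → u < n → v < n → Y u ≡ false → Y v ≡ false →
                    deg (everything △ Y) u ≡ false → a u v ≡ false

  module _ {U : ℕ → Set} {Y : ℕ → Bool} (stuck : Stuck Y)
           (Y⊆U : ∀ v → v < n → Y v ≡ true → U v)
           (odd-in-Y : (∃[ t ] t < n × Y t ≡ true × deg everything t ≡ true) ⊎ (∀ v → v < n → Y v ≡ false)) where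

    open Stuck stuck

    private
      Admissible : ℕ → Set
      Admissible v = v < n × U v × NonIsolated v

      Remaining : Bool → ℕ → Set
      Remaining b v = Admissible v × Y v ≡ false × deg (everything △ Y) v ≡ b

      near-self : ∀ v → near v v ≡ true
      near-self v = cong₂ _xor_ (a-irr v) (≡ᵇ-refl v)

      near-other : ∀ {v w} → v ≢ w → near v w ≡ a v w
      near-other {v} {w} v≢w = trans (cong (a v w xor_) (≢⇒≡ᵇ v≢w)) (xor-identityʳ _)

      clique-joined : ∀ {x y} → Remaining true x → Remaining true y → x ≢ y → Joined x y
      clique-joined ((x<n , _) , Yx , ex) ((y<n , _) , Yy , ey) x≢y =
        x≢y , trans (odd-vertex _ _ x<n y<n Yx Yy ex x≢y) ey

      -- Outside Y, both x and y see exactly the odd vertices of what is left, if they are counted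
      -- as neighbours of themselves. So a vertex on which their closed neighbourhoods differ lies
      -- in Y.
      clique-differ : ∀ {x y} → Remaining true x → Remaining true y → Distinct x y →
                      ∃[ w ] w < n × Y w ≡ true × a w x xor a w y ≡ true
      clique-differ {x} {y} Rx@((x<n , _) , Yx , ex) Ry@((y<n , _) , Yy , ey) (x≢y , w , w<n , ne) with Y w in Yw
      ... | true = w , w<n , Yw , xor-differ λ eq → ne (begin
        near x w  ≡⟨ near-other (λ { refl → case trans (sym Yx) Yw of λ () }) ⟩
        a x w  ≡⟨ trans (a-sym x w) (trans eq (a-sym w y)) ⟩
        a y w  ≡⟨ sym (near-other (λ { refl → case trans (sym Yy) Yw of λ () })) ⟩
        near y w  ∎)
        where open ≡-Reasoning
      ... | false = ⊥-elim (ne same)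
        where
        same : near x w ≡ near y w
        same with x ≟ w | y ≟ w
        ... | yes refl | yes refl = refl
        ... | yes refl | no y≢w   =
          trans (near-self x) (sym (trans (near-other y≢w) (proj₂ (clique-joined Ry Rx y≢w))))
        ... | no x≢w   | yes refl =
          trans (trans (near-other x≢w) (proj₂ (clique-joined Rx Ry x≢w))) (sym (near-self y))
        ... | no x≢w   | no y≢w   =
          trans (trans (near-other x≢w) (odd-vertex x w x<n w<n Yx Yw ex x≢w))
                (sym (trans (near-other y≢w) (odd-vertex y w y<n w<n Yy Yw ey y≢w)))

      isolated-apart : ∀ {x y} → Remaining false x → Remaining false y → x ≢ y → Apart x y
      isolated-apart ((x<n , _) , Yx , ex) ((y<n , _) , Yy , _) x≢y = x≢y , even-vertex _ _ x<n y<n Yx Yy ex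

      -- Such a vertex has a neighbour in the whole graph and none outside Y.
      isolated-neighbour : ∀ {x} → Remaining false x → ∃[ w ] w < n × Y w ≡ true × a w x ≡ true
      isolated-neighbour {x} ((x<n , _ , w , w<n , xw) , Yx , ex) with Y w in Yw
      ... | true  = w , w<n , Yw , trans (a-sym w x) xw
      ... | false = case trans (sym xw) (even-vertex x w x<n w<n Yx Yw ex) of λ ()

      ghost : ∀ w → a w n ≡ false
      ghost w = trans (a-sym w n) (a-out n w ≤-refl)

      forget : ∀ {Q : ℕ → Set} → (∃[ w ] w < n × Y w ≡ true × Q w) → ∃[ w ] w < n × Y w ≡ true
      forget (w , w<n , Yw , _) = w , w<n , Yw

      -- The vertex t₀ for `first-cut`, odd in the whole graph, with the two reasons why it tells no
      -- unit of different parities apart. Either it is taken from the list, and then it is adjacent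
      -- to all the others or to none; or it lies in Y because the list has no odd vertex, and then
      -- there are no such units.
      record Root (b : Bool) (L : List ℕ) : Set where
        field
          root      : ℕ
          root<n    : root < n
          root-U    : U root
          root-odd  : deg everything root ≡ true
          rest      : List ℕ
          distinct  : AllPairs Distinct rest
          remaining : All (Remaining b) rest
          avoids    : All (_≢ root) rest
          size      : length L ≤ suc (length rest)
          kind      : Remaining b root ⊎ All (λ v → deg everything v ≡ false) rest

      find-root : ∀ b L → AllPairs Distinct L → All (Remaining b) L → (∃[ w ] w < n × Y w ≡ true) → Root b L
      find-root b L L# RL (w , w<n , Yw) = choose odd-in-Y (take-out Distinct-sym (deg everything) L L#)
        where
        choose : (∃[ t ] t < n × Y t ≡ true × deg everything t ≡ true) ⊎ (∀ v → v < n → Y v ≡ false) → _ → Root b L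
        choose _ (inj₂ (e , ys , odd , restrict , e# , ys# , len)) = record
          { root = e ; root<n = proj₁ (proj₁ Re) ; root-U = proj₁ (proj₂ (proj₁ Re)) ; root-odd = odd ; rest = ys
          ; distinct = ys# ; remaining = proj₂ (restrict RL) ; avoids = All.map (λ (e≢v , _) v≡e → e≢v (sym v≡e)) e#
          ; size = ≤-reflexive len ; kind = inj₁ Re }
          where Re = proj₁ (restrict RL)
        choose (inj₁ (t , t<n , Yt , odd)) (inj₁ even) = record
          { root = t ; root<n = t<n ; root-U = Y⊆U t t<n Yt ; root-odd = odd ; rest = L
          ; distinct = L# ; remaining = RL
          ; avoids = All.map (λ { (_ , Yv , _) refl → case trans (sym Yv) Yt of λ () }) RL
          ; size = n≤1+n _ ; kind = inj₂ even }
        choose (inj₂ empty) (inj₁ _) = case trans (sym Yw) (empty w w<n) of λ ()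

      cut-first : ∀ {X r m} → B X everything ≡ true → (∀ w → w < n → X w ≡ true → U w) →
                  Chain U (everything △ X) m → r ≤ suc m → Chain U everything r
      cut-first {X} odd X⊆U chain r≤ = Chain-≤ (≤⇒≤′ r≤) (cut X (λ _ _ _ → refl) X⊆U odd chain)

      module _ (X : ℕ → Bool) (t : ℕ) (t<n : t < n) (Ut : U t)
               (support : ∀ w → X w ≡ true → Y w ≡ true ⊎ w ≡ t) where

        X⊆U : ∀ w → w < n → X w ≡ true → U w
        X⊆U w w<n Xw with support w Xw
        ... | inj₁ Yw   = Y⊆U w w<n Yw
        ... | inj₂ refl = Ut

        survives : ∀ {b v} → Remaining b v → v ≢ t → In U (everything △ X) v
        survives {b} {v} ((v<n , Uv , _) , Yv , _) v≢t with X v in Xv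
        ... | false = v<n , refl , Uv
        ... | true with support v Xv
        ...   | inj₁ Yv′ = case trans (sym Yv) Yv′ of λ ()
        ...   | inj₂ v≡t = ⊥-elim (v≢t v≡t)

    -- Each vertex is paired with the virtual vertex n, whose degree is always even, so that an odd
    -- unit is an odd vertex. Beside the root there are at least 2 r + 1 vertices, and half of them
    -- suffice for r cuts.
    many-isolated : ∀ r L → AllPairs Distinct L → All (Remaining false) L → 2 * r + 2 ≤ length L → Chain U everything r
    many-isolated r [] _ _ len = case subst (_≤ 0) (+-comm (2 * r) 2) len of λ ()
    many-isolated r L@(_ ∷ _) L# RL@(Rv ∷ _) len = finish (first-cut Y root units root<n root-odd (AllP.map⁺ (facts kind)))
      where
      open Root (find-root false L L# RL (forget (isolated-neighbour Rv)))
      single : ℕ → ℕ × ℕ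
      single x = x , n
      units : List (ℕ × ℕ)
      units = List.map single rest
      Fact : ℕ → Set
      Fact x =
        (deg everything x xor deg everything n ≡ false → ∃[ w ] w < n × Y w ≡ true × a w x xor a w n ≡ true) ×
        (deg everything x xor deg everything n ≡ true → a root x xor a root n ≡ false)
      neighbour : ∀ {x} → Remaining false x → ∃[ w ] w < n × Y w ≡ true × a w x xor a w n ≡ true
      neighbour Rx with w , w<n , Yw , wx ← isolated-neighbour Rx = w , w<n , Yw , cong₂ _xor_ wx (ghost w)
      facts : Remaining false root ⊎ All (λ v → deg everything v ≡ false) rest → All Fact rest
      facts (inj₁ (_ , Yr , er)) = All.map
        (λ { Rx@((x<n , _) , Yx , _) → (λ _ → neighbour Rx) ,
             (λ _ → cong₂ _xor_ (even-vertex root _ root<n x<n Yr Yx er) (ghost root)) }) remaining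
      facts (inj₂ even) = All.zipWith
        (λ { (Rx , e) → (λ _ → neighbour Rx) ,
             (λ odd → case trans (sym odd) (cong₂ _xor_ e (deg-ghost everything n ≤-refl)) of λ ()) }) (remaining , even)
      finish : (∃[ X ] (∀ w → X w ≡ true → Y w ≡ true ⊎ w ≡ root) × B X everything ≡ true
                     × length units ≤ 2 * tally (odd-pair (everything △ X)) units) → Chain U everything r
      finish (X , support , odd , bound) =
        cut-first odd (X⊆U X root root<n root-U support)
          (independent-chain rest (everything △ X)
            (AllPairs-with isolated-apart′ distinct remaining)
            (All.zipWith (λ (Rx , x≢r) → survives X root root<n root-U support Rx x≢r) (remaining , avoids)))
          (≤-trans (*-cancelˡ-≤ 2 (begin
            2 * r                                             ≤⟨ n≤1+n _ ⟩
            suc (2 * r)                                       ≤⟨ s≤s⁻¹ (≤-trans (≤-reflexive (+-comm 2 (2 * r))) (≤-trans len size)) ⟩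
            length rest                                       ≡⟨ sym (length-map single rest) ⟩
            length units                                      ≤⟨ bound ⟩
            2 * tally (odd-pair (everything △ X)) units       ≡⟨ cong (2 *_) (trans (tally-map (odd-pair (everything △ X)) single rest)
                                                                   (tally-cong (All.universal (λ x → cong bit
                                                                     (trans (cong (deg (everything △ X) x xor_) (deg-ghost (everything △ X) n ≤-refl))
                                                                            (xor-identityʳ (deg (everything △ X) x)))) rest))) ⟩
            2 * tally (λ x → bit (deg (everything △ X) x)) rest ∎)) (n≤1+n _))
        where
        open ≤-Reasoning
        isolated-apart′ : ∀ {x y} → Distinct x y → Remaining false x → Remaining false y → Apart x y
        isolated-apart′ (x≢y , _) Rx Ry = isolated-apart Rx Ry x≢y

    -- Beside the root there are at least 2 r + 1 vertices, hence r pairs. At least half of the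
    -- pairs get different parities, and each of these gives two cuts.
    many-clique : ∀ r L → AllPairs Distinct L → All (Remaining true) L → 2 * r + 2 ≤ length L → Chain U everything r
    many-clique r []      _ _ len = case subst (_≤ 0) (+-comm (2 * r) 2) len of λ ()
    many-clique r (_ ∷ []) _ _ len = case s≤s⁻¹ (subst (_≤ 1) (+-comm (2 * r) 2) len) of λ ()
    many-clique r L@(_ ∷ _ ∷ _) L#@((xy ∷ _) ∷ _) RL@(Rx ∷ Ry ∷ _) len =
      finish (first-cut Y root units root<n root-odd (facts kind))
      where
      open Root (find-root true L L# RL (forget (clique-differ Rx Ry xy)))
      units : List (ℕ × ℕ)
      units = pairs rest
      Fact : ℕ × ℕ → Set
      Fact (x , y) =
        (deg everything x xor deg everything y ≡ false → ∃[ w ] w < n × Y w ≡ true × a w x xor a w y ≡ true) ×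
        (deg everything x xor deg everything y ≡ true → a root x xor a root y ≡ false)
      joined : AllPairs Joined rest
      joined = AllPairs-with (λ (x≢y , _) Rx Ry → clique-joined Rx Ry x≢y) distinct remaining
      facts : Remaining true root ⊎ All (λ v → deg everything v ≡ false) rest → All Fact units
      facts (inj₁ Rr) = All.map
        (λ { ((Rx , x≢r) , (Ry , y≢r) , D) → (λ _ → clique-differ Rx Ry D) ,
             (λ _ → cong₂ _xor_ (proj₂ (clique-joined Rr Rx (x≢r ∘ sym))) (proj₂ (clique-joined Rr Ry (y≢r ∘ sym)))) })
        (pairs-All (All.zipWith (λ p → p) (remaining , avoids)) distinct)
      facts (inj₂ even) = All.map
        (λ { ((Rx , ex) , (Ry , ey) , D) → (λ _ → clique-differ Rx Ry D) ,
             (λ odd → case trans (sym odd) (cong₂ _xor_ ex ey) of λ ()) })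
        (pairs-All (All.zipWith (λ p → p) (remaining , even)) distinct)
      finish : (∃[ X ] (∀ w → X w ≡ true → Y w ≡ true ⊎ w ≡ root) × B X everything ≡ true
                     × length units ≤ 2 * tally (odd-pair (everything △ X)) units) → Chain U everything r
      finish (X , support , odd , bound) =
        cut-first odd (X⊆U X root root<n root-U support)
          (clique-chain units (everything △ X) (pairs-AllPairs joined)
            (All.map (λ ((Rx , x≢r) , (Ry , y≢r) , xy) → alive Rx x≢r , alive Ry y≢r , xy)
              (pairs-All (All.zipWith (λ p → p) (remaining , avoids)) joined)))
          (≤-trans (*-cancelˡ-≤ 2 (s≤s⁻¹ (begin
            suc (2 * r)               ≤⟨ s≤s⁻¹ (≤-trans (≤-reflexive (+-comm 2 (2 * r))) (≤-trans len size)) ⟩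
            length rest               ≤⟨ length≤pairs rest ⟩
            suc (2 * length units)    ∎)))
            (≤-trans bound (n≤1+n _)))
        where
        open ≤-Reasoning
        alive : ∀ {x} → Remaining true x → x ≢ root → In U (everything △ X) x
        alive = survives X root root<n root-U support

    -- Pigeonhole: at most 2 r of the representatives lie in Y, and with at most 2 r + 1 on each of
    -- the other two sides there would be only 6 r + 2.
    many-types : ∀ r Rs → count n Y ≤ 2 * r → AllPairs Distinct Rs → All Admissible Rs → 6 * r + 5 ≤ length Rs →
                 Chain U everything r
    many-types r Rs few Rs# adm len
      with Ys , Ss , restrict , (Ys# , inY) , (Ss# , outY) , len₁ ← split-by Y Rs Rs#
      with Ks , Is , restrict′ , (Ks# , odd) , (Is# , even) , len₂ ← split-by (deg (everything △ Y)) Ss Ss#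
      with 2 * r + 2 ≤? length Ks | 2 * r + 2 ≤? length Is
    ... | yes many | _ = many-clique r Ks Ks#
          (All.zipWith (λ (x , o) → proj₁ x , proj₂ x , o)
            (All.zipWith (λ p → p) (proj₁ (restrict′ (proj₂ (restrict adm))) , proj₁ (restrict′ outY)) , odd)) many
    ... | no _ | yes many = many-isolated r Is Is#
          (All.zipWith (λ (x , o) → proj₁ x , proj₂ x , o)
            (All.zipWith (λ p → p) (proj₂ (restrict′ (proj₂ (restrict adm))) , proj₂ (restrict′ outY)) , even)) many
    ... | no few₁ | no few₂ = ⊥-elim (<-irrefl refl (begin-strict
      length Rs                                   ≡⟨ len₁ ⟩
      length Ys + length Ss                       ≡⟨ cong (length Ys +_) len₂ ⟩
      length Ys + (length Ks + length Is)         ≤⟨ +-mono-≤ in-Y (+-mono-≤ (≤-trans (n≤1+n _) (≰⇒> few₁)) (≤-trans (n≤1+n _) (≰⇒> few₂))) ⟩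
      2 * r + ((2 * r + 2) + (2 * r + 2))         ≡⟨ arith r ⟩
      6 * r + 4                                   <⟨ +-monoʳ-< (6 * r) (n<1+n 4) ⟩
      6 * r + 5                                   ≤⟨ len ⟩
      length Rs                                   ∎))
      where
      open ≤-Reasoning
      in-Y : length Ys ≤ 2 * r
      in-Y = ≤-trans (length≤count n Ys (AllPairs.map proj₁ Ys#)
               (All.zipWith (λ ((v<n , _) , Yv) → v<n , Yv) (proj₁ (restrict adm) , inY))) few
      arith : ∀ r → 2 * r + ((2 * r + 2) + (2 * r + 2)) ≡ 6 * r + 4
      arith = solve-∀

  -- Chains as sequences of digits that name twin classes

  Isolated : ℕ → Set
  Isolated v = ∀ w → w < n → a v w ≡ false

  Index : ℕ → ℕ → Set
  Index N j = 1 ≤ j × j ≤ N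

  -- Item j with 1 ≤ j ≤ N is the true-twin class of its representative;
  -- item 0 collects all other vertices and serves as a dummy digit, whose
  -- representative n is a virtual isolated vertex.
  record Table (cap r : ℕ) (Y : ℕ → Bool) (N : ℕ) (item rank rep size : ℕ → ℕ) : Set where
    field
      N≤cap           : N ≤ cap
      item≤N          : ∀ v → item v ≤ N
      item-ghost      : ∀ v → n ≤ v → item v ≡ 0
      rep-dummy       : rep 0 ≡ n
      size-dummy      : dbl r < size 0
      rep<n           : ∀ j → Index N j → rep j < n
      rep-item        : ∀ j → Index N j → item (rep j) ≡ j
      rep-nonisolated : ∀ j → Index N j → NonIsolated (rep j)
      rep-distinct    : ∀ i j → Index N i → Index N j → i ≢ j → Distinct (rep i) (rep j)
      twin            : ∀ v → 1 ≤ item v → ∀ w → w < n → near v w ≡ near (rep (item v)) w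
      size-count      : ∀ j → Index N j → size j ≡ count n (λ v → item v ≡ᵇ j)
      rank-injective  : ∀ u v → 1 ≤ item u → item u ≡ item v → rank u ≡ rank v → u ≡ v
      rank-surjective : ∀ j → Index N j → ∀ ρ → ρ < size j → ∃[ v ] v < n × item v ≡ j × rank v ≡ ρ
      covers          : ∀ v → v < n → item v ≡ 0 → Isolated v ⊎ N ≡ cap
      covers-Y        : ∀ v → v < n → Y v ≡ true → item v ≡ 0 → Isolated v

  near-sym : ∀ u v → near u v ≡ near v u
  near-sym u v = cong₂ _xor_ (a-sym u v) (≡ᵇ-sym u v)
    where
    ≡ᵇ-sym : ∀ i j → (i ≡ᵇ j) ≡ (j ≡ᵇ i)
    ≡ᵇ-sym zero    zero    = refl
    ≡ᵇ-sym zero    (suc j) = refl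
    ≡ᵇ-sym (suc i) zero    = refl
    ≡ᵇ-sym (suc i) (suc j) = ≡ᵇ-sym i j

  states : (ℕ → Bool) → (ℕ → ℕ) → ℕ → ℕ → Bool
  states S z zero    = S
  states S z (suc m) = states S z m △ ⟦ z m ⟧

  states-shift : ∀ S z m → states S z (suc m) ≡ states (S △ ⟦ z 0 ⟧) (z ∘ suc) m
  states-shift S z zero    = refl
  states-shift S z (suc m) = cong (_△ ⟦ z (suc m) ⟧) (states-shift S z m)

  Picks-sequence : ∀ {U r S} → Picks U S r →
    ∃[ z ] ∀ l → l < r → Pick U (states S z (dbl l)) (z (dbl l)) (z (suc (dbl l)))
  Picks-sequence []                          = (λ _ → 0) , λ _ ()
  Picks-sequence {U} {S = S} (pick {r = r} t u p ps) = z , valid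
    where
    z : ℕ → ℕ
    z 0             = t
    z 1             = u
    z (suc (suc m)) = proj₁ (Picks-sequence ps) m
    valid : ∀ l → l < suc r → Pick U (states S z (dbl l)) (z (dbl l)) (z (suc (dbl l)))
    valid zero    _         = p
    valid (suc l) (s≤s l<r) =
      subst (λ S′ → Pick U S′ (z (dbl (suc l))) (z (suc (dbl (suc l)))))
            (sym (trans (states-shift S z (suc (dbl l))) (states-shift (S △ ⟦ t ⟧) (z ∘ suc) (dbl l))))
            (proj₂ (Picks-sequence ps) l l<r)

  module _ {cap r Y N item rank rep size} (table : Table cap r Y N item rank rep size) where

    open Table table

    -- How the removal of a vertex of class j changes the closed parity of class i. The second
    -- factor makes the dummy digit inert, since `near n n` is `true`.
    closed : ℕ → ℕ → Bool
    closed i j = near (rep i) (rep j) ∧ (0 <ᵇ j)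

    occ : (ℕ → ℕ) → ℕ → ℕ → ℕ
    occ d i L = count L λ m → d m ≡ᵇ i

    -- The parity of the degree of any vertex of class i that is still present after the first L
    -- digits, computed from class numbers alone.
    par : (ℕ → ℕ) → ℕ → ℕ → Bool
    par d i L = deg everything (rep i) xor ⨁ L λ m → closed i (d m)

    -- Both counts stop at `dbl l`, before the first digit of the round. This is enough for the
    -- second digit as well: by `odd` the two digits of a round differ, so the first takes nothing
    -- from the class of the second.
    record ValidAt (d : ℕ → ℕ) (l : ℕ) : Set where
      field
        odd  : par d (d (dbl l)) (dbl l) xor par d (d (suc (dbl l))) (dbl l) ≡ true
        left : occ d (d (dbl l)) (dbl l) < size (d (dbl l))
        right : occ d (d (suc (dbl l))) (dbl l) < size (d (suc (dbl l)))

    Valid : (ℕ → ℕ) → Set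
    Valid d = ∀ l → l < r → ValidAt d l

    -- The dummy digit may stand for any isolated vertex, the virtual one included: removing such a
    -- vertex alters no other degree.
    Match : ℕ → ℕ → Set
    Match z j = (j ≡ 0 × Isolated z) ⊎ (Index N j × item z ≡ j)

    -- The left side is the parity of the closed neighbourhood of the representative within S. It
    -- stays meaningful after the representative has been removed. The added `true` is the
    -- contribution of a present vertex to its own closed neighbourhood.
    Tracks : (ℕ → ℕ) → (ℕ → Bool) → ℕ → Set
    Tracks d S L = ∀ i → Index N i → deg S (rep i) xor S (rep i) ≡ true xor par d i L

    tracks-start : ∀ d → Tracks d everything 0
    tracks-start d i _ = trans (xor-comm (deg everything (rep i)) true) (cong not (sym (xor-identityʳ _)))

    item-index : ∀ {v j} → 1 ≤ j → item v ≡ j → v < n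
    item-index {v} 1≤j refl with v <? n
    ... | yes v<n = v<n
    ... | no v≮n  = case subst (1 ≤_) (item-ghost v (≮⇒≥ v≮n)) 1≤j of λ ()

    closed-match : ∀ i z j → Index N i → Match z j → near (rep i) z ≡ closed i j
    closed-match i z j Ii (inj₁ (refl , iso)) =
      trans (cong₂ _xor_ (trans (a-sym (rep i) z) (iso (rep i) (rep<n i Ii)))
              (≢⇒≡ᵇ {rep i} {z} λ { refl → let w , w<n , e = rep-nonisolated i Ii in case trans (sym e) (iso w w<n) of λ () }))
            (sym (∧-zeroʳ (near (rep i) (rep 0))))
    closed-match i z j Ii (inj₂ (Ij , refl)) = begin
      near (rep i) z        ≡⟨ near-sym (rep i) z ⟩
      near z (rep i)        ≡⟨ twin z (proj₁ Ij) (rep i) (rep<n i Ii) ⟩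
      near (rep (item z)) (rep i) ≡⟨ near-sym (rep (item z)) (rep i) ⟩
      near (rep i) (rep (item z)) ≡⟨ sym (∧-identityʳ _) ⟩
      near (rep i) (rep (item z)) ∧ true ≡⟨ cong (near (rep i) (rep (item z)) ∧_) (sym (positive (item z) (proj₁ Ij))) ⟩
      closed i (item z)  ∎
      where
      open ≡-Reasoning
      positive : ∀ j → 1 ≤ j → (0 <ᵇ j) ≡ true
      positive (suc j) _ = refl

    tracks-step : ∀ {d S L z} → Tracks d S L → Match z (d L) → Tracks d (S △ ⟦ z ⟧) (suc L)
    tracks-step {d} {S} {L} {z} tracks match i Ii = begin
      deg (S △ ⟦ z ⟧) (rep i) xor (S (rep i) xor ⟦ z ⟧ (rep i))
        ≡⟨ cong (_xor (S (rep i) xor ⟦ z ⟧ (rep i))) (deg-remove S z (rep i)) ⟩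
      (deg S (rep i) xor a (rep i) z) xor (S (rep i) xor ⟦ z ⟧ (rep i))
        ≡⟨ xor-interchange (deg S (rep i)) (a (rep i) z) (S (rep i)) (⟦ z ⟧ (rep i)) ⟩
      (deg S (rep i) xor S (rep i)) xor near (rep i) z
        ≡⟨ cong₂ _xor_ (tracks i Ii) (closed-match i z (d L) Ii match) ⟩
      (true xor par d i L) xor closed i (d L)
        ≡⟨ xor-assoc true (par d i L) (closed i (d L)) ⟩
      true xor (par d i L xor closed i (d L))
        ≡⟨ cong (true xor_) (xor-assoc (deg everything (rep i)) _ (closed i (d L))) ⟩
      true xor par d i (suc L) ∎
      where open ≡-Reasoning

    tracks-deg : ∀ {d S L v j} → (∀ m → m < L → d m ≤ N) → Tracks d S L → Match v j → j ≡ 0 ⊎ S v ≡ true → deg S v ≡ par d j L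
    tracks-deg {d} {S} {L} {v} d≤N tracks (inj₁ (refl , iso)) _ =
      trans (⨁-false n λ w w<n → trans (cong (S w ∧_) (iso w w<n)) (∧-zeroʳ (S w)))
            (sym (cong₂ _xor_ (trans (cong (deg everything) rep-dummy) (deg-ghost everything n ≤-refl))
                              (⨁-false L λ m m<L → dummy (d m) (d≤N m m<L))))
      where
      dummy : ∀ j → j ≤ N → closed 0 j ≡ false
      dummy zero    _   = ∧-zeroʳ (near (rep 0) (rep 0))
      dummy (suc j) j≤N = trans (∧-identityʳ _) (trans (cong (λ z → near z (rep (suc j))) rep-dummy)
        (cong₂ _xor_ (a-out n _ ≤-refl) (≢⇒≡ᵇ {n} {rep (suc j)} λ eq → <-irrefl (sym eq) (rep<n (suc j) (s≤s z≤n , j≤N)))))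
    tracks-deg d≤N tracks (inj₂ ((1≤j , _) , _)) (inj₁ refl) = case 1≤j of λ ()
    -- The degree of a present vertex is its closed parity flipped, and the closed parity is that of
    -- its twin, the representative, whether or not the latter is in S.
    tracks-deg {d} {S} {L} {v} {j} d≤N tracks (inj₂ (Ij , refl)) (inj₂ Sv) = flip-true (begin
      deg S v xor true  ≡⟨ cong (deg S v xor_) (sym Sv) ⟩
      deg S v xor S v   ≡⟨ closed-sum v (item-index (proj₁ Ij) refl) ⟩
      ⨁ n (λ w → S w ∧ near v w) ≡⟨ ⨁-cong n (λ w w<n → cong (S w ∧_) (twin v (proj₁ Ij) w w<n)) ⟩
      ⨁ n (λ w → S w ∧ near (rep (item v)) w) ≡⟨ sym (closed-sum (rep (item v)) (rep<n (item v) Ij)) ⟩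
      deg S (rep (item v)) xor S (rep (item v)) ≡⟨ tracks (item v) Ij ⟩
      true xor par d (item v) L ∎)
      where
      open ≡-Reasoning
      flip-true : ∀ {p q} → p xor true ≡ true xor q → p ≡ q
      flip-true {true}  {true}  _ = refl
      flip-true {false} {false} _ = refl
      closed-sum : ∀ v → v < n → deg S v xor S v ≡ ⨁ n (λ w → S w ∧ near v w)
      closed-sum v v<n = sym (trans (⨁-cong n λ w _ → ∧-distribˡ-xor (S w) (a v w) (v ≡ᵇ w))
        (trans (⨁-xor n (λ w → S w ∧ a v w) (λ w → S w ∧ (v ≡ᵇ w)))
          (cong (deg S v xor_) (trans (⨁-single n v v<n λ w _ w≢v →
              trans (cong (S w ∧_) (≢⇒≡ᵇ {v} {w} (w≢v ∘ sym))) (∧-zeroʳ (S w)))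
            (trans (cong (S v ∧_) (≡ᵇ-refl v)) (∧-identityʳ (S v)))))))

    -- A class loses its vertices in the order of their ranks, so that the occurrences of its digit
    -- determine which of them are gone.
    removed : (ℕ → ℕ) → ℕ → ℕ → Bool
    removed d L v = (0 <ᵇ item v) ∧ (rank v <ᵇ occ d (item v) L)

    -- A vertex that goes in round l is missing after the rounds l to r - 1, so it gets class r - l.
    -- The survivors form class 0, and the set removed first is the last class.
    classOf : (ℕ → ℕ) → ℕ → ℕ
    classOf d v = count r λ l → removed d (dbl (suc l)) v

    GoodClasses : (ℕ → ℕ) → Set
    GoodClasses c = (∀ v → v < n → c v ≤ r) × (∀ i → 1 ≤ i → i ≤ r → B (λ v → c v ≡ᵇ i) (λ v → c v <ᵇ i) ≡ true)

    module Soundness (d : ℕ → ℕ) (d≤N : ∀ m → m < dbl r → d m ≤ N) (valid : Valid d) where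

      present : ℕ → ℕ → Bool
      present L v = not (removed d L v)

      removed-up : ∀ L v → removed d L v ≡ true → removed d (suc L) v ≡ true
      removed-up L v eq with p , q ← ∧-true {0 <ᵇ item v} eq =
        cong₂ _∧_ p (<ᵇ-true {rank v} (<-≤-trans (<ᵇ⇒< (rank v) (occ d (item v) L) (subst T (sym q) tt)) (m≤m+n (occ d (item v) L) (bit (d L ≡ᵇ item v)))))

      record Step (L : ℕ) : Set where
        field
          z       : ℕ
          match   : Match z (d L)
          here    : d L ≡ 0 ⊎ present L z ≡ true
          removes : present (suc L) ≐ present L △ ⟦ z ⟧

      step : ∀ L → L < dbl r → occ d (d L) L < size (d L) → Step L
      step L L<2r occ<size with d L in dL | d≤N L L<2r
      ... | zero | _ = record
        { z = n ; match = inj₁ (dL , λ w _ → a-out n w ≤-refl) ; here = inj₁ dL ; removes = λ v v<n →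
            trans (cong not (unchanged v)) (sym (trans (cong (present L v xor_) (≢⇒≡ᵇ {v} {n} (<⇒≢ v<n))) (xor-identityʳ _))) }
        where
        unchanged : ∀ v → removed d (suc L) v ≡ removed d L v
        unchanged v with item v
        ... | zero  = refl
        ... | suc j rewrite dL = cong (rank v <ᵇ_) (+-identityʳ (occ d (suc j) L))
      ... | suc j | j≤N with z , z<n , iz , rz ← rank-surjective (suc j) (s≤s z≤n , j≤N) _ occ<size = record
        { z = z ; match = inj₂ (subst (Index N) (sym dL) (s≤s z≤n , j≤N) , trans iz (sym dL)) ; here = inj₂ hereZ ; removes = removes }
        where
        hereZ : present L z ≡ true
        hereZ rewrite iz | rz = cong not (<ᵇ-false {occ d (suc j) L} (<-irrefl refl))
        removes : present (suc L) ≐ present L △ ⟦ z ⟧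
        removes v v<n with v ≟ z
        ... | yes refl rewrite iz | rz | dL | ≡ᵇ-refl j | ≡ᵇ-refl z | <ᵇ-false {occ d (suc j) L} (<-irrefl refl) =
          cong not (<ᵇ-true (≤-reflexive (+-comm 1 (occ d (suc j) L))))
        ... | no v≢z = trans (cong not same) (sym (trans (cong (present L v xor_) (≢⇒≡ᵇ {v} {z} v≢z)) (xor-identityʳ _)))
          where
          same : removed d (suc L) v ≡ removed d L v
          same with item v in iv
          ... | zero = refl
          ... | suc i rewrite dL with j ≟ i
          ...   | no j≢i rewrite ≢⇒≡ᵇ {j} {i} j≢i = cong (rank v <ᵇ_) (+-identityʳ (occ d (suc i) L))
          ...   | yes refl rewrite ≡ᵇ-refl j with rank v <? occ d (suc j) L
          ...     | yes lt = trans (<ᵇ-true (<-≤-trans lt (m≤m+n _ 1))) (sym (<ᵇ-true lt))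
          ...     | no ≮ = trans (<ᵇ-false λ lt → ne (≤-antisym (s≤s⁻¹ (subst (rank v <_) (+-comm _ 1) lt)) (≮⇒≥ ≮)))
                                 (sym (<ᵇ-false ≮))
            where
            ne : rank v ≢ occ d (suc j) L
            ne eq = v≢z (rank-injective v z (subst (1 ≤_) (sym iv) (s≤s z≤n)) (trans iv (sym iz)) (trans eq (sym rz)))

      tracks-cong : ∀ L {S S′} → S ≐ S′ → Tracks d S L → Tracks d S′ L
      tracks-cong L S≐S′ tracks i Ii =
        trans (sym (cong₂ _xor_ (deg-cong (rep i) S≐S′) (S≐S′ (rep i) (rep<n i Ii)))) (tracks i Ii)

      dbl-< : ∀ {l} → l < r → suc (dbl l) < dbl r
      dbl-< l<r = dbl-mono-≤ l<r

      step-even : ∀ l → l < r → Step (dbl l)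
      step-even l l<r = step (dbl l) (<⇒≤ (dbl-< l<r)) (ValidAt.left (valid l l<r))

      step-odd : ∀ l → l < r → Step (suc (dbl l))
      step-odd l l<r = step (suc (dbl l)) (dbl-< l<r) (subst (_< size j) (sym same) right)
        where
        open ValidAt (valid l l<r)
        j = d (suc (dbl l))
        same : occ d j (suc (dbl l)) ≡ occ d j (dbl l)
        same with d (dbl l) ≡ᵇ j in eq
        ... | false = +-identityʳ _
        ... | true  = case trans (sym odd) (trans (cong (λ i → par d i (dbl l) xor par d j (dbl l)) (≡ᵇ-sound (d (dbl l)) j eq))
                                                  (xor-same (par d j (dbl l)))) of λ ()

      present-tracks : ∀ l → l ≤ r → Tracks d (present (dbl l)) (dbl l)
      present-tracks zero    _   = tracks-cong 0 (λ v _ → sym (cong not (∧-zeroʳ (0 <ᵇ item v)))) (tracks-start d)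
      present-tracks (suc l) l<r =
        tracks-cong (dbl (suc l)) (λ v v<n → sym (Step.removes (step-odd l l<r) v v<n))
          (tracks-step {d} (tracks-cong (suc (dbl l)) (λ v v<n → sym (Step.removes (step-even l l<r) v v<n))
            (tracks-step {d} (present-tracks l (<⇒≤ l<r)) (Step.match (step-even l l<r)))) (Step.match (step-odd l l<r)))

      present-down : ∀ L v → present (suc L) v ≡ true → present L v ≡ true
      present-down L v eq with removed d L v in rm
      ... | false = refl
      ... | true  = case trans (sym eq) (cong not (removed-up L v rm)) of λ ()

      -- The round removes y, the vertices t and u. As `B y y` vanishes, the cut between y and the
      -- rest has the parity of `B y S`, which is the sum of two degrees; the condition `odd` is
      -- about just this sum.
      level-odd : ∀ l → l < r →
        B (present (dbl l) △ present (dbl (suc l))) (present (dbl (suc l))) ≡ true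
      level-odd l l<r = begin
        B (S △ S′) S′               ≡⟨ B-cong y-eq (λ v v<n → trans (sym (cancel (S v) (S′ v))) (cong (S v xor_) (y-eq v v<n))) ⟩
        B y (S △ y)                 ≡⟨ B-△ʳ y S y ⟩
        B y S xor B y y             ≡⟨ cong₂ _xor_ (B-△ˡ ⟦ t ⟧ ⟦ u ⟧ S) (B-self y) ⟩
        (B ⟦ t ⟧ S xor B ⟦ u ⟧ S) xor false ≡⟨ xor-identityʳ _ ⟩
        B ⟦ t ⟧ S xor B ⟦ u ⟧ S     ≡⟨ cong₂ _xor_ (B-singleˡ t S) (B-singleˡ u S) ⟩
        deg S t xor deg S u         ≡⟨ cong₂ _xor_ (tracks-deg bounded tracks (Step.match even) (Step.here even))
                                                  (tracks-deg bounded tracks (Step.match odd′) here-u) ⟩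
        par d (d (dbl l)) (dbl l) xor par d (d (suc (dbl l))) (dbl l) ≡⟨ ValidAt.odd (valid l l<r) ⟩
        true ∎
        where
        open ≡-Reasoning
        S = present (dbl l)
        S′ = present (dbl (suc l))
        even = step-even l l<r
        odd′ = step-odd l l<r
        t = Step.z even
        u = Step.z odd′
        y = ⟦ t ⟧ △ ⟦ u ⟧
        tracks = present-tracks l (<⇒≤ l<r)
        bounded : ∀ m → m < dbl l → d m ≤ N
        bounded m m<2l = d≤N m (<-≤-trans m<2l (dbl-mono-≤ (<⇒≤ l<r)))
        cancel : ∀ p q → p xor (p xor q) ≡ q
        cancel p q = trans (sym (xor-assoc p p q)) (cong (_xor q) (xor-same p))
        y-eq : S △ S′ ≐ y
        y-eq v v<n = trans (cong (S v xor_) (trans (Step.removes odd′ v v<n)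
            (trans (cong (_xor ⟦ u ⟧ v) (Step.removes even v v<n)) (xor-assoc (S v) (⟦ t ⟧ v) (⟦ u ⟧ v)))))
          (cancel (S v) (y v))
        here-u : d (suc (dbl l)) ≡ 0 ⊎ S u ≡ true
        here-u with Step.here odd′
        ... | inj₁ e = inj₁ e
        ... | inj₂ e = inj₂ (present-down (dbl l) u e)

      below : ∀ l → l ≤ r → ∀ v → (classOf d v <ᵇ suc (r ∸ l)) ≡ present (dbl l) v
      below l l≤r v = count-threshold r (λ l → removed d (dbl l) v)
        (λ l e → removed-up (suc (dbl l)) v (removed-up (dbl l) v e)) (∧-zeroʳ (0 <ᵇ item v)) l l≤r

      good-classes : GoodClasses (classOf d)
      good-classes = (λ v _ → count-≤ r _) , levels
        where
        levels : ∀ i → 1 ≤ i → i ≤ r → B (λ v → classOf d v ≡ᵇ i) (λ v → classOf d v <ᵇ i) ≡ true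
        levels i 1≤i i≤r = trans (B-cong (λ v _ → equal-as-difference v) (λ v _ → under v)) (level-odd l l<r)
          where
          -- Class i is what this round removes, since classes are numbered backwards.
          l = r ∸ i
          l<r : l < r
          l<r = ∸-monoʳ-< 1≤i i≤r
          under : ∀ v → (classOf d v <ᵇ i) ≡ present (dbl (suc l)) v
          under v = trans (cong (classOf d v <ᵇ_) (sym (trans (sym (+-∸-assoc 1 l<r)) (m∸[m∸n]≡n i≤r)))) (below (suc l) l<r v)
          upto : ∀ v → (classOf d v <ᵇ suc i) ≡ present (dbl l) v
          upto v = trans (cong (λ z → classOf d v <ᵇ suc z) (sym (m∸[m∸n]≡n i≤r))) (below l (<⇒≤ l<r) v)
          equal-as-difference : ∀ v → (classOf d v ≡ᵇ i) ≡ present (dbl l) v xor present (dbl (suc l)) v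
          equal-as-difference v = trans (sym (trans (cong (_xor (classOf d v <ᵇ i)) (trans (<ᵇ-suc (classOf d v) i) (xor-comm (classOf d v <ᵇ i) (classOf d v ≡ᵇ i)))) (xor-cancel (classOf d v ≡ᵇ i) (classOf d v <ᵇ i)))) (cong₂ _xor_ (upto v) (under v))

    Covered : ℕ → Set
    Covered v = 1 ≤ item v ⊎ Isolated v

    module Completeness (picks : Picks Covered everything r) where

      z : ℕ → ℕ
      z = proj₁ (Picks-sequence picks)

      S : ℕ → ℕ → Bool
      S = states everything z

      picked : ∀ l → l < r → Pick Covered (S (dbl l)) (z (dbl l)) (z (suc (dbl l)))
      picked = proj₂ (Picks-sequence picks)

      digit : ℕ → ℕ
      digit m = item (z m)

      match-covered : ∀ {v} → Covered v → Match v (item v)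
      match-covered {v} (inj₁ 1≤) = inj₂ ((1≤ , item≤N v) , refl)
      match-covered {v} (inj₂ iso) with item v in iv
      ... | zero  = inj₁ (refl , iso)
      ... | suc j = inj₂ ((s≤s z≤n , subst (_≤ N) iv (item≤N v)) , refl)

      match-second : ∀ {S u} → u ≡ n ⊎ In Covered S u → Match u (item u)
      match-second (inj₁ refl)          = inj₁ (item-ghost n ≤-refl , λ w _ → a-out n w ≤-refl)
      match-second (inj₂ (_ , _ , cov)) = match-covered cov

      tracks : ∀ l → l ≤ r → Tracks digit (S (dbl l)) (dbl l)
      tracks zero    _   = tracks-start digit
      tracks (suc l) l<r with (_ , _ , cov) , second , _ ← picked l l<r =
        tracks-step {digit} {L = suc (dbl l)} (tracks-step {digit} {L = dbl l} (tracks l (<⇒≤ l<r)) (match-covered cov)) (match-second {S (dbl l)} second)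

      -- A conservation law: each member of a class is either present or accounted for by one digit.
      -- So the presence of the vertex to be picked gives the strict inequalities of `ValidAt`.
      Counts : ℕ → Set
      Counts L = ∀ j → Index N j → occ digit j L + count n (λ v → S L v ∧ (item v ≡ᵇ j)) ≡ size j

      counts-step : ∀ L → z L ≡ n ⊎ (z L < n × S L (z L) ≡ true) → Counts L → Counts (suc L)
      counts-step L inside counts j Ij@(1≤j , _) with digit L ≡ᵇ j in eq
      ... | false = trans (cong₂ _+_ (+-identityʳ _) (count-cong n same)) (counts j Ij)
        where
        same : ∀ v → v < n → S (suc L) v ∧ (item v ≡ᵇ j) ≡ S L v ∧ (item v ≡ᵇ j)
        same v _ with v ≡ᵇ z L in vz
        ... | false = cong (_∧ (item v ≡ᵇ j)) (xor-identityʳ (S L v))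
        ... | true rewrite ≡ᵇ-sound v (z L) vz | eq = trans (∧-zeroʳ (S L (z L) xor true)) (sym (∧-zeroʳ (S L (z L))))
      ... | true = trans (trans (+-assoc (occ digit j L) 1 _) (cong (occ digit j L +_) (sym fewer))) (counts j Ij)
        where
        iz : item (z L) ≡ j
        iz = ≡ᵇ-sound (digit L) j eq
        member : z L ≡ n ⊎ (z L < n × S L (z L) ≡ true) → z L < n × S L (z L) ≡ true
        member (inj₂ m)   = m
        member (inj₁ z≡n) = case subst (1 ≤_) (trans (sym iz) (trans (cong item z≡n) (item-ghost n ≤-refl))) 1≤j of λ ()
        fewer : count n (λ v → S L v ∧ (item v ≡ᵇ j)) ≡ suc (count n λ v → S (suc L) v ∧ (item v ≡ᵇ j))
        fewer = trans (count-remove n (z L) (proj₁ (member inside)) (cong₂ _∧_ (proj₂ (member inside)) eq))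
                      (cong suc (count-cong n same))
          where
          same : ∀ v → v < n → (S L v ∧ (item v ≡ᵇ j)) xor (v ≡ᵇ z L) ≡ S (suc L) v ∧ (item v ≡ᵇ j)
          same v _ with v ≡ᵇ z L in vz
          ... | false = trans (xor-identityʳ _) (cong (_∧ (item v ≡ᵇ j)) (sym (xor-identityʳ (S L v))))
          ... | true rewrite ≡ᵇ-sound v (z L) vz | eq = trans (cong (_xor true) (∧-identityʳ (S L (z L))))
                                                              (sym (∧-identityʳ (S L (z L) xor true)))

      second-inside : ∀ l → l < r → z (suc (dbl l)) ≡ n ⊎ (z (suc (dbl l)) < n × S (suc (dbl l)) (z (suc (dbl l))) ≡ true)
      second-inside l l<r with picked l l<r
      ... | _ , inj₁ e , _ = inj₁ e
      ... | _ , inj₂ (u<n , Su , _) , odd = inj₂ (u<n , remove-other {S (dbl l)} u≢t Su)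
        where
        u≢t : z (suc (dbl l)) ≢ z (dbl l)
        u≢t e = case trans (sym odd) (trans (cong (λ v → deg (S (dbl l)) (z (dbl l)) xor deg (S (dbl l)) v) e)
                                            (xor-same (deg (S (dbl l)) (z (dbl l))))) of λ ()

      counts : ∀ l → l ≤ r → Counts (dbl l)
      counts zero    _   j Ij = sym (size-count j Ij)
      counts (suc l) l<r with (t<n , St , _) , _ ← picked l l<r =
        counts-step (suc (dbl l)) (second-inside l l<r) (counts-step (dbl l) (inj₂ (t<n , St)) (counts l (<⇒≤ l<r)))

      enough : ∀ l → l < r → ∀ v → v ≡ n ⊎ (v < n × S (dbl l) v ≡ true) → occ digit (item v) (dbl l) < size (item v)
      enough l l<r v inside with item v in iv
      ... | zero = ≤-<-trans (count-≤ (dbl l) _) (≤-<-trans (dbl-mono-≤ (<⇒≤ l<r)) size-dummy)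
      ... | suc j with inside
      ...   | inj₁ refl = case trans (sym iv) (item-ghost n ≤-refl) of λ ()
      ...   | inj₂ (v<n , Sv) = begin
        suc (occ digit (suc j) (dbl l)) ≡⟨ +-comm 1 _ ⟩
        occ digit (suc j) (dbl l) + 1   ≤⟨ +-monoʳ-≤ (occ digit (suc j) (dbl l)) (≤-trans (s≤s z≤n)
          (≤-reflexive (sym (count-remove n v v<n (cong₂ _∧_ Sv (trans (cong (_≡ᵇ suc j) iv) (≡ᵇ-refl j))))))) ⟩
        occ digit (suc j) (dbl l) + count n (λ v → S (dbl l) v ∧ (item v ≡ᵇ suc j))
          ≡⟨ counts l (<⇒≤ l<r) (suc j) (s≤s z≤n , subst (_≤ N) iv (item≤N v)) ⟩
        size (suc j) ∎
        where open ≤-Reasoning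

      valid : Valid digit
      valid l l<r with (t<n , St , cov) , second , odd ← picked l l<r = record
        { odd   = trans (cong₂ _xor_
                    (sym (tracks-deg {digit} {L = dbl l} (λ m _ → item≤N (z m)) (tracks l (<⇒≤ l<r)) (match-covered cov) (inj₂ St)))
                    (sym (tracks-deg {digit} {L = dbl l} (λ m _ → item≤N (z m)) (tracks l (<⇒≤ l<r)) (match-second {S (dbl l)} second) (here second)))) odd
        ; left  = enough l l<r (z (dbl l)) (inj₂ (t<n , St))
        ; right = enough l l<r (z (suc (dbl l))) (inside second) }
        where
        here : ∀ {u} → u ≡ n ⊎ In Covered (S (dbl l)) u → item u ≡ 0 ⊎ S (dbl l) u ≡ true
        here (inj₁ refl)         = inj₁ (item-ghost n ≤-refl)
        here (inj₂ (_ , Su , _)) = inj₂ Su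
        inside : ∀ {u} → u ≡ n ⊎ In Covered (S (dbl l)) u → u ≡ n ⊎ (u < n × S (dbl l) u ≡ true)
        inside (inj₁ e)              = inj₁ e
        inside (inj₂ (u<n , Su , _)) = inj₂ (u<n , Su)

  -- Every good partition leaves a valid digit sequence

  data Outcome (r : ℕ) (Y : ℕ → Bool) : Set where
    complete : Chain (λ v → Y v ≡ true) everything r → Outcome r Y
    eulerian : (∀ v → v < n → deg everything v ≡ false) → Outcome r Y
    halted   : Stuck Y → (∃[ t ] t < n × Y t ≡ true × deg everything t ≡ true) ⊎ (∀ v → v < n → Y v ≡ false) →
               Outcome r Y

  -- Below the cap every vertex has a class or is isolated, so the given chain can be encoded
  -- directly. At the cap it may use vertices without a class, and it is replaced by a chain that
  -- does not: the one found greedily inside Y, or the one from `many-types`. Without odd vertices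
  -- the given chain shows that r is 0.
  digits-exist : ∀ {r Y N item rank rep size} (table : Table (6 * r + 5) r Y N item rank rep size) →
    Outcome r Y → count n Y ≤ 2 * r → Chain (λ _ → ⊤) everything r →
    ∃[ d ] (∀ m → d m ≤ N) × Valid table d
  digits-exist {r} {Y} {N} {item} {rank} {rep} table outcome few chain =
    digit , (λ m → item≤N (z m)) , valid
    where
    open Table table
    Y⊆ : ∀ v → v < n → Y v ≡ true → Covered table v
    Y⊆ v v<n Yv with item v in iv
    ... | zero  = inj₂ (covers-Y v v<n Yv iv)
    ... | suc _ = inj₁ (s≤s z≤n)

    reps : ℕ → List ℕ
    reps zero    = []
    reps (suc j) = rep (suc j) ∷ reps j

    length-reps : ∀ j → length (reps j) ≡ j
    length-reps zero    = refl
    length-reps (suc j) = cong suc (length-reps j)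

    reps-All : ∀ {P : ℕ → Set} j → (∀ i → 1 ≤ i → i ≤ j → P (rep i)) → All P (reps j)
    reps-All zero    _ = []
    reps-All (suc j) p = p (suc j) (s≤s z≤n) ≤-refl ∷ reps-All j λ i 1≤i i≤j → p i 1≤i (m≤n⇒m≤1+n i≤j)

    reps-distinct : ∀ j → j ≤ N → AllPairs Distinct (reps j)
    reps-distinct zero    _   = []
    reps-distinct (suc j) j<N =
      reps-All j (λ i 1≤i i≤j → rep-distinct (suc j) i (s≤s z≤n , j<N) (1≤i , ≤-trans i≤j (<⇒≤ j<N)) λ { refl → <-irrefl refl i≤j })
      ∷ reps-distinct j (<⇒≤ j<N)

    restricted : Outcome r Y → N ≡ 6 * r + 5 → ∀ {s} → s ≡ r → Chain (λ _ → ⊤) everything s → Chain (Covered table) everything r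
    restricted (complete c) _ _ _ = Chain-mono Y⊆ c
    restricted (eulerian even) _ refl [] = []
    restricted (eulerian even) _ refl (cut X _ _ odd _) with t , t<n , _ , e ← B-true odd = case trans (sym e) (even t t<n) of λ ()
    restricted (halted stuck odd-in-Y) full _ _ =
      many-types stuck Y⊆ odd-in-Y r (reps N) few (reps-distinct N ≤-refl)
        (reps-All N λ i 1≤i i≤N → rep<n i (1≤i , i≤N)
          , inj₁ (subst (1 ≤_) (sym (rep-item i (1≤i , i≤N))) 1≤i) , rep-nonisolated i (1≤i , i≤N))
        (≤-reflexive (trans (sym full) (sym (length-reps N))))

    covered-chain : Chain (Covered table) everything r
    covered-chain with N ≟ 6 * r + 5
    ... | yes full = restricted outcome full refl chain
    ... | no ¬full = Chain-mono all chain
      where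
      all : ∀ v → v < n → ⊤ → Covered table v
      all v v<n _ with item v in iv
      ... | suc _ = inj₁ (s≤s z≤n)
      ... | zero with covers v v<n iv
      ...   | inj₁ iso  = inj₂ iso
      ...   | inj₂ full = ⊥-elim (¬full full)

    open Completeness table (Chain⇒Picks r covered-chain)

  -- Building the table of twin classes vertex by vertex

  module Classes (r : ℕ) (Y : ℕ → Bool) where

    cap : ℕ
    cap = 6 * r + 5

    -- A table for the vertices in done; a representative may still have to be
    -- added to its own class.
    record Partial (done : ℕ → Bool) (N : ℕ) (item rank rep size : ℕ → ℕ) : Set where
      field
        N≤cap           : N ≤ cap
        item≤N          : ∀ v → item v ≤ N
        item-out        : ∀ v → n ≤ v ⊎ done v ≡ false → item v ≡ 0
        rep-dummy       : rep 0 ≡ n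
        size-dummy      : dbl r < size 0
        size-zero       : ∀ j → N < j → size j ≡ 0
        rep<n           : ∀ j → Index N j → rep j < n
        rep-item        : ∀ j → Index N j → done (rep j) ≡ true → item (rep j) ≡ j
        rep-nonisolated : ∀ j → Index N j → NonIsolated (rep j)
        rep-distinct    : ∀ i j → Index N i → Index N j → i ≢ j → Distinct (rep i) (rep j)
        twin            : ∀ v → 1 ≤ item v → ∀ w → w < n → near v w ≡ near (rep (item v)) w
        size-count      : ∀ j → Index N j → size j ≡ count n (λ v → item v ≡ᵇ j)
        rank<size       : ∀ v → 1 ≤ item v → rank v < size (item v)
        rank-injective  : ∀ u v → 1 ≤ item u → item u ≡ item v → rank u ≡ rank v → u ≡ v
        rank-surjective : ∀ j → Index N j → ∀ ρ → ρ < size j → ∃[ v ] v < n × item v ≡ j × rank v ≡ ρ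
        covers          : ∀ v → v < n → done v ≡ true → item v ≡ 0 → Isolated v ⊎ N ≡ cap
        covers-Y        : ∀ v → v < n → done v ≡ true → Y v ≡ true → item v ≡ 0 → Isolated v

    empty-table : ∀ {done item rank rep size} → (∀ v → v < n → done v ≡ false) → (∀ v → item v ≡ 0) → rep 0 ≡ n →
                  dbl r < size 0 → (∀ j → 1 ≤ j → size j ≡ 0) → Partial done 0 item rank rep size
    empty-table {done} {item} none items rep-dummy size-dummy sizes = record
      { N≤cap = z≤n ; item≤N = λ v → ≤-reflexive (items v) ; item-out = λ v _ → items v
      ; rep-dummy = rep-dummy ; size-dummy = size-dummy ; size-zero = λ j 1≤j → sizes j 1≤j
      ; rep<n = λ j Ij → absurd Ij ; rep-item = λ j Ij → absurd Ij ; rep-nonisolated = λ j Ij → absurd Ij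
      ; rep-distinct = λ i j Ii _ → absurd Ii ; twin = λ v 1≤ → zero-item v 1≤ ; size-count = λ j Ij → absurd Ij
      ; rank<size = λ v 1≤ → zero-item v 1≤ ; rank-injective = λ u v 1≤ → zero-item u 1≤
      ; rank-surjective = λ j Ij → absurd Ij
      ; covers = λ v v<n e → case trans (sym e) (none v v<n) of λ ()
      ; covers-Y = λ v v<n e → case trans (sym e) (none v v<n) of λ () }
      where
      absurd : ∀ {j} {A : Set} → Index 0 j → A
      absurd (s≤s _ , ())
      zero-item : ∀ v {A : Set} → 1 ≤ item v → A
      zero-item v 1≤ = case subst (1 ≤_) (items v) 1≤ of λ ()

    Partial-cong : ∀ {done done′ N item rank rep size} → done ≐ done′ →
                   Partial done N item rank rep size → Partial done′ N item rank rep size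
    Partial-cong {done} {done′} {item = item} same p = record
      { N≤cap = N≤cap ; item≤N = item≤N ; item-out = out
      ; rep-dummy = rep-dummy ; size-dummy = size-dummy ; size-zero = size-zero ; rep<n = rep<n
      ; rep-item = λ j Ij e → rep-item j Ij (trans (same _ (rep<n j Ij)) e)
      ; rep-nonisolated = rep-nonisolated ; rep-distinct = rep-distinct ; twin = twin ; size-count = size-count
      ; rank<size = rank<size ; rank-injective = rank-injective ; rank-surjective = rank-surjective
      ; covers = λ v v<n e → covers v v<n (trans (same v v<n) e)
      ; covers-Y = λ v v<n e → covers-Y v v<n (trans (same v v<n) e) }
      where
      open Partial p
      out : ∀ v → n ≤ v ⊎ done′ v ≡ false → item v ≡ 0
      out v (inj₁ n≤v) = item-out v (inj₁ n≤v)
      out v (inj₂ e) with v <? n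
      ... | yes v<n = item-out v (inj₂ (trans (same v v<n) e))
      ... | no v≮n  = item-out v (inj₁ (≮⇒≥ v≮n))

    module _ {done N item rank rep size} (partial : Partial done N item rank rep size) where

      open Partial partial

      finished : (∀ v → v < n → done v ≡ true) → Table cap r Y N item rank rep size
      finished all = record
        { N≤cap = N≤cap ; item≤N = item≤N ; item-ghost = λ v n≤v → item-out v (inj₁ n≤v)
        ; rep-dummy = rep-dummy ; size-dummy = size-dummy ; rep<n = rep<n
        ; rep-item = λ j Ij → rep-item j Ij (all (rep j) (rep<n j Ij))
        ; rep-nonisolated = rep-nonisolated ; rep-distinct = rep-distinct ; twin = twin ; size-count = size-count
        ; rank-injective = rank-injective ; rank-surjective = rank-surjective
        ; covers = λ v v<n → covers v v<n (all v v<n) ; covers-Y = λ v v<n → covers-Y v v<n (all v v<n) }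

      done-before : ∀ {v w} → w ≢ v → (done △ ⟦ v ⟧) w ≡ done w
      done-before {v} {w} w≢v = trans (cong (done w xor_) (≢⇒≡ᵇ {w} {v} w≢v)) (xor-identityʳ (done w))

      done-not-before : ∀ {v w} → done v ≡ false → (done △ ⟦ v ⟧) w ≡ false → w ≢ v × done w ≡ false
      done-not-before {v} {w} ¬done e with w ≟ v
      ... | yes refl = case trans (sym e) (cong₂ _xor_ ¬done (≡ᵇ-refl w)) of λ ()
      ... | no w≢v   = w≢v , trans (sym (done-before w≢v)) e

      module _ {v} (v<n : v < n) (¬done : done v ≡ false) where

        leave : (∀ i → Index N i → rep i ≢ v) → Isolated v ⊎ N ≡ cap → (Y v ≡ true → Isolated v) →
                Partial (done △ ⟦ v ⟧) N item rank rep size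
        leave no-rep reason reason-Y = record
          { N≤cap = N≤cap ; item≤N = item≤N
          ; item-out = λ { w (inj₁ n≤w) → item-out w (inj₁ n≤w) ; w (inj₂ e) → item-out w (inj₂ (proj₂ (done-not-before ¬done e))) }
          ; rep-dummy = rep-dummy ; size-dummy = size-dummy ; size-zero = size-zero ; rep<n = rep<n
          ; rep-item = λ j Ij e → rep-item j Ij (trans (sym (done-before (no-rep j Ij))) e)
          ; rep-nonisolated = rep-nonisolated ; rep-distinct = rep-distinct ; twin = twin ; size-count = size-count
          ; rank<size = rank<size ; rank-injective = rank-injective ; rank-surjective = rank-surjective
          ; covers = cov ; covers-Y = cov-Y }
          where
          cov : ∀ w → w < n → (done △ ⟦ v ⟧) w ≡ true → item w ≡ 0 → Isolated w ⊎ N ≡ cap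
          cov w w<n e iw with w ≟ v
          ... | yes refl = reason
          ... | no w≢v   = covers w w<n (trans (sym (done-before w≢v)) e) iw
          cov-Y : ∀ w → w < n → (done △ ⟦ v ⟧) w ≡ true → Y w ≡ true → item w ≡ 0 → Isolated w
          cov-Y w w<n e Yw iw with w ≟ v
          ... | yes refl = reason-Y Yw
          ... | no w≢v   = covers-Y w w<n (trans (sym (done-before w≢v)) e) Yw iw

        new-class : NonIsolated v → N < cap → (∀ i → Index N i → Distinct (rep i) v) →
                    Partial done (suc N) item rank (update rep (suc N) v) size
        new-class nonisolated N<cap new = record
          { N≤cap = N<cap ; item≤N = λ w → m≤n⇒m≤1+n (item≤N w) ; item-out = item-out
          ; rep-dummy = rep-dummy ; size-dummy = size-dummy ; size-zero = λ j N<j → size-zero j (<⇒≤ N<j)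
          ; rep<n = λ j Ij → by-index {λ v′ → v′ < n} j Ij v<n (rep<n j)
          ; rep-item = rep-item′
          ; rep-nonisolated = λ j Ij → by-index {NonIsolated} j Ij nonisolated (rep-nonisolated j)
          ; rep-distinct = distinct
          ; twin = λ w 1≤ x x<n → trans (twin w 1≤ x x<n) (cong (λ u → near u x) (sym (old (item w) (item≤N w))))
          ; size-count = count′
          ; rank<size = rank<size ; rank-injective = rank-injective
          ; rank-surjective = surjective
          ; covers = λ w w<n e iw → case covers w w<n e iw of λ
              { (inj₁ iso) → inj₁ iso ; (inj₂ N≡cap) → ⊥-elim (<-irrefl N≡cap N<cap) }
          ; covers-Y = covers-Y }
          where
          rep′ = update rep (suc N) v
          old : ∀ j → j ≤ N → rep′ j ≡ rep j
          old j j≤N = update-other rep (suc N) v j (≢⇒≡ᵇ {j} {suc N} λ { refl → <-irrefl refl j≤N })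
          newest : rep′ (suc N) ≡ v
          newest = update-same rep (suc N) v
          split : ∀ j → Index (suc N) j → j ≡ suc N ⊎ Index N j
          split j (1≤j , j≤1+N) with m≤n⇒m<n∨m≡n j≤1+N
          ... | inj₁ j<1+N = inj₂ (1≤j , s≤s⁻¹ j<1+N)
          ... | inj₂ e     = inj₁ e
          by-index : ∀ {P : ℕ → Set} j → Index (suc N) j → P v → (Index N j → P (rep j)) → P (rep′ j)
          by-index {P} j Ij Pv Pold with split j Ij
          ... | inj₁ refl = subst P (sym newest) Pv
          ... | inj₂ I    = subst P (sym (old j (proj₂ I))) (Pold I)
          rep-item′ : ∀ j → Index (suc N) j → done (rep′ j) ≡ true → item (rep′ j) ≡ j
          rep-item′ j Ij e with split j Ij
          ... | inj₁ refl = case trans (sym e) (trans (cong done newest) ¬done) of λ ()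
          ... | inj₂ I    = trans (cong item (old j (proj₂ I))) (rep-item j I (trans (sym (cong done (old j (proj₂ I)))) e))
          distinct : ∀ i j → Index (suc N) i → Index (suc N) j → i ≢ j → Distinct (rep′ i) (rep′ j)
          distinct i j Ii Ij i≢j with split i Ii | split j Ij
          ... | inj₁ refl | inj₁ refl = ⊥-elim (i≢j refl)
          ... | inj₁ refl | inj₂ J = subst₂ Distinct (sym newest) (sym (old j (proj₂ J))) (Distinct-sym (new j J))
          ... | inj₂ I | inj₁ refl = subst₂ Distinct (sym (old i (proj₂ I))) (sym newest) (new i I)
          ... | inj₂ I | inj₂ J = subst₂ Distinct (sym (old i (proj₂ I))) (sym (old j (proj₂ J))) (rep-distinct i j I J i≢j)
          count′ : ∀ j → Index (suc N) j → size j ≡ count n (λ w → item w ≡ᵇ j)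
          count′ j Ij with split j Ij
          ... | inj₂ I    = size-count j I
          ... | inj₁ refl = trans (size-zero (suc N) ≤-refl)
            (sym (count-zero n λ w _ → ≢⇒≡ᵇ {item w} {suc N} λ e → <-irrefl e (s≤s (item≤N w))))
          surjective : ∀ j → Index (suc N) j → ∀ ρ → ρ < size j → ∃[ w ] w < n × item w ≡ j × rank w ≡ ρ
          surjective j Ij ρ ρ< with split j Ij
          ... | inj₂ I    = rank-surjective j I ρ ρ<
          ... | inj₁ refl = case subst (ρ <_) (size-zero (suc N) ≤-refl) ρ< of λ ()

        -- The newcomer takes the old size as its rank. Old ranks lie below that size, so the ranks
        -- of a class always run through 0 to size - 1, each once.
        join : ∀ j → Index N j → (∀ w → w < n → near v w ≡ near (rep j) w) →
               Partial (done △ ⟦ v ⟧) N (update item v j) (update rank v (size j)) rep (update size j (suc (size j)))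
        join j Ij@(1≤j , j≤N) same-row = record
          { N≤cap = N≤cap
          ; item≤N = λ w → by-vertex {λ w i → i ≤ N} w j≤N (item≤N w)
          ; item-out = out
          ; rep-dummy = rep-dummy
          ; size-dummy = subst (dbl r <_) (sym (size-off 0 λ { refl → case 1≤j of λ () })) size-dummy
          ; size-zero = λ i N<i → trans (size-off i λ { refl → <⇒≱ N<i j≤N }) (size-zero i N<i)
          ; rep<n = rep<n ; rep-item = rep-item′ ; rep-nonisolated = rep-nonisolated ; rep-distinct = rep-distinct
          ; twin = twin′ ; size-count = count′ ; rank<size = rank<′ ; rank-injective = injective ; rank-surjective = surjective
          ; covers = λ w w<n e iw → by-done w e (λ { refl → ⊥-elim (joined-nonzero iw) })
                       λ w≢v e′ → covers w w<n e′ (trans (sym (item-off w w≢v)) iw)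
          ; covers-Y = λ w w<n e Yw iw → by-done w e (λ { refl → ⊥-elim (joined-nonzero iw) })
                         λ w≢v e′ → covers-Y w w<n e′ Yw (trans (sym (item-off w w≢v)) iw) }
          where
          item′ = update item v j
          rank′ = update rank v (size j)
          size′ = update size j (suc (size j))
          item-off : ∀ w → w ≢ v → item′ w ≡ item w
          item-off w w≢v = update-other item v j w (≢⇒≡ᵇ {w} {v} w≢v)
          item-on : item′ v ≡ j
          item-on = update-same item v j
          rank-off : ∀ w → w ≢ v → rank′ w ≡ rank w
          rank-off w w≢v = update-other rank v (size j) w (≢⇒≡ᵇ {w} {v} w≢v)
          rank-on : rank′ v ≡ size j
          rank-on = update-same rank v (size j)
          size-off : ∀ i → i ≢ j → size′ i ≡ size i
          size-off i i≢j = update-other size j (suc (size j)) i (≢⇒≡ᵇ {i} {j} i≢j)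
          size-on : size′ j ≡ suc (size j)
          size-on = update-same size j (suc (size j))
          joined-nonzero : item′ v ≡ 0 → ⊥
          joined-nonzero e = case subst (1 ≤_) (trans (sym item-on) e) 1≤j of λ ()
          by-vertex : ∀ {P : ℕ → ℕ → Set} w → P v j → P w (item w) → P w (item′ w)
          by-vertex {P} w Pv Pw with w ≟ v
          ... | yes refl = subst (P w) (sym item-on) Pv
          ... | no w≢v   = subst (P w) (sym (item-off w w≢v)) Pw
          by-done : ∀ {P : Set} w → (done △ ⟦ v ⟧) w ≡ true → (w ≡ v → P) → (w ≢ v → done w ≡ true → P) → P
          by-done w e at off with w ≟ v
          ... | yes w≡v = at w≡v
          ... | no w≢v  = off w≢v (trans (sym (done-before w≢v)) e)
          out : ∀ w → n ≤ w ⊎ (done △ ⟦ v ⟧) w ≡ false → item′ w ≡ 0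
          out w (inj₁ n≤w) = trans (item-off w λ { refl → <⇒≱ v<n n≤w }) (item-out w (inj₁ n≤w))
          out w (inj₂ e) with w≢v , e′ ← done-not-before ¬done e = trans (item-off w w≢v) (item-out w (inj₂ e′))
          rep-item′ : ∀ i → Index N i → (done △ ⟦ v ⟧) (rep i) ≡ true → item′ (rep i) ≡ i
          rep-item′ i Ii e with rep i ≟ v | i ≟ j
          ... | no rep≢v | _ = trans (item-off (rep i) rep≢v) (rep-item i Ii (trans (sym (done-before rep≢v)) e))
          ... | yes rep≡v | yes refl = trans (cong item′ rep≡v) item-on
          -- A vertex that joins class j cannot represent another class i, because the
          -- representatives have different closed neighbourhoods.
          ... | yes rep≡v | no i≢j with _ , w , w<n , ne ← rep-distinct i j Ii Ij i≢j =
            ⊥-elim (ne (trans (cong (λ u → near u w) rep≡v) (same-row w w<n)))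
          twin′ : ∀ w → 1 ≤ item′ w → ∀ x → x < n → near w x ≡ near (rep (item′ w)) x
          twin′ w 1≤ x x<n with w ≟ v
          ... | yes refl = trans (same-row x x<n) (cong (λ i → near (rep i) x) (sym item-on))
          ... | no w≢v   = trans (twin w (subst (1 ≤_) (item-off w w≢v) 1≤) x x<n) (cong (λ i → near (rep i) x) (sym (item-off w w≢v)))
          count′ : ∀ i → Index N i → size′ i ≡ count n (λ w → item′ w ≡ᵇ i)
          count′ i Ii with i ≟ j
          ... | yes refl = trans size-on (sym (trans (count-remove n v v<n (trans (cong (_≡ᵇ i) item-on) (≡ᵇ-refl i)))
                             (cong suc (trans (count-cong n others) (sym (size-count i Ii))))))
            where
            others : ∀ w → w < n → (item′ w ≡ᵇ i) xor (w ≡ᵇ v) ≡ (item w ≡ᵇ i)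
            others w _ with w ≟ v
            ... | yes refl rewrite item-on | ≡ᵇ-refl i | ≡ᵇ-refl w | item-out w (inj₂ ¬done) =
              sym (≢⇒≡ᵇ {0} {i} λ { refl → case 1≤j of λ () })
            ... | no w≢v = trans (cong₂ _xor_ (cong (_≡ᵇ i) (item-off w w≢v)) (≢⇒≡ᵇ {w} {v} w≢v)) (xor-identityʳ _)
          ... | no i≢j = trans (size-off i i≢j) (trans (size-count i Ii) (count-cong n same))
            where
            same : ∀ w → w < n → (item w ≡ᵇ i) ≡ (item′ w ≡ᵇ i)
            same w _ with w ≟ v
            ... | yes refl = trans (≢⇒≡ᵇ {item w} {i} λ e → case subst (1 ≤_) (trans (sym e) (item-out w (inj₂ ¬done))) (proj₁ Ii) of λ ())
                                   (sym (trans (cong (_≡ᵇ i) item-on) (≢⇒≡ᵇ {j} {i} (i≢j ∘ sym))))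
            ... | no w≢v = cong (_≡ᵇ i) (sym (item-off w w≢v))
          size-grows : ∀ i → size i ≤ size′ i
          size-grows i with i ≟ j
          ... | yes refl = ≤-trans (n≤1+n _) (≤-reflexive (sym size-on))
          ... | no i≢j   = ≤-reflexive (sym (size-off i i≢j))
          rank<′ : ∀ w → 1 ≤ item′ w → rank′ w < size′ (item′ w)
          rank<′ w 1≤ with w ≟ v
          ... | yes refl = subst₂ _<_ (sym rank-on) (trans (sym size-on) (cong size′ (sym item-on))) ≤-refl
          ... | no w≢v   = subst₂ _<_ (sym (rank-off w w≢v)) (cong size′ (sym (item-off w w≢v)))
                             (<-≤-trans (rank<size w (subst (1 ≤_) (item-off w w≢v) 1≤)) (size-grows (item w)))
          fresh : ∀ w → w ≢ v → 1 ≤ item′ w → item′ w ≡ item′ v → rank′ w ≢ rank′ v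
          fresh w w≢v 1≤ items ranks = <-irrefl (trans (sym (rank-off w w≢v)) (trans ranks rank-on))
            (subst (rank w <_) (cong size (trans (sym (item-off w w≢v)) (trans items item-on))) (rank<size w (subst (1 ≤_) (item-off w w≢v) 1≤)))
          injective : ∀ u w → 1 ≤ item′ u → item′ u ≡ item′ w → rank′ u ≡ rank′ w → u ≡ w
          injective u w 1≤ items ranks with u ≟ v | w ≟ v
          ... | yes refl | yes refl = refl
          ... | yes refl | no w≢v = ⊥-elim (fresh w w≢v (subst (1 ≤_) items 1≤) (sym items) (sym ranks))
          ... | no u≢v | yes refl = ⊥-elim (fresh u u≢v 1≤ items ranks)
          ... | no u≢v | no w≢v = rank-injective u w (subst (1 ≤_) (item-off u u≢v) 1≤)
            (trans (sym (item-off u u≢v)) (trans items (item-off w w≢v))) (trans (sym (rank-off u u≢v)) (trans ranks (rank-off w w≢v)))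
          surjective : ∀ i → Index N i → ∀ ρ → ρ < size′ i → ∃[ w ] w < n × item′ w ≡ i × rank′ w ≡ ρ
          surjective i Ii ρ ρ< = choose (i ≟ j)
            where
            from-old : ρ < size i → ∃[ w ] w < n × item′ w ≡ i × rank′ w ≡ ρ
            from-old ρ<size with w , w<n , iw , rw ← rank-surjective i Ii ρ ρ<size =
              w , w<n , trans (item-off w w≢v) iw , trans (rank-off w w≢v) rw
              where
              w≢v : w ≢ v
              w≢v refl = case subst (1 ≤_) (trans (sym iw) (item-out w (inj₂ ¬done))) (proj₁ Ii) of λ ()
            choose : Dec (i ≡ j) → ∃[ w ] w < n × item′ w ≡ i × rank′ w ≡ ρ
            choose (no i≢j) = from-old (subst (ρ <_) (size-off i i≢j) ρ<)
            choose (yes refl) with m≤n⇒m<n∨m≡n (s≤s⁻¹ (subst (ρ <_) size-on ρ<))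
            ... | inj₁ ρ<size = from-old ρ<size
            ... | inj₂ refl   = v , v<n , item-on , rank-on

-- Reasoning about programs

writesVar : Cmd → ℕ → Bool
writesVar skip           y = false
writesVar (x := e)       y = y ≡ᵇ x
writesVar (x ⁅ i ⁆:= e)  y = false
writesVar (c₁ ⨾ c₂)      y = writesVar c₁ y ∨ writesVar c₂ y
writesVar (branch e c₁ c₂) y = writesVar c₁ y ∨ writesVar c₂ y
writesVar (while e c)    y = writesVar c y

writesArr : Cmd → ℕ → Bool
writesArr skip           y = false
writesArr (x := e)       y = false
writesArr (x ⁅ i ⁆:= e)  y = y ≡ᵇ x
writesArr (c₁ ⨾ c₂)      y = writesArr c₁ y ∨ writesArr c₂ y
writesArr (branch e c₁ c₂) y = writesArr c₁ y ∨ writesArr c₂ y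
writesArr (while e c)    y = writesArr c y

-- The frame condition. What a command writes is a Boolean computed from its text, so for a concrete
-- program the side conditions are proved by `refl`. Arrays are equated as functions, which allows a
-- whole table to be transported at once.
record Same (c : Cmd) (σ τ : State) : Set where
  field
    var= : ∀ x → writesVar c x ≡ false → vars τ x ≡ vars σ x
    arr≡ : ∀ x → writesArr c x ≡ false → arrs τ x ≡ arrs σ x

open Same public

arr= : ∀ {c σ τ} → Same c σ τ → ∀ x → writesArr c x ≡ false → ∀ i → arrs τ x i ≡ arrs σ x i
arr= same x w i = cong (λ f → f i) (arr≡ same x w)

∨-false : ∀ {p q} → p ∨ q ≡ false → p ≡ false × q ≡ false
∨-false {false} e = refl , e

Same-refl : ∀ {c σ} → Same c σ σ
Same-refl = record { var= = λ _ _ → refl ; arr≡ = λ _ _ → refl }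

Same-trans : ∀ {c σ τ ρ} → Same c σ τ → Same c τ ρ → Same c σ ρ
Same-trans s s′ = record
  { var= = λ x w → trans (var= s′ x w) (var= s x w)
  ; arr≡ = λ x w → trans (arr≡ s′ x w) (arr≡ s x w) }

Same-⊆ : ∀ {c c′ σ τ} → (∀ x → writesVar c′ x ≡ false → writesVar c x ≡ false) →
         (∀ x → writesArr c′ x ≡ false → writesArr c x ≡ false) → Same c σ τ → Same c′ σ τ
Same-⊆ v a s = record { var= = λ x w → var= s x (v x w) ; arr≡ = λ x w → arr≡ s x (a x w) }

Same-ˡ : ∀ {c c′ σ τ} → Same c σ τ → Same (c ⨾ c′) σ τ
Same-ˡ = Same-⊆ (λ _ w → proj₁ (∨-false w)) (λ _ w → proj₁ (∨-false w))

Same-ʳ : ∀ {c c′ σ τ} → Same c′ σ τ → Same (c ⨾ c′) σ τ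
Same-ʳ {c} = Same-⊆ (λ x w → proj₂ (∨-false {writesVar c x} w)) (λ x w → proj₂ (∨-false {writesArr c x} w))

Same-var : ∀ {x e v σ} → Same (x := e) σ (setVar x v σ)
Same-var {x} {e} {v} {σ} = record { var= = update-other (vars σ) x v ; arr≡ = λ _ _ → refl }

Same-arr : ∀ {x i e j v σ} → Same (x ⁅ i ⁆:= e) σ (setArr x j v σ)
Same-arr {x} {j = j} {v} {σ} = record
  { var= = λ _ _ → refl
  ; arr≡ = λ y w → update-other (arrs σ) x (update (arrs σ x) j v) y w }

module _ {W : ℕ} where

  Run⇒Same : ∀ {c σ τ t} → Run W c σ τ t → Same c σ τ
  Run⇒Same run-skip         = Same-refl
  Run⇒Same (run-var {e = e} _) = Same-var {e = e}
  Run⇒Same (run-arr {i = i} {e} _ _) = Same-arr {i = i} {e}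
  Run⇒Same (run-seq {c₁ = c₁} {c₂} p q) = Same-trans (Same-ˡ {c₁} {c₂} (Run⇒Same p)) (Same-ʳ {c₁} {c₂} (Run⇒Same q))
  Run⇒Same (run-then {c₁ = c₁} {c₂} _ _ p) =
    Same-⊆ (λ _ w → proj₁ (∨-false w)) (λ _ w → proj₁ (∨-false w)) (Run⇒Same p)
  Run⇒Same (run-else {c₁ = c₁} {c₂} _ _ p) =
    Same-⊆ (λ x w → proj₂ (∨-false {writesVar c₁ x} w)) (λ x w → proj₂ (∨-false {writesArr c₁ x} w)) (Run⇒Same p)
  Run⇒Same (run-stop _ _)   = Same-refl
  Run⇒Same (run-loop {e = e} {c} _ _ p q) =
    Same-trans (Same-⊆ {c} {while e c} (λ _ w → w) (λ _ w → w) (Run⇒Same p)) (Run⇒Same q)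

leaves : Exp → ℕ
leaves (lit a)      = 1
leaves (var x)      = 1
leaves (x ⁅ e ⁆)    = leaves e
leaves (op o e₁ e₂) = leaves e₁ + leaves e₂

smallLits : Exp → Bool
smallLits (lit a)      = a <ᵇ 8
smallLits (var x)      = true
smallLits (x ⁅ e ⁆)    = smallLits e
smallLits (op o e₁ e₂) = smallLits e₁ ∧ smallLits e₂

-- For a concrete expression this computes to a product of unit types, so the implicit arguments of
-- this type are filled in by unification.
Small : Exp → Set
Small e = T (smallLits e) × T (leaves e <ᵇ 20)

forLoop : ℕ → Exp → Cmd → Cmd
forLoop x e c = x := lit 0 ⨾ while (op less (var x) e) (c ⨾ x := op add (var x) (lit 1))

record Bounded (M : ℕ) (σ : State) : Set where
  field
    var≤ : ∀ x → vars σ x ≤ M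
    arr≤ : ∀ x i → arrs σ x i ≤ M

open Bounded public

if-≤ : ∀ {p q M} b → p ≤ M → q ≤ M → (if b then p else q) ≤ M
if-≤ true  p≤ _  = p≤
if-≤ false _  q≤ = q≤

Bounded-var : ∀ {M x v σ} → v ≤ M → Bounded M σ → Bounded M (setVar x v σ)
Bounded-var {x = x} v≤ b = record { var≤ = λ y → if-≤ (y ≡ᵇ x) v≤ (var≤ b y) ; arr≤ = arr≤ b }

Bounded-arr : ∀ {M x i v σ} → v ≤ M → Bounded M σ → Bounded M (setArr x i v σ)
Bounded-arr {M} {x} {i} {v} {σ} v≤ b = record { var≤ = var≤ b ; arr≤ = λ y j → bound y j (y ≡ᵇ x) }
  where
  bound : ∀ y j p → (if p then update (arrs σ x) i v else arrs σ y) j ≤ M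
  bound y j true  = if-≤ (j ≡ᵇ i) v≤ (arr≤ b x j)
  bound y j false = arr≤ b y j

-- All stored values are at most M; the value of a small expression over
-- them is at most M ^ 20.

module Machine (W M : ℕ) (8≤M : 8 ≤ M) (M^20≤W : M ^ 20 ≤ W) where

  private
    instance
      M-nonZero : NonZero M
      M-nonZero = >-nonZero (≤-trans (s≤s z≤n) 8≤M)

    2≤M : 2 ≤ M
    2≤M = ≤-trans (s≤s (s≤s z≤n)) 8≤M

    1≤leaves : ∀ e → 1 ≤ leaves e
    1≤leaves (lit a)      = ≤-refl
    1≤leaves (var x)      = ≤-refl
    1≤leaves (x ⁅ e ⁆)    = 1≤leaves e
    1≤leaves (op o e₁ e₂) = ≤-trans (1≤leaves e₁) (m≤m+n _ _)

    M≤ : ∀ {l} → 1 ≤ l → M ≤ M ^ l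
    M≤ 1≤l = ≤-trans (≤-reflexive (sym (^-identityʳ M))) (^-monoʳ-≤ M 1≤l)

    sum≤product : ∀ p q → 2 ≤ p → 2 ≤ q → p + q ≤ p * q
    sum≤product (suc (suc p)) (suc (suc q)) _ _ = begin
      suc (suc p) + suc (suc q)      ≤⟨ m≤m+n _ (p + q + p * q) ⟩
      suc (suc p) + suc (suc q) + (p + q + p * q) ≡⟨ arith p q ⟩
      suc (suc p) * suc (suc q)      ∎
      where
      open ≤-Reasoning
      arith : ∀ p q → suc (suc p) + suc (suc q) + (p + q + p * q) ≡ suc (suc p) * suc (suc q)
      arith = solve-∀
    sum≤product 0 _ () _
    sum≤product 1 _ (s≤s ()) _
    sum≤product (suc (suc _)) 0 _ ()
    sum≤product (suc (suc _)) 1 _ (s≤s ())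

    T-∧⁻ : ∀ {p q} → T (p ∧ q) → T p × T q
    T-∧⁻ {true} t = tt , t

    -- No operation does worse than multiplication: the bounds for the two operands are at least 2,
    -- so their sum is at most their product.
    eval≤ : ∀ {σ} e → Bounded M σ → T (smallLits e) → eval σ e ≤ M ^ leaves e
    eval≤ (lit a) b small = ≤-trans (<⇒≤ (<ᵇ⇒< a 8 small)) (≤-trans 8≤M (M≤ ≤-refl))
    eval≤ (var x)   b _ = ≤-trans (var≤ b x) (M≤ ≤-refl)
    eval≤ (x ⁅ e ⁆) b _ = ≤-trans (arr≤ b x _) (M≤ (1≤leaves e))
    eval≤ {σ} (op o e₁ e₂) b small = result o
      where
      lits = T-∧⁻ {smallLits e₁} small
      l = leaves e₁
      m = leaves e₂
      v₁≤ = eval≤ {σ} e₁ b (proj₁ lits)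
      v₂≤ = eval≤ {σ} e₂ b (proj₂ lits)
      one≤ : 1 ≤ M ^ (l + m)
      one≤ = m^n>0 M (l + m)
      result : ∀ o → apply o (eval σ e₁) (eval σ e₂) ≤ M ^ (l + m)
      result add = ≤-trans (+-mono-≤ v₁≤ v₂≤) (≤-trans
        (sum≤product (M ^ l) (M ^ m) (≤-trans 2≤M (M≤ (1≤leaves e₁))) (≤-trans 2≤M (M≤ (1≤leaves e₂))))
        (≤-reflexive (sym (^-distribˡ-+-* M l m))))
      result sub = ≤-trans (m∸n≤m _ (eval σ e₂)) (≤-trans v₁≤ (^-monoʳ-≤ M (m≤m+n l m)))
      result mul = ≤-trans (*-mono-≤ v₁≤ v₂≤) (≤-reflexive (sym (^-distribˡ-+-* M l m)))
      result less  = ≤-trans (bit≤1 _) one≤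
      result equal = ≤-trans (bit≤1 _) one≤

    fits′ : ∀ {σ} e → Bounded M σ → T (smallLits e) → leaves e ≤ 20 → Fits W σ e
    value≤W : ∀ {σ} e → Bounded M σ → T (smallLits e) → leaves e ≤ 20 → eval σ e ≤ W
    value≤W e b lits l≤ = ≤-trans (eval≤ e b lits) (≤-trans (^-monoʳ-≤ M l≤) M^20≤W)
    fits′ e@(lit a)   b lits l≤ = value≤W e b lits l≤ , tt
    fits′ e@(var x)   b lits l≤ = value≤W e b lits l≤ , tt
    fits′ e@(x ⁅ e₁ ⁆) b lits l≤ = value≤W e b lits l≤ , fits′ e₁ b lits l≤
    fits′ e@(op o e₁ e₂) b lits l≤ = value≤W e b lits l≤
      , fits′ e₁ b (proj₁ (T-∧⁻ {smallLits e₁} lits)) (≤-trans (m≤m+n _ _) l≤)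
      , fits′ e₂ b (proj₂ (T-∧⁻ {smallLits e₁} lits)) (≤-trans (m≤n+m _ _) l≤)

    fits : ∀ {σ} e → Bounded M σ → Small e → Fits W σ e
    fits e b (lits , l<) = fits′ e b lits (<⇒≤ (<ᵇ⇒< (leaves e) 20 l<))

  -- A Hoare triple with a time bound. `bounded` is carried along because it is what makes the
  -- expressions of the next command fit into a word.
  record Runs (c : Cmd) (σ : State) (t : ℕ) (Q : State → Set) : Set where
    constructor runs
    field
      {final}  : State
      {time}   : ℕ
      run      : Run W c σ final time
      time≤    : time ≤ t
      bounded  : Bounded M final
      holds    : Q final

  weaken : ∀ {c σ t t′ Q Q′} → t ≤ t′ → (∀ τ → Bounded M τ → Same c σ τ → Q τ → Q′ τ) →
           Runs c σ t Q → Runs c σ t′ Q′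
  weaken t≤ Q⇒ (runs r s≤ b q) = runs r (≤-trans s≤ t≤) b (Q⇒ _ b (Run⇒Same r) q)

  slower : ∀ {c σ t t′ Q} → t ≤ t′ → Runs c σ t Q → Runs c σ t′ Q
  slower t≤ = weaken t≤ λ _ _ _ q → q

  do-skip : ∀ {σ Q} → Bounded M σ → Q σ → Runs skip σ 1 Q
  do-skip b q = runs run-skip ≤-refl b q

  do-var : ∀ {σ x e Q} v {sm : Small e} → Bounded M σ → eval σ e ≡ v → v ≤ M →
           Q (setVar x v σ) → Runs (x := e) σ 1 Q
  do-var {e = e} v {sm = s} b refl v≤ q = runs (run-var (fits e b s)) ≤-refl (Bounded-var v≤ b) q

  do-arr : ∀ {σ x i e Q} j v {sm′ : Small i} {sm : Small e} → Bounded M σ → eval σ i ≡ j → eval σ e ≡ v → v ≤ M →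
           Q (setArr x j v σ) → Runs (x ⁅ i ⁆:= e) σ 1 Q
  do-arr {i = i} {e} j v {sm′ = s} {sm = s′} b refl refl v≤ q =
    runs (run-arr (fits i b s) (fits e b s′)) ≤-refl (Bounded-arr v≤ b) q

  infixr 3 _then_
  _then_ : ∀ {c₁ c₂ σ t₁ t₂ Q R} → Runs c₁ σ t₁ Q →
           (∀ τ → Bounded M τ → Same c₁ σ τ → Q τ → Runs c₂ τ t₂ R) → Runs (c₁ ⨾ c₂) σ (t₁ + t₂) R
  runs r s≤ b q then k with k _ b (Run⇒Same r) q
  ... | runs r′ s′≤ b′ q′ = runs (run-seq r r′) (+-mono-≤ s≤ s′≤) b′ q′

  var-then : ∀ {σ x e c t R} v {sm : Small e} → Bounded M σ → eval σ e ≡ v → v ≤ M →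
             (Bounded M (setVar x v σ) → Runs c (setVar x v σ) t R) → Runs (x := e ⨾ c) σ (suc t) R
  var-then {e = e} v {sm = s} b refl v≤ k with k (Bounded-var v≤ b)
  ... | runs r s≤ b′ q = runs (run-seq (run-var (fits e b s)) r) (s≤s s≤) b′ q

  arr-then : ∀ {σ x i e c t R} j v {sm′ : Small i} {sm : Small e} → Bounded M σ → eval σ i ≡ j → eval σ e ≡ v → v ≤ M →
             (Bounded M (setArr x j v σ) → Runs c (setArr x j v σ) t R) → Runs (x ⁅ i ⁆:= e ⨾ c) σ (suc t) R
  arr-then {i = i} {e} j v {sm′ = s} {sm = s′} b refl refl v≤ k with k (Bounded-arr v≤ b)
  ... | runs r s≤ b′ q = runs (run-seq (run-arr (fits i b s) (fits e b s′)) r) (s≤s s≤) b′ q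

  do-branch : ∀ {σ e c₁ c₂ t Q} {sm : Small e} → Bounded M σ →
              (eval σ e ≢ 0 → Runs c₁ σ t Q) → (eval σ e ≡ 0 → Runs c₂ σ t Q) → Runs (branch e c₁ c₂) σ (suc t) Q
  do-branch {σ} {e} {sm = s} b yes-branch no-branch with eval σ e ≟ 0
  ... | yes e≡0 with no-branch e≡0
  ...   | runs r s≤ b′ q = runs (run-else (fits e b s) e≡0 r) (s≤s s≤) b′ q
  do-branch {σ} {e} {sm = s} b yes-branch no-branch | no e≢0 with yes-branch e≢0
  ...   | runs r s≤ b′ q = runs (run-then (fits e b s) e≢0 r) (s≤s s≤) b′ q

  do-if : ∀ {σ e c₁ c₂ t Q} p {sm : Small e} → Bounded M σ → eval σ e ≡ bit p →
          (p ≡ true → Runs c₁ σ t Q) → (p ≡ false → Runs c₂ σ t Q) → Runs (branch e c₁ c₂) σ (suc t) Q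
  do-if true  {sm = s} b e yes-branch no-branch =
    do-branch {sm = s} b (λ _ → yes-branch refl) (λ e≡0 → case trans (sym e) e≡0 of λ ())
  do-if false {sm = s} b e yes-branch no-branch =
    do-branch {sm = s} b (λ e≢0 → ⊥-elim (e≢0 e)) (λ _ → no-branch refl)

  while-stop : ∀ {σ e c Q} {sm : Small e} → Bounded M σ → eval σ e ≡ 0 → Q σ → Runs (while e c) σ 1 Q
  while-stop {e = e} {sm = s} b e≡0 q = runs (run-stop (fits e b s) e≡0) ≤-refl b q

  while-step : ∀ {σ e c t₁ t₂ Q R} {sm : Small e} → Bounded M σ → eval σ e ≢ 0 → Runs c σ t₁ Q →
               (∀ τ → Bounded M τ → Same c σ τ → Q τ → Runs (while e c) τ t₂ R) → Runs (while e c) σ (suc (t₁ + t₂)) R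
  while-step {e = e} {sm = s} b e≢0 (runs r s≤ b₁ q) k with k _ b₁ (Run⇒Same r) q
  ... | runs r′ s′≤ b′ q′ = runs (run-loop (fits e b s) e≢0 r r′) (s≤s (+-mono-≤ s≤ s′≤)) b′ q′

  -- N is the actual number of rounds, N′ a bound that serves the time estimate. A round costs t + 2
  -- with its test and increment; the initial assignment and the final test cost 2 more, which N′ ≥
  -- 1 absorbs by raising t + 2 to t + 4.
  do-for : ∀ {x e c σ t} N N′ (I : ℕ → State → Set) {sm : Small (op less (var x) e)} →
    writesVar c x ≡ false → Bounded M σ → N ≤ N′ → 1 ≤ N′ → N ≤ M →
    (∀ τ → Same (forLoop x e c) σ τ → eval τ e ≡ N) →
    I 0 (setVar x 0 σ) →
    (∀ i τ → i < N → Bounded M τ → Same (forLoop x e c) σ τ → vars τ x ≡ i → I i τ →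
       Runs c τ t (λ τ′ → I (suc i) (setVar x (suc i) τ′))) →
    Runs (forLoop x e c) σ (N′ * (t + 4)) (I N)
  do-for {x} {e} {c} {σ} {t} N N′ I {sm = s} c-keeps b N≤N′ 1≤N′ N≤M N-fixed start body =
    slower time-bound (var-then 0 b refl z≤n λ b′ →
      iterate N 0 (setVar x 0 σ) (+-identityʳ N) b′
        (Same-ˡ {x := lit 0} {while _ (c ⨾ _)} (Same-var {x} {lit 0})) (update-same (vars σ) x 0) start)
    where
    time-bound : suc (N * (t + 2) + 1) ≤ N′ * (t + 4)
    time-bound = begin
      suc (N * (t + 2) + 1)     ≡⟨ trans (cong suc (+-comm (N * (t + 2)) 1)) (+-comm 2 (N * (t + 2))) ⟩
      N * (t + 2) + 2           ≤⟨ +-mono-≤ (*-monoˡ-≤ (t + 2) N≤N′) (*-monoˡ-≤ 2 1≤N′) ⟩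
      N′ * (t + 2) + N′ * 2     ≡⟨ sym (*-distribˡ-+ N′ (t + 2) 2) ⟩
      N′ * (t + 2 + 2)          ≡⟨ cong (N′ *_) (+-assoc t 2 2) ⟩
      N′ * (t + 4)              ∎
      where open ≤-Reasoning
    loop : Cmd
    loop = while (op less (var x) e) (c ⨾ x := op add (var x) (lit 1))
    less-true : ∀ {i j} → i < j → bit (i <ᵇ j) ≢ 0
    less-true {i} {j} i<j with i <ᵇ j | <⇒<ᵇ i<j
    ... | true | _ = λ ()
    less-false : ∀ j → bit (j <ᵇ j) ≡ 0
    less-false zero    = refl
    less-false (suc j) = less-false j
    iterate : ∀ m i τ → m + i ≡ N → Bounded M τ → Same (forLoop x e c) σ τ → vars τ x ≡ i → I i τ →
              Runs loop τ (m * (t + 2) + 1) (I N)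
    iterate zero i τ refl b′ same xi inv =
      runs (run-stop (fits (op less (var x) e) b′ s) (trans (cong₂ (λ p q → bit (p <ᵇ q)) xi (N-fixed τ same)) (less-false i))) ≤-refl b′ inv
    iterate (suc m) i τ m+i b′ same xi inv with body i τ i<N b′ same xi inv
      where i<N : i < N
            i<N = subst (i <_) m+i (s≤s (m≤n+m i m))
    ... | runs {τ′} {t₁} r₁ t₁≤ b₁ q₁
      with iterate m (suc i) (setVar x (suc i) τ′) (trans (+-suc m i) m+i)
             (Bounded-var 1+i≤M b₁)
             (Same-trans (Same-trans same
               (Same-⊆ {c} {forLoop x e c} (λ y w → proj₁ (∨-false {writesVar c y} (proj₂ (∨-false {y ≡ᵇ x} w))))
                       (λ y w → proj₁ (∨-false w)) (Run⇒Same r₁)))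
               (Same-⊆ {x := lit 0} {forLoop x e c} (λ y w → proj₁ (∨-false {y ≡ᵇ x} w)) (λ _ _ → refl) (Same-var {x} {lit 0})))
             (update-same (vars τ′) x (suc i)) q₁
      where 1+i≤M : suc i ≤ M
            1+i≤M = ≤-trans (subst (suc i ≤_) m+i (s≤s (m≤n+m i m))) N≤M
    ... | runs r₂ t₂≤ b₂ q₂ =
      runs (run-loop (fits (op less (var x) e) b′ s) (λ e0 → less-true i<N (trans (sym (cong₂ (λ p q → bit (p <ᵇ q)) xi (N-fixed τ same))) e0))
             (run-seq r₁ (subst (λ v → Run W (x := op add (var x) (lit 1)) τ′ (setVar x v τ′) 1) count-up
               (run-var (fits (op add (var x) (lit 1)) b₁ (tt , tt))))) r₂)
           (begin
             suc (t₁ + 1 + _)               ≤⟨ s≤s (+-mono-≤ (+-monoˡ-≤ 1 t₁≤) t₂≤) ⟩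
             suc (t + 1 + (m * (t + 2) + 1)) ≡⟨ arith t (m * (t + 2)) ⟩
             t + 2 + m * (t + 2) + 1        ∎)
           b₂ q₂
      where
      open ≤-Reasoning
      i<N : i < N
      i<N = subst (i <_) m+i (s≤s (m≤n+m i m))
      arith : ∀ t u → suc (t + 1 + (u + 1)) ≡ t + 2 + u + 1
      arith = solve-∀
      count-up : vars τ′ x + 1 ≡ suc i
      count-up = trans (cong (_+ 1) (trans (var= (Run⇒Same r₁) x c-keeps) xi)) (+-comm i 1)

-- The program

nᵛ kᵛ rᵛ Dᵛ Nᵛ capᵛ goᵛ okᵛ uᵛ vᵛ wᵛ iᵛ xᵛ yᵛ zᵛ sᵛ tᵛ : ℕ
nᵛ = 0
kᵛ = 1
rᵛ = 2
Dᵛ = 3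
Nᵛ = 4
capᵛ = 5
goᵛ = 6
okᵛ = 7
uᵛ = 10
vᵛ = 11
wᵛ = 12
iᵛ = 13
xᵛ = 20
yᵛ = 21
zᵛ = 22
sᵛ = 23
tᵛ = 24

adjᵃ outᵃ parᵃ remᵃ itemᵃ rankᵃ repᵃ sizeᵃ digᵃ degᵃ : ℕ
adjᵃ = 0
outᵃ = 1
parᵃ = 2
remᵃ = 3
itemᵃ = 4
rankᵃ = 5
repᵃ = 6
sizeᵃ = 7
digᵃ = 8
degᵃ = 9

infixl 6 _+ᴱ_ _-ᴱ_
infixl 7 _*ᴱ_
infix 5 _<ᴱ_ _=ᴱ_
_+ᴱ_ _-ᴱ_ _*ᴱ_ _<ᴱ_ _=ᴱ_ xorᴱ cell closedCell linked : Exp → Exp → Exp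
_+ᴱ_ = op add
_-ᴱ_ = op sub
_*ᴱ_ = op mul
_<ᴱ_ = op less
_=ᴱ_ = op equal
xorᴱ e₁ e₂ = (e₁ =ᴱ e₂) =ᴱ lit 0
cell e₁ e₂ = adjᵃ ⁅ e₁ *ᴱ var nᵛ +ᴱ e₂ ⁆
closedCell e₁ e₂ = cell e₁ e₂ +ᴱ (e₁ =ᴱ e₂)
linked e₁ e₂ = closedCell (repᵃ ⁅ e₁ ⁆) (repᵃ ⁅ e₂ ⁆) *ᴱ (lit 0 <ᴱ e₂)

notᴱ : Exp → Exp
notᴱ e = e =ᴱ lit 0

computeDegrees : Cmd
computeDegrees =
  forLoop uᵛ (var nᵛ)
    ( xᵛ := lit 0
    ⨾ forLoop vᵛ (var nᵛ) (xᵛ := xorᴱ (var xᵛ) (cell (var uᵛ) (var vᵛ)))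
    ⨾ parᵃ ⁅ var uᵛ ⁆:= var xᵛ
    ⨾ degᵃ ⁅ var uᵛ ⁆:= var xᵛ )

remove : ℕ → Cmd
remove x =
    remᵃ ⁅ var x -ᴱ lit 1 ⁆:= lit 1
  ⨾ forLoop vᵛ (var nᵛ) (parᵃ ⁅ var vᵛ ⁆:= xorᴱ (parᵃ ⁅ var vᵛ ⁆) (cell (var x -ᴱ lit 1) (var vᵛ)))

scanBody : Cmd
scanBody =
  branch ((remᵃ ⁅ var uᵛ ⁆) +ᴱ (remᵃ ⁅ var vᵛ ⁆)) skip
    (branch (parᵃ ⁅ var uᵛ ⁆)
      ( xᵛ := var uᵛ +ᴱ lit 1
      ⨾ branch (xorᴱ (parᵃ ⁅ var vᵛ ⁆) (cell (var uᵛ) (var vᵛ)) *ᴱ notᴱ (var uᵛ =ᴱ var vᵛ))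
          (yᵛ := var uᵛ +ᴱ lit 1) skip )
      (branch (cell (var uᵛ) (var vᵛ)) (zᵛ := var uᵛ +ᴱ lit 1) skip))

scan : Cmd
scan = xᵛ := lit 0 ⨾ yᵛ := lit 0 ⨾ zᵛ := lit 0 ⨾ forLoop uᵛ (var nᵛ) (forLoop vᵛ (var nᵛ) scanBody)

greedyStep : Cmd
greedyStep =
    scan
  ⨾ branch (var yᵛ) (remove yᵛ) (branch (var xᵛ *ᴱ var zᵛ) (remove xᵛ ⨾ remove zᵛ) skip)

greedy : Cmd
greedy = forLoop wᵛ (var rᵛ) greedyStep

findClass : Cmd
findClass =
    tᵛ := lit 0
  ⨾ forLoop wᵛ (var Nᵛ)
      ( xᵛ := lit 1
      ⨾ forLoop vᵛ (var nᵛ)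
          (branch (xorᴱ (closedCell (var uᵛ) (var vᵛ)) (closedCell (repᵃ ⁅ var wᵛ +ᴱ lit 1 ⁆) (var vᵛ)))
             (xᵛ := lit 0) skip)
      ⨾ branch (var xᵛ) (tᵛ := var wᵛ +ᴱ lit 1) skip )

openClass : Cmd
openClass = Nᵛ := var Nᵛ +ᴱ lit 1 ⨾ tᵛ := var Nᵛ ⨾ repᵃ ⁅ var Nᵛ ⁆:= var uᵛ

joinClass : Cmd
joinClass =
    itemᵃ ⁅ var uᵛ ⁆:= var tᵛ
  ⨾ rankᵃ ⁅ var uᵛ ⁆:= sizeᵃ ⁅ var tᵛ ⁆
  ⨾ sizeᵃ ⁅ var tᵛ ⁆:= (sizeᵃ ⁅ var tᵛ ⁆) +ᴱ lit 1

testIsolated : Cmd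
testIsolated =
  sᵛ := lit 0 ⨾ forLoop vᵛ (var nᵛ) (branch (cell (var uᵛ) (var vᵛ)) (sᵛ := lit 1) skip)

insert : Cmd
insert =
    testIsolated
  ⨾ branch (var sᵛ)
      ( findClass
      ⨾ branch (var tᵛ) skip (branch (var Nᵛ <ᴱ var capᵛ) openClass skip)
      ⨾ branch (var tᵛ) joinClass skip )
      skip

-- The vertices removed by greedy come first, so that they find room below
-- the cap.
classify : Cmd
classify =
  forLoop iᵛ (lit 2) (forLoop uᵛ (var nᵛ) (branch (remᵃ ⁅ var uᵛ ⁆ =ᴱ var iᵛ) skip insert))

checkBody : Cmd
checkBody =
  forLoop vᵛ (var uᵛ +ᴱ var uᵛ)
    ( zᵛ := xorᴱ (var zᵛ) (xorᴱ (linked (var xᵛ) (digᵃ ⁅ var vᵛ ⁆)) (linked (var yᵛ) (digᵃ ⁅ var vᵛ ⁆)))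
    ⨾ sᵛ := var sᵛ +ᴱ (digᵃ ⁅ var vᵛ ⁆ =ᴱ var xᵛ)
    ⨾ tᵛ := var tᵛ +ᴱ (digᵃ ⁅ var vᵛ ⁆ =ᴱ var yᵛ) )

check : Cmd
check =
    okᵛ := lit 1
  ⨾ forLoop uᵛ (var rᵛ)
      ( xᵛ := digᵃ ⁅ var uᵛ +ᴱ var uᵛ ⁆
      ⨾ yᵛ := digᵃ ⁅ var uᵛ +ᴱ var uᵛ +ᴱ lit 1 ⁆
      ⨾ zᵛ := xorᴱ (degᵃ ⁅ repᵃ ⁅ var xᵛ ⁆ ⁆) (degᵃ ⁅ repᵃ ⁅ var yᵛ ⁆ ⁆)
      ⨾ sᵛ := lit 0
      ⨾ tᵛ := lit 0
      ⨾ checkBody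
      ⨾ branch (var zᵛ *ᴱ ((var sᵛ <ᴱ sizeᵃ ⁅ var xᵛ ⁆) *ᴱ (var tᵛ <ᴱ sizeᵃ ⁅ var yᵛ ⁆))) skip (okᵛ := lit 0) )

-- `goᵛ` is the carry. A carry out of the last digit means that all sequences have been tried, so
-- its negation says whether to go on.
increment : Cmd
increment =
    goᵛ := lit 1
  ⨾ forLoop uᵛ (var Dᵛ)
      (branch (var goᵛ)
        ( digᵃ ⁅ var uᵛ ⁆:= (digᵃ ⁅ var uᵛ ⁆) +ᴱ lit 1
        ⨾ branch (var Nᵛ <ᴱ digᵃ ⁅ var uᵛ ⁆) (digᵃ ⁅ var uᵛ ⁆:= lit 0) (goᵛ := lit 0) )
        skip)
  ⨾ goᵛ := notᴱ (var goᵛ)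

enumerate : Cmd
enumerate = goᵛ := lit 1 ⨾ while (var goᵛ) (check ⨾ branch (var okᵛ) (goᵛ := lit 0) increment)

output : Cmd
output =
  forLoop uᵛ (var nᵛ)
    (branch (itemᵃ ⁅ var uᵛ ⁆)
      ( sᵛ := lit 0
      ⨾ forLoop vᵛ (var rᵛ)
          ( sᵛ := var sᵛ +ᴱ (digᵃ ⁅ var vᵛ +ᴱ var vᵛ ⁆ =ᴱ itemᵃ ⁅ var uᵛ ⁆)
                         +ᴱ (digᵃ ⁅ var vᵛ +ᴱ var vᵛ +ᴱ lit 1 ⁆ =ᴱ itemᵃ ⁅ var uᵛ ⁆)
          ⨾ outᵃ ⁅ var uᵛ ⁆:= outᵃ ⁅ var uᵛ ⁆ +ᴱ (rankᵃ ⁅ var uᵛ ⁆ <ᴱ var sᵛ) ) )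
      skip)

-- With the cap 6 k - 1 there are at most 6 k possible digits, counting the
-- dummy.
initialise : Cmd
initialise =
    rᵛ := var kᵛ -ᴱ lit 1
  ⨾ Dᵛ := var rᵛ +ᴱ var rᵛ
  ⨾ capᵛ := lit 6 *ᴱ var rᵛ +ᴱ lit 5
  ⨾ repᵃ ⁅ lit 0 ⁆:= var nᵛ
  ⨾ sizeᵃ ⁅ lit 0 ⁆:= var Dᵛ +ᴱ lit 1

algorithm : Cmd
algorithm =
  -- Variable 0 holds n during the run and the verdict at its end, hence the last assignment.
  initialise ⨾ computeDegrees ⨾ greedy ⨾ classify ⨾ enumerate ⨾ output ⨾ nᵛ := var okᵛ

-- Digit sequences of length m in base suc N, as numbers

module Numeral (N : ℕ) where

  value : ℕ → (ℕ → ℕ) → ℕ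
  value zero    d = 0
  value (suc m) d = value m d + d m * suc N ^ m

  value-cong : ∀ m {d d′} → (∀ i → i < m → d i ≡ d′ i) → value m d ≡ value m d′
  value-cong zero    _ = refl
  value-cong (suc m) e = cong₂ (λ p q → p + q * suc N ^ m) (value-cong m λ i i<m → e i (m<n⇒m<1+n i<m)) (e m ≤-refl)

  value< : ∀ m {d} → (∀ i → i < m → d i ≤ N) → value m d < suc N ^ m
  value< zero    _  = s≤s z≤n
  value< (suc m) {d} d≤ = begin-strict
    value m d + d m * suc N ^ m  <⟨ +-monoˡ-< (d m * suc N ^ m) (value< m λ i i<m → d≤ i (m<n⇒m<1+n i<m)) ⟩
    suc N ^ m + d m * suc N ^ m  ≤⟨ *-monoˡ-≤ (suc N ^ m) (s≤s (d≤ m ≤-refl)) ⟩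
    suc N * suc N ^ m            ∎
    where open ≤-Reasoning

  value-injective : ∀ m {d d′} → (∀ i → i < m → d i ≤ N) → (∀ i → i < m → d′ i ≤ N) → value m d ≡ value m d′ →
                    ∀ i → i < m → d i ≡ d′ i
  value-injective (suc m) {d} {d′} d≤ d′≤ e i i<1+m = by (m≤n⇒m<n∨m≡n (s≤s⁻¹ i<1+m))
    where
    below : ∀ {f} → (∀ i → i < suc m → f i ≤ N) → value m f < suc N ^ m
    below f≤ = value< m λ i i<m → f≤ i (m<n⇒m<1+n i<m)
    impossible : ∀ {f g} → (∀ i → i < suc m → f i ≤ N) → f m < g m → value (suc m) f ≢ value (suc m) g
    impossible {f} {g} f≤ lt = <⇒≢ (begin-strict
      value m f + f m * suc N ^ m   <⟨ +-monoˡ-< (f m * suc N ^ m) (below f≤) ⟩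
      suc (f m) * suc N ^ m         ≤⟨ *-monoˡ-≤ (suc N ^ m) lt ⟩
      g m * suc N ^ m               ≤⟨ m≤n+m _ (value m g) ⟩
      value m g + g m * suc N ^ m   ∎)
      where open ≤-Reasoning
    top : d m ≡ d′ m
    top with <-cmp (d m) (d′ m)
    ... | tri< lt _ _ = ⊥-elim (impossible {d} {d′} d≤ lt e)
    ... | tri≈ _ eq _ = eq
    ... | tri> _ _ gt = ⊥-elim (impossible {d′} {d} d′≤ gt (sym e))
    by : i < m ⊎ i ≡ m → d i ≡ d′ i
    by (inj₂ refl) = top
    by (inj₁ i<m)  = value-injective m (λ i i<m → d≤ i (m<n⇒m<1+n i<m)) (λ i i<m → d′≤ i (m<n⇒m<1+n i<m))
      (+-cancelʳ-≡ (d m * suc N ^ m) (value m d) (value m d′)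
        (trans e (cong (λ x → value m d′ + x * suc N ^ m) (sym top)))) i i<m

-- Running time

-- The nesting follows that of the loops, as `do-for` charges them. Loops over r are charged for
-- `suc r` rounds, since that bound must be positive.
greedy-bound classify-bound output-bound total-time : ℕ → ℕ → ℕ
greedy-bound n r = suc r * ((3 + n * (n * 9 + 4)) + suc (suc (suc (n * 5) + suc (n * 5))) + 4)
classify-bound n r =
  2 * (n * (suc (suc (n * 6) + suc (suc ((6 * r + 6) * (suc (n * 6 + 2) + 4)) + 9)) + 4) + 4)
output-bound n r = n * (suc (suc (suc r * 6)) + 4)

iteration-bound search-bound : ℕ → ℕ
iteration-bound r = suc (suc r * (5 + (2 * suc r * 7 + 2) + 4)) + suc (suc (suc (suc (2 * r) * 8 + 1)))
search-bound r = suc ((6 * suc r) ^ dbl r * (iteration-bound r + 1) + 1)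

total-time n r = 5 + (n * (n * 5 + 3 + 4) + (greedy-bound n r + (classify-bound n r + (search-bound r +
                 (output-bound n r + 1)))))

-- From Fin to ℕ

isOdd : ℕ → Bool
isOdd zero    = false
isOdd (suc m) = not (isOdd m)

isOdd-+ : ∀ p q → isOdd (p + q) ≡ isOdd p xor isOdd q
isOdd-+ zero    q = refl
isOdd-+ (suc p) q = trans (cong not (isOdd-+ p q)) (sym (xor-assoc true (isOdd p) (isOdd q)))

isOdd-bit : ∀ b → isOdd (bit b) ≡ b
isOdd-bit true  = refl
isOdd-bit false = refl

isOdd-*2 : ∀ q → isOdd (q * 2) ≡ false
isOdd-*2 zero    = refl
isOdd-*2 (suc q) = trans (not-involutive _) (isOdd-*2 q)

isOdd⇒Odd : ∀ {m} → isOdd m ≡ true → Odd m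
isOdd⇒Odd odd (divides q refl) = case trans (sym odd) (isOdd-*2 q) of λ ()

Odd⇒isOdd : ∀ {m} → Odd m → isOdd m ≡ true
Odd⇒isOdd {m} odd with isOdd m in eq
... | true  = refl
... | false = ⊥-elim (odd (even m eq))
  where
  even : ∀ m → isOdd m ≡ false → 2 ∣ m
  even zero          _ = divides 0 refl
  even (suc (suc m)) e with divides q refl ← even m (trans (sym (not-involutive (isOdd m))) e) = divides (suc q) refl

⨁-suc : ∀ m f → ⨁ (suc m) f ≡ f 0 xor ⨁ m (f ∘ suc)
⨁-suc zero    f = sym (xor-identityʳ (f 0))
⨁-suc (suc m) f = trans (cong (_xor f (suc m)) (⨁-suc m f)) (xor-assoc (f 0) (⨁ m (f ∘ suc)) (f (suc m)))

isOdd-sum : ∀ {m} (F : Fin m → ℕ) f → (∀ i → isOdd (F i) ≡ f (toℕ i)) → isOdd (sum F) ≡ ⨁ m f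
isOdd-sum {zero}  F f F≡f = refl
isOdd-sum {suc m} F f F≡f = begin
  isOdd (F Fin.zero + sum (F ∘ Fin.suc))       ≡⟨ isOdd-+ (F Fin.zero) _ ⟩
  isOdd (F Fin.zero) xor isOdd (sum (F ∘ Fin.suc)) ≡⟨ cong₂ _xor_ (F≡f Fin.zero) (isOdd-sum (F ∘ Fin.suc) (f ∘ suc) (F≡f ∘ Fin.suc)) ⟩
  f 0 xor ⨁ m (f ∘ suc)                        ≡⟨ sym (⨁-suc m f) ⟩
  ⨁ (suc m) f                                  ∎
  where open ≡-Reasoning

extend : ∀ {A : Set} {n} → A → (Fin n → A) → ℕ → A
extend {n = n} z f v with v <? n
... | yes v<n = f (fromℕ< v<n)
... | no _    = z

extend-toℕ : ∀ {A : Set} {n} (z : A) (f : Fin n → A) u → extend z f (toℕ u) ≡ f u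
extend-toℕ {n = n} z f u with toℕ u <? n
... | yes u<n = cong f (fromℕ<-toℕ u u<n)
... | no u≮n  = ⊥-elim (u≮n (toℕ<n u))

extend-out : ∀ {A : Set} {n} (z : A) (f : Fin n → A) {v} → n ≤ v → extend z f v ≡ z
extend-out {n = n} z f {v} n≤v with v <? n
... | yes v<n = ⊥-elim (<⇒≱ v<n n≤v)
... | no _    = refl

module Interface {n : ℕ} (G : Graph n) where

  a : ℕ → ℕ → Bool
  a u v = extend false (λ i → extend false (adj G i) v) u

  a-toℕ : ∀ i j → a (toℕ i) (toℕ j) ≡ adj G i j
  a-toℕ i j = trans (extend-toℕ false (λ i → extend false (adj G i) (toℕ j)) i) (extend-toℕ false (adj G i) j)

  a-out : ∀ u v → n ≤ u → a u v ≡ false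
  a-out u v n≤u = extend-out false _ n≤u

  a-out′ : ∀ u v → n ≤ v → a u v ≡ false
  a-out′ u v n≤v with u <? n
  ... | yes u<n = extend-out false (adj G (fromℕ< u<n)) n≤v
  ... | no _    = refl

  as-Fin : ∀ {v} → v < n → ∃[ i ] toℕ {n} i ≡ v
  as-Fin v<n = fromℕ< v<n , toℕ-fromℕ< v<n

  a-sym : ∀ u v → a u v ≡ a v u
  a-sym u v = go (u <? n) (v <? n)
    where
    go : Dec (u < n) → Dec (v < n) → a u v ≡ a v u
    go (no u≮n)  _         = trans (a-out u v (≮⇒≥ u≮n)) (sym (a-out′ v u (≮⇒≥ u≮n)))
    go (yes _)   (no v≮n)  = trans (a-out′ u v (≮⇒≥ v≮n)) (sym (a-out v u (≮⇒≥ v≮n)))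
    go (yes u<n) (yes v<n) with i , refl ← as-Fin u<n | j , refl ← as-Fin v<n =
      trans (a-toℕ i j) (trans (adj-sym G i j) (sym (a-toℕ j i)))

  a-irr : ∀ v → a v v ≡ false
  a-irr v = go (v <? n)
    where
    go : Dec (v < n) → a v v ≡ false
    go (no v≮n) = a-out v v (≮⇒≥ v≮n)
    go (yes v<n) with i , refl ← as-Fin v<n = trans (a-toℕ i i) (no-loop G i)

  -- The row u may be out of range: row n is read for the virtual representative, and everything
  -- beyond the matrix is 0.
  matrix-cell : ∀ u v → v < n → adjacencyMatrix G (u * n + v) ≡ bit (a u v)
  matrix-cell u v v<n with u * n + v <? n * n
  ... | no m≮ with u <? n
  ...   | no u≮n = refl
  ...   | yes u<n = ⊥-elim (m≮ (begin-strict
    u * n + v <⟨ +-monoʳ-< (u * n) v<n ⟩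
    u * n + n ≡⟨ +-comm (u * n) n ⟩
    suc u * n ≤⟨ *-monoˡ-≤ n u<n ⟩
    n * n     ∎))
    where open ≤-Reasoning
  matrix-cell u v v<n | yes m< with u <? n
  ...   | no u≮n = ⊥-elim (<⇒≱ m< (≤-trans (*-monoˡ-≤ n (≮⇒≥ u≮n)) (m≤m+n (u * n) v)))
  ...   | yes u<n with j , refl ← as-Fin v<n =
    trans (cong (λ m → bit (adj G (proj₁ (remQuot {n} n m)) (proj₂ (remQuot {n} n m)))) same)
          (trans (cong (λ p → bit (adj G (proj₁ p) (proj₂ p))) (remQuot-combine i j))
                 (cong bit (sym (extend-toℕ false (adj G i) j))))
    where
    i = fromℕ< u<n
    same : fromℕ< m< ≡ combine i j
    same = toℕ-injective (trans (toℕ-fromℕ< m<) (trans (cong (_+ toℕ j) (trans (*-comm u n) (cong (n *_) (sym (toℕ-fromℕ< u<n)))))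
                                                      (sym (toℕ-combine i j))))

  open Parity n a a-sym a-irr a-out

  d-parity : ∀ A C SA SC → (∀ u → lookup A u ≡ SA (toℕ u)) → (∀ u → lookup C u ≡ SC (toℕ u)) →
             isOdd (d G A C) ≡ B SC SA
  d-parity A C SA SC A≡ C≡ = trans (isOdd-sum _ (λ u → SA u ∧ deg SC u) row) (B-sym SA SC)
    where
    row : ∀ u → isOdd (sum λ v → bit (lookup A u ∧ lookup C v ∧ adj G u v)) ≡ SA (toℕ u) ∧ deg SC (toℕ u)
    row u = trans (isOdd-sum _ (λ v → SA (toℕ u) ∧ (SC v ∧ a (toℕ u) v)) λ v →
              trans (isOdd-bit _) (cong₂ _∧_ (A≡ u) (cong₂ _∧_ (C≡ v) (sym (a-toℕ u v)))))
            (sym (∧-⨁ n (SA (toℕ u)) (λ v → SC v ∧ a (toℕ u) v)))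

  does-≟ : ∀ {k} (i j : Fin k) → does (i Fin.≟ j) ≡ (toℕ i ≡ᵇ toℕ j)
  does-≟ i j with i Fin.≟ j
  ... | yes refl = sym (≡ᵇ-refl (toℕ i))
  ... | no i≢j   = sym (≢⇒≡ᵇ {toℕ i} {toℕ j} (i≢j ∘ toℕ-injective))

  module _ (r : ℕ) where

    -- The classes are cut off from the last to the first. Each class is odd against the earlier
    -- ones, hence also against the union of these with itself, because `B` is alternating.
    partition⇒chain : ∀ (P : Fin n → Fin (suc r)) → IsGoodPartition G P → Chain (λ _ → ⊤) everything r
    partition⇒chain P (_ , π , good) = Chain-cong all (chain r ≤-refl)
      where
      ρ : ℕ → ℕ
      ρ = extend 0 λ v → toℕ (π ⟨$⟩ˡ P v)
      up-to : ℕ → ℕ → Bool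
      up-to l v = ρ v <ᵇ l
      level : ℕ → ℕ → Bool
      level l v = ρ v ≡ᵇ l
      all : up-to (suc r) ≐ everything
      all v v<n with i , refl ← as-Fin v<n
        rewrite extend-toℕ 0 (λ v → toℕ (π ⟨$⟩ˡ P v)) i = <ᵇ-true (toℕ<n (π ⟨$⟩ˡ P i))
      odd : ∀ l → suc l ≤ r → B (level (suc l)) (up-to (suc l)) ≡ true
      odd l l<r = trans (sym (d-parity (earlier P π i) (class P (π ⟨$⟩ʳ i)) _ _ in-earlier in-class))
                        (Odd⇒isOdd (good i λ e → case trans (sym e) (toℕ-fromℕ< (s≤s l<r)) of λ ()))
        where
        i : Fin (suc r)
        i = fromℕ< (s≤s l<r)
        i≡ : toℕ i ≡ suc l
        i≡ = toℕ-fromℕ< (s≤s l<r)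
        in-earlier : ∀ u → lookup (earlier P π i) u ≡ up-to (suc l) (toℕ u)
        in-earlier u = trans (lookup∘tabulate _ u)
          (sym (cong₂ _<ᵇ_ (extend-toℕ 0 (λ v → toℕ (π ⟨$⟩ˡ P v)) u) (sym i≡)))
        in-class : ∀ u → lookup (class P (π ⟨$⟩ʳ i)) u ≡ level (suc l) (toℕ u)
        in-class u = trans (lookup∘tabulate _ u) (trans moved
          (trans (does-≟ (π ⟨$⟩ˡ P u) i) (sym (cong₂ _≡ᵇ_ (extend-toℕ 0 (λ v → toℕ (π ⟨$⟩ˡ P v)) u) (sym i≡)))))
          where
          moved : does (P u Fin.≟ (π ⟨$⟩ʳ i)) ≡ does ((π ⟨$⟩ˡ P u) Fin.≟ i)
          moved with P u Fin.≟ (π ⟨$⟩ʳ i) | (π ⟨$⟩ˡ P u) Fin.≟ i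
          ... | yes _ | yes _ = refl
          ... | no _  | no _  = refl
          ... | yes e | no ≢i = ⊥-elim (≢i (trans (cong (π ⟨$⟩ˡ_) e) (inverseˡ π)))
          ... | no ≢u | yes e = ⊥-elim (≢u (trans (sym (inverseʳ π)) (cong (π ⟨$⟩ʳ_) e)))
      chain : ∀ l → l ≤ r → Chain (λ _ → ⊤) (up-to (suc l)) l
      chain zero    _   = []
      chain (suc l) l<r = cut (level (suc l)) sub′ (λ _ _ _ → tt)
        (trans (B-cong {level (suc l)} (λ _ _ → refl) (λ v _ → <ᵇ-suc (ρ v) (suc l)))
          (trans (B-△ʳ (level (suc l)) (up-to (suc l)) (level (suc l))) (cong₂ _xor_ (odd l l<r) (B-self (level (suc l))))))
        (Chain-cong (λ v _ → sym (trans (cong (_xor level (suc l) v) (<ᵇ-suc (ρ v) (suc l))) (xor-cancel (up-to (suc l) v) (level (suc l) v))))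
                    (chain l (<⇒≤ l<r)))
        where
        sub′ : level (suc l) ⊑ up-to (suc (suc l))
        sub′ v _ e rewrite ≡ᵇ-sound (ρ v) (suc l) e = <ᵇ-true (n<1+n (suc l))

    -- A class i ≥ 1 is non-empty because its cut is odd; for class 0 the
    -- cut of class 1 serves, if there is one.
    classes⇒partition : 1 ≤ n → (c : ℕ → ℕ) → (∀ v → v < n → c v ≤ r) →
      (∀ i → 1 ≤ i → i ≤ r → B (λ v → c v ≡ᵇ i) (λ v → c v <ᵇ i) ≡ true) →
      ∃[ P ] (IsGoodPartition {n} {suc r} G P × (∀ v → c (toℕ v) ≡ toℕ (P v)))
    classes⇒partition 1≤n c c≤r odd = P , (surjective , Perm.id , good) , λ v → sym (P≡ v)
      where
      P : Fin n → Fin (suc r)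
      P v = fromℕ< (s≤s (c≤r (toℕ v) (toℕ<n v)))
      P≡ : ∀ v → toℕ (P v) ≡ c (toℕ v)
      P≡ v = toℕ-fromℕ< (s≤s (c≤r (toℕ v) (toℕ<n v)))
      good : GoodOrdering G P Perm.id
      good i i≢0 = isOdd⇒Odd (trans (d-parity (earlier P Perm.id i) (class P i) (λ v → c v <ᵇ toℕ i) (λ v → c v ≡ᵇ toℕ i)
          (λ u → trans (lookup∘tabulate (λ v → does (P v Fin.<? i)) u) (cong (_<ᵇ toℕ i) (P≡ u)))
          (λ u → trans (lookup∘tabulate (λ v → does (P v Fin.≟ i)) u) (trans (does-≟ (P u) i) (cong (_≡ᵇ toℕ i) (P≡ u)))))
        (odd (toℕ i) (n≢0⇒n>0 i≢0) (s≤s⁻¹ (toℕ<n i))))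
      hit : ∀ v → v < n → ∀ j → c v ≡ toℕ j → ∃[ x ] P x ≡ j
      hit v v<n j e with x , refl ← as-Fin v<n = x , toℕ-injective (trans (P≡ x) e)
      surjective : ∀ j → ∃[ x ] P x ≡ j
      surjective j with toℕ j in tj
      ... | suc i with t , t<n , e , _ ← B-true (odd (suc i) (s≤s z≤n) (s≤s⁻¹ (subst (_< suc r) tj (toℕ<n j)))) =
        hit t t<n j (trans (≡ᵇ-sound (c t) (suc i) e) (sym tj))
      ... | zero with r ≟ 0
      ...   | yes r≡0 = hit 0 1≤n j (trans (n≤0⇒n≡0 (subst (c 0 ≤_) r≡0 (c≤r 0 1≤n))) (sym tj))
      ...   | no r≢0 with t , _ , _ , e ← B-true (odd 1 ≤-refl (n≢0⇒n>0 r≢0)) with w , w<n , e′ ← ⨁-true n e =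
        hit w w<n j (trans (n<1⇒n≡0 (<ᵇ⇒< (c w) 1 (subst T (sym (proj₁ (∧-true e′))) tt))) (sym tj))

  -- Correctness and running time of the program

  module Verification
    (1≤n : 1 ≤ n) (r : ℕ) (W M : ℕ) (8≤M : 8 ≤ M) (M^20≤W : M ^ 20 ≤ W)
    (n<M : n < M) (6k≤M : 6 * r + 6 ≤ M) where

    open Machine W M 8≤M M^20≤W

    1≤M : 1 ≤ M
    1≤M = ≤-trans (s≤s z≤n) 8≤M

    bit≤M : ∀ b → bit b ≤ M
    bit≤M b = ≤-trans (bit≤1 b) 1≤M

    ≤n⇒≤M : ∀ {m} → m ≤ n → m ≤ M
    ≤n⇒≤M m≤n = ≤-trans m≤n (<⇒≤ n<M)

    ≤6k⇒≤M : ∀ {m} → m ≤ 6 * r + 6 → m ≤ M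
    ≤6k⇒≤M m≤ = ≤-trans m≤ 6k≤M

    record Base (σ : State) : Set where
      field
        n=    : vars σ nᵛ ≡ n
        r=    : vars σ rᵛ ≡ r
        cells : ∀ u v → v < n → arrs σ adjᵃ (u * n + v) ≡ bit (a u v)

    open Base public

    keep : ∀ {c σ τ} → Same c σ τ → writesVar c nᵛ ∨ writesVar c rᵛ ≡ false → writesArr c adjᵃ ≡ false → Base σ → Base τ
    keep {c} same wv wa base = record
      { n=    = trans (var= same nᵛ (proj₁ (∨-false wv))) (n= base)
      ; r=    = trans (var= same rᵛ (proj₂ (∨-false {writesVar c nᵛ} wv))) (r= base)
      ; cells = λ u v v<n → trans (arr= same adjᵃ wa _) (cells base u v v<n) }

    xor-eval : ∀ σ e₁ e₂ {p q} → eval σ e₁ ≡ bit p → eval σ e₂ ≡ bit q → eval σ (xorᴱ e₁ e₂) ≡ bit (p xor q)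
    xor-eval σ e₁ e₂ {p} {q} v₁ v₂ = trans (cong₂ (λ x y → bit (bit (x ≡ᵇ y) ≡ᵇ 0)) v₁ v₂) (table p q)
      where
      table : ∀ p q → bit (bit (bit p ≡ᵇ bit q) ≡ᵇ 0) ≡ bit (p xor q)
      table true  true  = refl
      table true  false = refl
      table false true  = refl
      table false false = refl

    mul-bit : ∀ p q → bit p * bit q ≡ bit (p ∧ q)
    mul-bit true  q = +-identityʳ (bit q)
    mul-bit false q = refl

    not-bit : ∀ p → bit (bit p ≡ᵇ 0) ≡ bit (not p)
    not-bit true  = refl
    not-bit false = refl

    cell-eval : ∀ {σ} e₁ e₂ {u v} → Base σ → eval σ e₁ ≡ u → eval σ e₂ ≡ v → v < n → eval σ (cell e₁ e₂) ≡ bit (a u v)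
    cell-eval {σ} e₁ e₂ base refl refl v<n =
      trans (cong (λ m → arrs σ adjᵃ (eval σ e₁ * m + eval σ e₂)) (n= base)) (cells base _ _ v<n)

    closed-eval : ∀ {σ} e₁ e₂ {u v} → Base σ → eval σ e₁ ≡ u → eval σ e₂ ≡ v → v < n →
                  eval σ (closedCell e₁ e₂) ≡ bit (near u v)
    closed-eval e₁ e₂ {u} {v} base v₁ v₂ v<n =
      trans (cong₂ _+_ (cell-eval e₁ e₂ base v₁ v₂ v<n) (cong₂ (λ x y → bit (x ≡ᵇ y)) v₁ v₂)) (no-carry (u ≡ᵇ v) refl)
      where
      no-carry : ∀ b → (u ≡ᵇ v) ≡ b → bit (a u v) + bit b ≡ bit (a u v xor b)
      no-carry false _ = trans (+-identityʳ _) (cong bit (sym (xor-identityʳ (a u v))))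
      no-carry true  e rewrite ≡ᵇ-sound u v e | a-irr v = refl

    array-at : ∀ (f : ℕ → ℕ) {i} x → update f i x i ≡ x
    array-at f {i} x = update-same f i x

    array-off : ∀ (f : ℕ → ℕ) {i j} x → j ≢ i → update f i x j ≡ f j
    array-off f {i} {j} x j≢i = update-other f i x j (≢⇒≡ᵇ {j} {i} j≢i)

    <-suc : ∀ {i j} → i < suc j → i < j ⊎ i ≡ j
    <-suc i<1+j = m≤n⇒m<n∨m≡n (s≤s⁻¹ i<1+j)

    -- Cell n of `degᵃ` is singled out because the search reads it as the degree of the virtual
    -- vertex; the loop leaves it as it was.
    degrees-run : ∀ {σ} → Bounded M σ → Base σ → Runs computeDegrees σ (n * (n * 5 + 3 + 4)) λ τ →
                  (∀ v → v < n → arrs τ parᵃ v ≡ bit (deg everything v) × arrs τ degᵃ v ≡ bit (deg everything v))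
                  × arrs τ degᵃ n ≡ arrs σ degᵃ n
    degrees-run {σ} b base = do-for n n Inv refl b ≤-refl 1≤n (≤n⇒≤M ≤-refl)
      (λ τ same → n= (keep same refl refl base)) ((λ v ()) , refl) body
      where
      Inv : ℕ → State → Set
      Inv u τ = (∀ v → v < u → arrs τ parᵃ v ≡ bit (deg everything v) × arrs τ degᵃ v ≡ bit (deg everything v))
              × arrs τ degᵃ n ≡ arrs σ degᵃ n
      body : ∀ u τ → u < n → Bounded M τ → Same computeDegrees σ τ → vars τ uᵛ ≡ u → Inv u τ → Runs _ τ (n * 5 + 3) (Inv (suc u))
      body u τ u<n b same u= (inv , ghost) = slower (≤-reflexive (+-comm 3 (n * 5)))
        (var-then 0 b refl z≤n λ b → slower (≤-reflexive (+-comm (n * 5) 2))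
        (do-for n n (λ v τ → vars τ xᵛ ≡ bit (⨁ v (a u))) refl b ≤-refl 1≤n (≤n⇒≤M ≤-refl)
          (λ τ same′ → trans (var= same′ nᵛ refl) (n= baseτ)) refl
          (λ v ρ v<n b same′ v= x= → do-var (bit (⨁ v (a u) xor a u v)) b
            (xor-eval ρ (var xᵛ) (cell (var uᵛ) (var vᵛ)) x=
              (cell-eval (var uᵛ) (var vᵛ) (keep same′ refl refl (record { n= = n= baseτ ; r= = r= baseτ ; cells = cells baseτ }))
                (trans (var= same′ uᵛ refl) u=) v= v<n))
            (bit≤M _) refl)
         then λ ρ b same′ x= →
         arr-then u (bit (⨁ n (a u))) b (trans (var= same′ uᵛ refl) u=) x= (bit≤M _) λ b →
         do-arr u (bit (⨁ n (a u))) b (trans (var= same′ uᵛ refl) u=) x= (bit≤M _)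
           (result ρ same′ , trans (array-off (arrs ρ degᵃ) {u} {n} _ (λ { refl → <-irrefl refl u<n })) (trans (arr= same′ degᵃ refl n) ghost))))
        where
        baseτ = keep same refl refl base
        result : ∀ ρ → Same _ (setVar xᵛ 0 τ) ρ → ∀ v → v < suc u →
          arrs (setArr degᵃ u (bit (⨁ n (a u))) (setArr parᵃ u (bit (⨁ n (a u))) ρ)) parᵃ v ≡ bit (deg everything v) ×
          arrs (setArr degᵃ u (bit (⨁ n (a u))) (setArr parᵃ u (bit (⨁ n (a u))) ρ)) degᵃ v ≡ bit (deg everything v)
        result ρ same′ v v<1+u with <-suc v<1+u
        ... | inj₂ refl = array-at (arrs ρ parᵃ) {v} _ , array-at (arrs ρ degᵃ) {v} _
        ... | inj₁ v<u = trans (array-off (arrs ρ parᵃ) {u} {v} _ (<⇒≢ v<u)) (trans (arr= same′ parᵃ refl v) (proj₁ (inv v v<u)))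
                       , trans (array-off (arrs ρ degᵃ) {u} {v} _ (<⇒≢ v<u)) (trans (arr= same′ degᵃ refl v) (proj₂ (inv v v<u)))

    -- The greedy phase

    find : ∀ m (f : ℕ → Bool) → (∃[ v ] v < m × f v ≡ true) ⊎ (∀ v → v < m → f v ≡ false)
    find zero    f = inj₂ λ v ()
    find (suc m) f with f m in fm | find m f
    ... | true  | _ = inj₁ (m , ≤-refl , fm)
    ... | false | inj₁ (v , v<m , fv) = inj₁ (v , m<n⇒m<1+n v<m , fv)
    ... | false | inj₂ none = inj₂ λ v v<1+m → case <-suc v<1+m of λ { (inj₁ v<m) → none v v<m ; (inj₂ refl) → fm }

    left-over : (ℕ → Bool) → ℕ → Bool
    left-over Y = everything △ Y

    record Track (Y : ℕ → Bool) (σ : State) : Set where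
      field
        rem= : ∀ v → v < n → arrs σ remᵃ v ≡ bit (Y v)
        par= : ∀ v → v < n → arrs σ parᵃ v ≡ bit (deg (left-over Y) v)

    open Track

    remove-run : ∀ {σ Y} x p → (x ≡ᵇ vᵛ) ≡ false → Bounded M σ → Base σ → Track Y σ → vars σ x ≡ suc p → p < n → Y p ≡ false →
                 Runs (remove x) σ (suc (n * 5)) (Track (Y △ ⟦ p ⟧))
    remove-run {σ} {Y} x p x≢v b base track x= p<n Yp =
      arr-then p 1 b p= refl 1≤M λ b →
      weaken ≤-refl finish (do-for n n Inv refl b ≤-refl 1≤n (≤n⇒≤M ≤-refl)
        (λ τ same → n= (keep same refl refl base₁)) (start , λ v ()) body)
      where
      base₁ : Base (setArr remᵃ p 1 σ)
      base₁ = record { n= = n= base ; r= = r= base ; cells = cells base }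
      p= : vars σ x ∸ 1 ≡ p
      p= = cong (_∸ 1) x=
      S′ = left-over (Y △ ⟦ p ⟧)
      Inv : ℕ → State → Set
      Inv w τ = (∀ v → w ≤ v → v < n → arrs τ parᵃ v ≡ bit (deg (left-over Y) v))
              × (∀ v → v < w → arrs τ parᵃ v ≡ bit (deg S′ v))
      start : ∀ v → 0 ≤ v → v < n → arrs σ parᵃ v ≡ bit (deg (left-over Y) v)
      start v _ v<n = par= track v v<n
      update-deg : ∀ v → deg S′ v ≡ deg (left-over Y) v xor a p v
      update-deg v = trans (deg-cong {S′} {left-over Y △ ⟦ p ⟧} v λ w _ → sym (xor-assoc true (Y w) (⟦ p ⟧ w)))
                           (trans (deg-remove (left-over Y) p v) (cong (deg (left-over Y) v xor_) (a-sym v p)))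
      loop = forLoop vᵛ (var nᵛ) (parᵃ ⁅ var vᵛ ⁆:= xorᴱ (parᵃ ⁅ var vᵛ ⁆) (cell (var x -ᴱ lit 1) (var vᵛ)))
      body : ∀ w τ → w < n → Bounded M τ → Same loop (setArr remᵃ p 1 σ) τ → vars τ vᵛ ≡ w → Inv w τ →
             Runs _ τ 1 (λ τ′ → Inv (suc w) (setVar vᵛ (suc w) τ′))
      body w τ w<n b same v= (todo , done) =
        do-arr w (bit (deg S′ w)) b v=
          (trans (xor-eval τ (parᵃ ⁅ var vᵛ ⁆) (cell (var x -ᴱ lit 1) (var vᵛ))
                   (trans (cong (arrs τ parᵃ) v=) (todo w ≤-refl w<n))
                   (cell-eval {τ} (var x -ᴱ lit 1) (var vᵛ) (keep same refl refl base₁)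
                     (trans (cong (_∸ 1) (var= same x (cong₂ _∨_ x≢v (cong (false ∨_) x≢v)))) p=) v= w<n))
                 (cong bit (sym (update-deg w))))
          (bit≤M _)
          ( (λ v w<v v<n → trans (array-off (arrs τ parᵃ) {w} {v} _ (λ { refl → <-irrefl refl w<v })) (todo v (<⇒≤ w<v) v<n))
          , λ v v<1+w → case <-suc v<1+w of λ
            { (inj₁ v<w) → trans (array-off (arrs τ parᵃ) {w} {v} _ (<⇒≢ v<w)) (done v v<w)
            ; (inj₂ refl) → array-at (arrs τ parᵃ) {v} _ } )
      finish : ∀ τ → Bounded M τ → Same loop (setArr remᵃ p 1 σ) τ → Inv n τ → Track (Y △ ⟦ p ⟧) τ
      finish τ _ same (_ , done) = record { rem= = rems ; par= = done }
        where
        rems : ∀ v → v < n → arrs τ remᵃ v ≡ bit ((Y △ ⟦ p ⟧) v)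
        rems v v<n with v ≟ p
        ... | yes refl = trans (arr= same remᵃ refl v) (trans (array-at (arrs σ remᵃ) {v} 1)
                           (sym (cong bit (cong₂ _xor_ Yp (≡ᵇ-refl v)))))
        ... | no v≢p = trans (arr= same remᵃ refl v) (trans (array-off (arrs σ remᵃ) {p} {v} 1 v≢p)
                         (trans (rem= track v v<n) (cong bit (sym (trans (cong (Y v xor_) (≢⇒≡ᵇ {v} {p} v≢p)) (xor-identityʳ (Y v)))))))

    module _ (Y : ℕ → Bool) where

      private
        S = left-over Y

      -- At SwitchAt u v the removal of u leaves v odd; at EvenAt u v, if there
      -- is no SwitchAt, the removal of u together with any odd vertex does.
      OddAt SwitchAt EvenAt : ℕ → ℕ → Set
      OddAt u v    = Y u ≡ false × Y v ≡ false × deg S u ≡ true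
      SwitchAt u v = Y u ≡ false × Y v ≡ false × deg S u ≡ true × u ≢ v × deg S v xor a u v ≡ true
      EvenAt u v   = Y u ≡ false × Y v ≡ false × deg S u ≡ false × a u v ≡ true

      -- The program stores suc u for a pair (u , v) it has found, and 0 if none.
      Seen : (ℕ → ℕ → Set) → (ℕ → ℕ → Set) → ℕ → Set
      Seen Before At x = (x ≡ 0 × (∀ u v → Before u v → ¬ At u v))
                       ⊎ (∃[ u ] ∃[ v ] x ≡ suc u × u < n × v < n × At u v)

      Scanned : (ℕ → ℕ → Set) → State → Set
      Scanned Before τ = Seen Before OddAt (vars τ xᵛ) × Seen Before SwitchAt (vars τ yᵛ) × Seen Before EvenAt (vars τ zᵛ)

      Before : ℕ → ℕ → ℕ → ℕ → Set
      Before i j u v = u < i × v < n ⊎ u ≡ i × v < j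

      seen-mono : ∀ {B B′ : ℕ → ℕ → Set} {At x} → (∀ u v → B′ u v → B u v) → Seen B At x → Seen B′ At x
      seen-mono ⊆ (inj₁ (e , none)) = inj₁ (e , λ u v → none u v ∘ ⊆ u v)
      seen-mono ⊆ (inj₂ found)      = inj₂ found

      seen-skip : ∀ {i j At x} → ¬ At i j → Seen (Before i j) At x → Seen (Before i (suc j)) At x
      seen-skip ¬at (inj₂ found) = inj₂ found
      seen-skip {i} {j} {At} ¬at (inj₁ (e , none)) = inj₁ (e , λ u v → step u v)
        where
        step : ∀ u v → Before i (suc j) u v → ¬ At u v
        step u v (inj₁ p) = none u v (inj₁ p)
        step u v (inj₂ (refl , v<1+j)) at with <-suc v<1+j
        ... | inj₁ v<j  = none u v (inj₂ (refl , v<j)) at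
        ... | inj₂ refl = ¬at at

      scan-run : ∀ {σ} → Bounded M σ → Base σ → Track Y σ →
                 Runs scan σ (3 + n * (n * (5 + 4) + 4)) (Scanned (λ u v → u < n × v < n))
      scan-run {σ} b base track =
        var-then 0 b refl z≤n λ b → var-then 0 b refl z≤n λ b → var-then 0 b refl z≤n λ b →
        weaken ≤-refl (λ τ _ _ (p , q , s) → seen-mono to p , seen-mono to q , seen-mono to s)
          (do-for n n (λ i → Scanned (Before i 0)) refl b ≤-refl 1≤n (≤n⇒≤M ≤-refl)
            (λ τ same → trans (var= same nᵛ refl) (n= base))
            (inj₁ (refl , none₀) , inj₁ (refl , none₀) , inj₁ (refl , none₀)) row)
        where
        none₀ : ∀ {At : ℕ → ℕ → Set} u v → Before 0 0 u v → ¬ At u v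
        none₀ u v (inj₁ (() , _))
        none₀ u v (inj₂ (_ , ()))
        to : ∀ u v → u < n × v < n → Before n 0 u v
        to u v p = inj₁ p
        next-row : ∀ i u v → Before (suc i) 0 u v → Before i n u v
        next-row i u v (inj₁ (u<1+i , v<n)) with <-suc u<1+i
        ... | inj₁ u<i = inj₁ (u<i , v<n)
        ... | inj₂ u≡i = inj₂ (u≡i , v<n)
        next-row i u v (inj₂ (_ , ()))
        σ₀ = setVar zᵛ 0 (setVar yᵛ 0 (setVar xᵛ 0 σ))
        outer = forLoop uᵛ (var nᵛ) (forLoop vᵛ (var nᵛ) scanBody)
        cellBody : ∀ i j τ → i < n → j < n → Bounded M τ → Base τ → Track Y τ → vars τ uᵛ ≡ i → vars τ vᵛ ≡ j →
                   Scanned (Before i j) τ → Runs scanBody τ 5 (λ τ′ → Scanned (Before i (suc j)) τ′)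
        cellBody i j τ i<n j<n b base track u= v= (p , q , s) =
          do-branch b
            (λ removed → slower (s≤s z≤n) (do-skip b (skip-all λ yi yj → removed (cong₂ _+_ (trans rem-i (cong bit yi)) (trans rem-j (cong bit yj))))))
            λ present →
          let Yi : Y i ≡ false
              Yi = zero-bit (trans (sym rem-i) (m+n≡0⇒m≡0 _ present))
              Yj : Y j ≡ false
              Yj = zero-bit (trans (sym rem-j) (m+n≡0⇒n≡0 (arrs τ remᵃ (vars τ uᵛ)) present))
          in do-if (deg S i) b par-i
            (λ odd → var-then (suc i) b (trans (+-comm _ 1) (cong suc u=)) (≤-trans i<n (<⇒≤ n<M)) λ b →
              do-if ((deg S j xor a i j) ∧ not (i ≡ᵇ j)) b
                (trans (cong₂ _*_ (xor-eval (setVar xᵛ (suc i) τ) (parᵃ ⁅ var vᵛ ⁆) (cell (var uᵛ) (var vᵛ)) par-j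
                                    (cell-eval {τ} (var uᵛ) (var vᵛ) base u= v= j<n))
                                  (trans (cong (λ z → bit (z ≡ᵇ 0)) (cong₂ (λ x y → bit (x ≡ᵇ y)) u= v=)) (not-bit (i ≡ᵇ j))))
                       (mul-bit (deg S j xor a i j) (not (i ≡ᵇ j))))
                (λ switch → let sw , ne = ∧-true {deg S j xor a i j} switch in
                  do-var (suc i) b (trans (+-comm _ 1) (cong suc u=)) (≤-trans i<n (<⇒≤ n<M))
                    ( inj₂ (i , j , refl , i<n , j<n , Yi , Yj , odd)
                    , inj₂ (i , j , refl , i<n , j<n , Yi , Yj , odd , (λ { refl → case trans (sym ne) (cong not (≡ᵇ-refl i)) of λ () }) , sw)
                    , seen-skip {i} {j} {EvenAt} (λ (_ , _ , even , _) → case trans (sym odd) even of λ ()) s ))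
                (λ ¬switch → do-skip b
                    ( inj₂ (i , j , refl , i<n , j<n , Yi , Yj , odd)
                    , seen-skip {i} {j} {SwitchAt} (λ (_ , _ , _ , i≢j , sw) →
                        case trans (sym ¬switch) (cong₂ _∧_ sw (cong not (≢⇒≡ᵇ {i} {j} i≢j))) of λ ()) q
                    , seen-skip {i} {j} {EvenAt} (λ (_ , _ , even , _) → case trans (sym odd) even of λ ()) s )))
            (λ even → do-if (a i j) b (cell-eval {τ} (var uᵛ) (var vᵛ) base u= v= j<n)
                (λ adjacent → slower (s≤s z≤n) (do-var (suc i) b (trans (+-comm _ 1) (cong suc u=)) (≤-trans i<n (<⇒≤ n<M))
                    ( seen-skip {i} {j} {OddAt} (λ (_ , _ , odd) → case trans (sym odd) even of λ ()) p
                    , seen-skip {i} {j} {SwitchAt} (λ (_ , _ , odd , _) → case trans (sym odd) even of λ ()) q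
                    , inj₂ (i , j , refl , i<n , j<n , Yi , Yj , even , adjacent) )))
                (λ ¬adjacent → slower (s≤s z≤n) (do-skip b
                    ( seen-skip {i} {j} {OddAt} (λ (_ , _ , odd) → case trans (sym odd) even of λ ()) p
                    , seen-skip {i} {j} {SwitchAt} (λ (_ , _ , odd , _) → case trans (sym odd) even of λ ()) q
                    , seen-skip {i} {j} {EvenAt} (λ (_ , _ , _ , adj) → case trans (sym adj) ¬adjacent of λ ()) s ))))
          where
          rem-i : arrs τ remᵃ (vars τ uᵛ) ≡ bit (Y i)
          rem-i = trans (cong (arrs τ remᵃ) u=) (rem= track i i<n)
          rem-j : arrs τ remᵃ (vars τ vᵛ) ≡ bit (Y j)
          rem-j = trans (cong (arrs τ remᵃ) v=) (rem= track j j<n)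
          par-i : arrs τ parᵃ (vars τ uᵛ) ≡ bit (deg S i)
          par-i = trans (cong (arrs τ parᵃ) u=) (par= track i i<n)
          par-j : arrs τ parᵃ (vars τ vᵛ) ≡ bit (deg S j)
          par-j = trans (cong (arrs τ parᵃ) v=) (par= track j j<n)
          zero-bit : ∀ {c} → bit c ≡ 0 → c ≡ false
          zero-bit {false} _ = refl
          skip-all : (Y i ≡ false → Y j ≡ false → ⊥) → Scanned (Before i (suc j)) τ
          skip-all ¬both = seen-skip {i} {j} {OddAt} (λ (yi , yj , _) → ¬both yi yj) p
                         , seen-skip {i} {j} {SwitchAt} (λ (yi , yj , _) → ¬both yi yj) q
                         , seen-skip {i} {j} {EvenAt} (λ (yi , yj , _) → ¬both yi yj) s
        row : ∀ i τ → i < n → Bounded M τ → Same outer σ₀ τ → vars τ uᵛ ≡ i → Scanned (Before i 0) τ →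
              Runs (forLoop vᵛ (var nᵛ) scanBody) τ (n * (5 + 4)) (Scanned (Before (suc i) 0))
        row i τ i<n b same u= inv =
          weaken ≤-refl (λ τ _ _ (p , q , s) → seen-mono (next-row i) p , seen-mono (next-row i) q , seen-mono (next-row i) s)
            (do-for n n (λ j → Scanned (Before i j)) refl b ≤-refl 1≤n (≤n⇒≤M ≤-refl)
              (λ ρ same′ → trans (var= same′ nᵛ refl) (trans (var= same nᵛ refl) (n= base))) inv
              (λ j ρ j<n b same′ v= inv → cellBody i j ρ i<n j<n b (keep same′ refl refl (keep same refl refl (base′)))
                (record { rem= = λ v v<n → trans (arr= same′ remᵃ refl v) (trans (arr= same remᵃ refl v) (rem= track v v<n))
                        ; par= = λ v v<n → trans (arr= same′ parᵃ refl v) (trans (arr= same parᵃ refl v) (par= track v v<n)) })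
                (trans (var= same′ uᵛ refl) u=) v= inv))
          where
          base′ : Base σ₀
          base′ = record { n= = n= base ; r= = r= base ; cells = cells base }

      NoOdd NoSwitch NoEven : Set
      NoOdd    = ∀ v → v < n → Y v ≡ false → deg S v ≡ false
      NoSwitch = ∀ u v → u < n → v < n → Y u ≡ false → Y v ≡ false → deg S u ≡ true → u ≢ v → a u v ≡ deg S v
      NoEven   = ∀ u v → u < n → v < n → Y u ≡ false → Y v ≡ false → deg S u ≡ false → a u v ≡ false

      -- In `progress` the cuts made so far are kept as a function that puts them in front of any
      -- chain of the rest, and an odd vertex is left for the next one. `stopped` records besides
      -- the outcome why all later scans find nothing either, so that the remaining rounds change
      -- nothing.
      data Greedy (s : ℕ) : Set where
        progress : (∀ q Z → Y ⊑ Z → Chain (λ v → Z v ≡ true) S q → Chain (λ v → Z v ≡ true) everything (s + q)) →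
                   (∃[ v ] v < n × Y v ≡ false × deg S v ≡ true) →
                   (∃[ t ] t < n × Y t ≡ true × deg everything t ≡ true) ⊎ (∀ v → v < n → Y v ≡ false) →
                   Greedy s
        stopped  : (∀ q → Outcome q Y) → NoSwitch → NoOdd ⊎ NoEven → Greedy s

    record GreedyState (s : ℕ) (σ : State) : Set where
      field
        Y      : ℕ → Bool
        track  : Track Y σ
        small  : count n Y ≤ 2 * s
        status : Greedy Y s

    add-other : ∀ {Y p v} → v ≢ p → Y v ≡ false → (Y △ ⟦ p ⟧) v ≡ false
    add-other {Y} {p} {v} v≢p Yv = cong₂ _xor_ Yv (≢⇒≡ᵇ {v} {p} v≢p)

    add-same : ∀ {Y p} → Y p ≡ false → (Y △ ⟦ p ⟧) p ≡ true
    add-same {Y} {p} Yp = cong₂ _xor_ Yp (≡ᵇ-refl p)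

    add-old : ∀ {Y p v} → Y p ≡ false → Y v ≡ true → (Y △ ⟦ p ⟧) v ≡ true
    add-old {Y} {p} {v} Yp Yv = trans (cong (Y v xor_) (≢⇒≡ᵇ {v} {p} λ { refl → case trans (sym Yp) Yv of λ () }))
                                      (trans (xor-identityʳ (Y v)) Yv)

    left-over-add : ∀ Y p → left-over Y △ ⟦ p ⟧ ≐ left-over (Y △ ⟦ p ⟧)
    left-over-add Y p v _ = xor-assoc true (Y v) (⟦ p ⟧ v)

    deg-add : ∀ Y p v → deg (left-over (Y △ ⟦ p ⟧)) v ≡ deg (left-over Y) v xor a v p
    deg-add Y p v = trans (sym (deg-cong v (left-over-add Y p))) (deg-remove (left-over Y) p v)

    ≢-from : ∀ (f : ℕ → Bool) {u v} → f u ≡ true → f v ≡ false → u ≢ v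
    ≢-from f fu fv refl = case trans (sym fu) fv of λ ()

    take-switch : ∀ {s Y} u v → u < n → v < n → SwitchAt Y u v → Greedy Y s → Greedy (Y △ ⟦ u ⟧) (suc s)
    take-switch u v u<n v<n (Yu , Yv , odd , u≢v , sw) (stopped _ none _) =
      case trans (sym sw) (trans (cong (_xor a u v) (sym (none u v u<n v<n Yu Yv odd u≢v))) (xor-same (a u v))) of λ ()
    take-switch {s} {Y} u v u<n v<n (Yu , Yv , odd , u≢v , sw) (progress build _ first) =
      progress build′
        (v , v<n , add-other {Y} (u≢v ∘ sym) Yv , trans (deg-add Y u v) (trans (cong (deg (left-over Y) v xor_) (a-sym v u)) sw))
        (inj₁ (root first))
      where
      build′ : ∀ q Z → Y △ ⟦ u ⟧ ⊑ Z → Chain (λ v → Z v ≡ true) (left-over (Y △ ⟦ u ⟧)) q →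
               Chain (λ v → Z v ≡ true) everything (suc s + q)
      build′ q Z Y⊆U chain = subst (Chain (λ v → Z v ≡ true) everything) (+-suc s q)
        (build (suc q) Z (λ w w<n Yw → Y⊆U w w<n (add-old {Y} Yu Yw))
          (cut-single u (u<n , cong not Yu , Y⊆U u u<n (add-same {Y} Yu)) odd
            (Chain-cong (λ w w<n → sym (left-over-add Y u w w<n)) chain)))
      root : (∃[ t ] t < n × Y t ≡ true × deg everything t ≡ true) ⊎ (∀ v → v < n → Y v ≡ false) →
             ∃[ t ] t < n × (Y △ ⟦ u ⟧) t ≡ true × deg everything t ≡ true
      root (inj₁ (t , t<n , Yt , e)) = t , t<n , add-old {Y} Yu Yt , e
      -- The first vertex to be removed is odd in the whole graph, for nothing is missing yet; it
      -- remains the odd vertex of Y.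
      root (inj₂ empty) = u , u<n , add-same {Y} Yu , trans (sym (deg-cong u λ w w<n → cong not (empty w w<n))) odd

    -- Without a switch, the odd vertices are pairwise adjacent and adjacent to no even one. So the
    -- neighbour z of the even vertex y is even and not adjacent to x; the removal of x and y takes
    -- one neighbour from z and makes it odd. The pair is an odd cut, since just one of its vertices
    -- is odd.
    take-pair : ∀ {s Y} x y w → x < n → y < n → w < n → NoSwitch Y → OddAt Y x w → (∃[ z ] z < n × EvenAt Y y z) →
                Greedy Y s → Greedy (Y △ ⟦ x ⟧ △ ⟦ y ⟧) (suc s)
    take-pair x y w x<n y<n w<n _ (Yx , _ , odd) (z , z<n , Yy , Yz , even , yz) (stopped _ _ (inj₁ none)) =
      case trans (sym odd) (none x x<n Yx) of λ ()
    take-pair x y w x<n y<n w<n _ (Yx , _ , odd) (z , z<n , Yy , Yz , even , yz) (stopped _ _ (inj₂ none)) =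
      case trans (sym yz) (none y z y<n z<n Yy Yz even) of λ ()
    take-pair {s} {Y} x y w x<n y<n w<n none (Yx , _ , odd) (z , z<n , Yy , Yz , even , yz) (progress build _ first) =
      progress build′ (z , z<n , add-other {Y △ ⟦ x ⟧} z≢y (add-other {Y} z≢x Yz) , z-odd) (inj₁ (root first))
      where
      S = left-over Y
      x≢y : x ≢ y
      x≢y = ≢-from (deg S) odd even
      z≢y : z ≢ y
      z≢y refl = case trans (sym yz) (a-irr z) of λ ()
      z≢x : z ≢ x
      z≢x refl = case trans (sym yz) (trans (a-sym y z) (trans (none z y x<n y<n Yx Yy odd x≢y) even)) of λ ()
      z-even : deg S z ≡ false
      z-even with deg S z in dz
      ... | false = refl
      ... | true  = case trans (sym yz) (trans (a-sym y z) (trans (none z y z<n y<n Yz Yy dz z≢y) even)) of λ ()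
      Yy′ : (Y △ ⟦ x ⟧) y ≡ false
      Yy′ = add-other {Y} (x≢y ∘ sym) Yy
      z-odd : deg (left-over (Y △ ⟦ x ⟧ △ ⟦ y ⟧)) z ≡ true
      z-odd = trans (deg-add (Y △ ⟦ x ⟧) y z) (cong₂ _xor_ (trans (deg-add Y x z) (cong₂ _xor_ z-even
                (trans (a-sym z x) (trans (none x z x<n z<n Yx Yz odd (z≢x ∘ sym)) z-even)))) (trans (a-sym z y) yz))
      pair : ℕ → Bool
      pair = ⟦ x ⟧ △ ⟦ y ⟧
      pair-cases : ∀ v → pair v ≡ true → v ≡ x ⊎ v ≡ y
      pair-cases v e with v ≡ᵇ x in vx
      ... | true  = inj₁ (≡ᵇ-sound v x vx)
      ... | false = inj₂ (≡ᵇ-sound v y e)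
      build′ : ∀ q Z → Y △ ⟦ x ⟧ △ ⟦ y ⟧ ⊑ Z → Chain (λ v → Z v ≡ true) (left-over (Y △ ⟦ x ⟧ △ ⟦ y ⟧)) q →
               Chain (λ v → Z v ≡ true) everything (suc s + q)
      build′ q Z Y⊆U chain = subst (Chain (λ v → Z v ≡ true) everything) (+-suc s q)
        (build (suc q) Z (λ w w<n Yw → Y⊆U w w<n (add-old {Y △ ⟦ x ⟧} Yy′ (add-old {Y} Yx Yw)))
          (cut pair inside within
            (trans (B-△ˡ ⟦ x ⟧ ⟦ y ⟧ S) (cong₂ _xor_ (trans (B-singleˡ x S) odd) (trans (B-singleˡ y S) even)))
            (Chain-cong (λ v _ → rearrange (Y v) (⟦ x ⟧ v) (⟦ y ⟧ v)) chain)))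
        where
        rearrange : ∀ p q t → true xor ((p xor q) xor t) ≡ (true xor p) xor (q xor t)
        rearrange false false t = refl
        rearrange false true  t = refl
        rearrange true  false t = not-involutive t
        rearrange true  true  t = refl
        inside : pair ⊑ S
        inside v _ e with pair-cases v e
        ... | inj₁ refl = cong not Yx
        ... | inj₂ refl = cong not Yy
        within : pair ⊑ Z
        within v v<n e with pair-cases v e
        ... | inj₁ refl = Y⊆U v v<n (add-old {Y △ ⟦ x ⟧} Yy′ (add-same {Y} Yx))
        ... | inj₂ refl = Y⊆U v v<n (add-same {Y △ ⟦ x ⟧} Yy′)
      root : (∃[ t ] t < n × Y t ≡ true × deg everything t ≡ true) ⊎ (∀ v → v < n → Y v ≡ false) →
             ∃[ t ] t < n × (Y △ ⟦ x ⟧ △ ⟦ y ⟧) t ≡ true × deg everything t ≡ true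
      root (inj₁ (t , t<n , Yt , e)) = t , t<n , add-old {Y △ ⟦ x ⟧} Yy′ (add-old {Y} Yx Yt) , e
      root (inj₂ empty) = x , x<n , add-old {Y △ ⟦ x ⟧} Yy′ (add-same {Y} Yx)
                        , trans (sym (deg-cong x λ w w<n → cong not (empty w w<n))) odd

    Scanned-NoSwitch : ∀ {Y B x} → (∀ u v → u < n × v < n → B u v) → x ≡ 0 → Seen Y B (SwitchAt Y) x → NoSwitch Y
    Scanned-NoSwitch all refl (inj₁ (_ , none)) u v u<n v<n Yu Yv odd u≢v = sym (xor-agree λ sw → none u v (all u v (u<n , v<n)) (Yu , Yv , odd , u≢v , sw))
    Scanned-NoSwitch all refl (inj₂ (_ , _ , () , _))

    -- As long as there is progress an odd vertex exists, so an idle step means that no even vertex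
    -- has a neighbour among those left. Together with the absence of switches this is `Stuck`.
    stay : ∀ {s Y x z} → NoSwitch Y → (x ≡ 0 ⊎ z ≡ 0) → Seen Y (λ u v → u < n × v < n) (OddAt Y) x →
           Seen Y (λ u v → u < n × v < n) (EvenAt Y) z → Greedy Y s → Greedy Y (suc s)
    stay none idle odds evens (stopped out ns rest) = stopped out ns rest
    stay {Y = Y} none (inj₁ refl) (inj₁ (_ , no-odd)) evens (progress _ (v , v<n , Yv , odd) _) =
      ⊥-elim (no-odd v v (v<n , v<n) (Yv , Yv , odd))
    stay {Y = Y} none (inj₁ refl) (inj₂ (_ , _ , () , _)) evens (progress _ _ _)
    stay {Y = Y} none (inj₂ refl) odds (inj₂ (_ , _ , () , _)) (progress _ _ _)
    stay {Y = Y} none (inj₂ refl) odds (inj₁ (_ , no-even)) (progress _ _ first) =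
      stopped (λ q → halted (record { odd-vertex = none ; even-vertex = even }) first) none (inj₂ even)
      where
      even : NoEven Y
      even u v u<n v<n Yu Yv e with a u v in uv
      ... | false = refl
      ... | true  = ⊥-elim (no-even u v (u<n , v<n) (Yu , Yv , e , uv))

    step-time : ℕ
    step-time = (3 + n * (n * (5 + 4) + 4)) + suc (suc (suc (n * 5) + suc (n * 5)))

    greedy-step : ∀ {σ} s → Bounded M σ → Base σ → GreedyState s σ → Runs greedyStep σ step-time (GreedyState (suc s))
    greedy-step {σ} s b base record { Y = Y ; track = track ; small = small ; status = status } =
      scan-run Y b base track then λ τ b same (odds , switches , evens) →
        let baseτ  = keep same refl refl base
            trackτ : Track Y τ
            trackτ = record { rem= = λ v v<n → trans (arr= same remᵃ refl v) (rem= track v v<n)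
                            ; par= = λ v v<n → trans (arr= same parᵃ refl v) (par= track v v<n) }
        in do-branch b (switch τ b baseτ trackτ switches) λ y≡0 →
           let none = Scanned-NoSwitch (λ _ _ p → p) y≡0 switches
           in do-branch b (pair τ b baseτ trackτ none odds evens) λ xz≡0 →
              slower (s≤s z≤n) (do-skip b record
                { Y = Y ; track = trackτ ; small = ≤-trans small (*-monoʳ-≤ 2 (n≤1+n s))
                ; status = stay none (m*n≡0⇒m≡0∨n≡0 (vars τ xᵛ) xz≡0) odds evens status })
      where
      switch : ∀ τ → Bounded M τ → Base τ → Track Y τ → Seen Y (λ u v → u < n × v < n) (SwitchAt Y) (vars τ yᵛ) → vars τ yᵛ ≢ 0 →
               Runs (remove yᵛ) τ (suc (suc (n * 5) + suc (n * 5))) (GreedyState (suc s))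
      switch τ b base track (inj₁ (y≡0 , _)) y≢0 = ⊥-elim (y≢0 y≡0)
      switch τ b base track (inj₂ (u , v , y= , u<n , v<n , at@(Yu , _))) _ =
        weaken (m≤n⇒m≤1+n (m≤m+n (suc (n * 5)) _))
          (λ ρ _ _ track′ → record
            { Y = Y △ ⟦ u ⟧ ; track = track′
            ; small = ≤-trans (≤-reflexive (count-insert n u u<n Yu))
                        (≤-trans (s≤s small) (≤-trans (n≤1+n _) (≤-reflexive (sym (*-suc 2 s)))))
            ; status = take-switch u v u<n v<n at status })
          (remove-run yᵛ u refl b base track y= u<n Yu)
      pair : ∀ τ → Bounded M τ → Base τ → Track Y τ → NoSwitch Y → Seen Y (λ u v → u < n × v < n) (OddAt Y) (vars τ xᵛ) →
             Seen Y (λ u v → u < n × v < n) (EvenAt Y) (vars τ zᵛ) → vars τ xᵛ * vars τ zᵛ ≢ 0 →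
             Runs (remove xᵛ ⨾ remove zᵛ) τ (suc (n * 5) + suc (n * 5)) (GreedyState (suc s))
      pair τ b base track none (inj₁ (x≡0 , _)) evens xz≢0 = ⊥-elim (xz≢0 (cong (_* vars τ zᵛ) x≡0))
      pair τ b base track none (inj₂ _) (inj₁ (z≡0 , _)) xz≢0 =
        ⊥-elim (xz≢0 (trans (cong (vars τ xᵛ *_) z≡0) (*-zeroʳ (vars τ xᵛ))))
      pair τ b base track none (inj₂ (x , w , x= , x<n , w<n , at@(Yx , _ , odd))) (inj₂ (y , z , z= , y<n , z<n , at′@(Yy , _ , even , _))) _ =
        remove-run xᵛ x refl b base track x= x<n Yx then λ ρ b same track′ →
        weaken ≤-refl
          (λ ρ′ _ _ track″ → record
            { Y = Y △ ⟦ x ⟧ △ ⟦ y ⟧ ; track = track″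
            ; small = ≤-trans (≤-reflexive (trans (count-insert n y y<n Yy′) (cong suc (count-insert n x x<n Yx))))
                        (≤-trans (s≤s (s≤s small)) (≤-reflexive (sym (*-suc 2 s))))
            ; status = take-pair x y w x<n y<n w<n none at (z , z<n , at′) status })
          (remove-run zᵛ y refl b (keep same refl refl base) track′ (trans (var= same zᵛ refl) z=) y<n Yy′)
        where
        Yy′ : (Y △ ⟦ x ⟧) y ≡ false
        Yy′ = add-other {Y} (≢-from (deg (left-over Y)) odd even ∘ sym) Yy

    record GreedyResult (σ : State) : Set where
      field
        Y       : ℕ → Bool
        rem=    : ∀ v → v < n → arrs σ remᵃ v ≡ bit (Y v)
        few     : count n Y ≤ 2 * r
        outcome : Outcome r Y

    greedy-run : ∀ {σ} → Bounded M σ → Base σ → (∀ v → v < n → arrs σ parᵃ v ≡ bit (deg everything v)) →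
                 (∀ v → arrs σ remᵃ v ≡ 0) → Runs greedy σ (suc r * (step-time + 4)) GreedyResult
    greedy-run {σ} b base pars rems = weaken ≤-refl finish
      (do-for r (suc r) GreedyState refl b (n≤1+n r) (s≤s z≤n) (≤6k⇒≤M r≤)
        (λ τ same → trans (var= same rᵛ refl) (r= base))
        (record { Y = λ _ → false
                ; track = record { rem= = λ v _ → rems v ; par= = λ v v<n → trans (pars v v<n) (cong bit (deg-cong v λ _ _ → refl)) }
                ; small = ≤-reflexive (count-zero n λ _ _ → refl)
                ; status = start (find n (deg everything)) })
        (λ s τ _ b same _ state → weaken ≤-refl (λ _ _ _ st → record
            { Y = GreedyState.Y st
            ; track = record { rem= = Track.rem= (GreedyState.track st) ; par= = Track.par= (GreedyState.track st) }
            ; small = GreedyState.small st ; status = GreedyState.status st })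
          (greedy-step s b (keep same refl refl base) state)))
      where
      r≤ : r ≤ 6 * r + 6
      r≤ = ≤-trans (m≤m+n r (5 * r)) (m≤m+n (6 * r) 6)
      start : (∃[ v ] v < n × deg everything v ≡ true) ⊎ (∀ v → v < n → deg everything v ≡ false) → Greedy (λ _ → false) 0
      start (inj₁ (v , v<n , odd)) = progress (λ q Z _ chain → Chain-cong (λ _ _ → refl) chain) (v , v<n , refl , odd) (inj₂ λ _ _ → refl)
      start (inj₂ even) = stopped (λ q → eulerian even) (λ u v u<n _ _ _ odd _ → case trans (sym odd) (even u u<n) of λ ()) (inj₁ λ v v<n _ → even v v<n)
      finish : ∀ τ → Bounded M τ → Same greedy σ τ → GreedyState r τ → GreedyResult τ
      finish τ _ _ record { Y = Y ; track = track ; small = small ; status = status } = record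
        { Y = Y ; rem= = rem= track ; few = small ; outcome = result status }
        where
        result : Greedy Y r → Outcome r Y
        result (progress build _ _) = complete (subst (Chain (λ v → Y v ≡ true) everything) (+-identityʳ r) (build 0 Y (λ _ _ e → e) []))
        result (stopped out _ _)    = out r

    -- The classification phase

    module ClassifyPhase (Y : ℕ → Bool) where

      open Classes r Y

      Tab : (ℕ → Bool) → State → Set
      Tab done σ = Partial done (vars σ Nᵛ) (arrs σ itemᵃ) (arrs σ rankᵃ) (arrs σ repᵃ) (arrs σ sizeᵃ)

      record Context (σ : State) : Set where
        field
          base : Base σ
          cap= : vars σ capᵛ ≡ cap

      open Context

      writesTables : Cmd → Bool
      writesTables c = writesArr c itemᵃ ∨ writesArr c rankᵃ ∨ writesArr c repᵃ ∨ writesArr c sizeᵃ ∨ writesVar c Nᵛ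

      keep-context : ∀ {c σ τ} → Same c σ τ → writesVar c nᵛ ∨ writesVar c rᵛ ≡ false → writesVar c capᵛ ≡ false →
                     writesArr c adjᵃ ≡ false → Context σ → Context τ
      keep-context same wv wc wa ctx = record { base = keep same wv wa (base ctx) ; cap= = trans (var= same capᵛ wc) (cap= ctx) }

      keep-tab : ∀ {c σ τ done} → Same c σ τ → writesTables c ≡ false → Tab done σ → Tab done τ
      keep-tab {c} {σ} {τ} {done} same w tab =
        subst (λ N → Partial done N (arrs τ itemᵃ) (arrs τ rankᵃ) (arrs τ repᵃ) (arrs τ sizeᵃ)) (sym (var= same Nᵛ w₅))
        (subst (λ f → Partial done (vars σ Nᵛ) f (arrs τ rankᵃ) (arrs τ repᵃ) (arrs τ sizeᵃ)) (sym (arr≡ same itemᵃ w₁))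
        (subst (λ f → Partial done (vars σ Nᵛ) (arrs σ itemᵃ) f (arrs τ repᵃ) (arrs τ sizeᵃ)) (sym (arr≡ same rankᵃ w₂))
        (subst (λ f → Partial done (vars σ Nᵛ) (arrs σ itemᵃ) (arrs σ rankᵃ) f (arrs τ sizeᵃ)) (sym (arr≡ same repᵃ w₃))
        (subst (λ f → Partial done (vars σ Nᵛ) (arrs σ itemᵃ) (arrs σ rankᵃ) (arrs σ repᵃ) f) (sym (arr≡ same sizeᵃ w₄)) tab))))
        where
        w₁ = proj₁ (∨-false {writesArr c itemᵃ} w)
        v₁ = proj₂ (∨-false {writesArr c itemᵃ} w)
        w₂ = proj₁ (∨-false {writesArr c rankᵃ} v₁)
        v₂ = proj₂ (∨-false {writesArr c rankᵃ} v₁)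
        w₃ = proj₁ (∨-false {writesArr c repᵃ} v₂)
        v₃ = proj₂ (∨-false {writesArr c repᵃ} v₂)
        w₄ = proj₁ (∨-false {writesArr c sizeᵃ} v₃)
        w₅ = proj₂ (∨-false {writesArr c sizeᵃ} v₃)

      -- A flag that starts at y and is set to x by the first i < m with P i.
      Flag : (ℕ → Set) → ℕ → ℕ → ℕ → ℕ → Set
      Flag P y x m f = (f ≡ y × (∀ i → i < m → ¬ P i)) ⊎ (f ≡ x × ∃[ i ] i < n × P i)

      isolated-run : ∀ {σ} v → Bounded M σ → Base σ → vars σ uᵛ ≡ v →
                     Runs testIsolated σ (suc (n * (2 + 4))) (λ τ → Flag (λ w → a v w ≡ true) 0 1 n (vars τ sᵛ))
      isolated-run {σ} v b base u= =
        var-then 0 b refl z≤n λ b →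
        do-for n n (λ w τ → Flag (λ w → a v w ≡ true) 0 1 w (vars τ sᵛ)) refl b ≤-refl 1≤n (≤n⇒≤M ≤-refl)
          (λ τ same → trans (var= same nᵛ refl) (n= base)) (inj₁ (refl , λ _ ()))
          λ w τ w<n b same v= inv → do-if (a v w) b
            (cell-eval (var uᵛ) (var vᵛ) (keep same refl refl (record { n= = n= base ; r= = r= base ; cells = cells base }))
              (trans (var= same uᵛ refl) u=) v= w<n)
            (λ adjacent → do-var 1 b refl 1≤M (inj₂ (refl , w , w<n , adjacent)))
            (λ ¬adjacent → do-skip b (next w ¬adjacent inv))
        where
        next : ∀ w {f} → a v w ≡ false → Flag (λ w → a v w ≡ true) 0 1 w f → Flag (λ w → a v w ≡ true) 0 1 (suc w) f
        next w ¬adj (inj₂ found) = inj₂ found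
        next w ¬adj (inj₁ (e , none)) = inj₁ (e , λ i i<1+w adj → case <-suc i<1+w of λ
          { (inj₁ i<w) → none i i<w adj ; (inj₂ refl) → case trans (sym adj) ¬adj of λ () })

      Found : ℕ → (ℕ → ℕ) → ℕ → ℕ → Set
      Found v rep m t = (t ≡ 0 × (∀ j → 1 ≤ j → j ≤ m → ∃[ w ] w < n × near v w ≢ near (rep j) w))
                      ⊎ (1 ≤ t × t ≤ m × (∀ w → w < n → near v w ≡ near (rep t) w))

      findClass-time : ℕ
      findClass-time = suc ((6 * r + 6) * (suc (n * (2 + 4) + 2) + 4))

      findClass-run : ∀ {σ} v → Bounded M σ → Base σ → vars σ uᵛ ≡ v → vars σ Nᵛ ≤ cap →
                      Runs findClass σ findClass-time (λ τ → Found v (arrs σ repᵃ) (vars σ Nᵛ) (vars τ tᵛ))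
      findClass-run {σ} v b base u= N≤cap =
        var-then 0 b refl z≤n λ b →
        do-for (vars σ Nᵛ) (6 * r + 6) (λ m τ → Found v rep m (vars τ tᵛ)) refl b
          N≤ (≤-trans (s≤s z≤n) (m≤n+m 6 (6 * r))) (≤6k⇒≤M N≤)
          (λ τ same → var= same Nᵛ refl) (inj₁ (refl , λ { j (s≤s _) () })) body
        where
        rep = arrs σ repᵃ
        N≤ : vars σ Nᵛ ≤ 6 * r + 6
        N≤ = ≤-trans N≤cap (+-monoʳ-≤ (6 * r) (n≤1+n 5))
        rowBody : Cmd
        rowBody = branch (xorᴱ (closedCell (var uᵛ) (var vᵛ)) (closedCell (repᵃ ⁅ var wᵛ +ᴱ lit 1 ⁆) (var vᵛ))) (xᵛ := lit 0) skip
        Differ : ℕ → ℕ → Set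
        Differ i w = near v w xor near (rep (suc i)) w ≡ true
        body : ∀ i τ → i < vars σ Nᵛ → Bounded M τ → Same _ (setVar tᵛ 0 σ) τ → vars τ wᵛ ≡ i → Found v rep i (vars τ tᵛ) →
               Runs (xᵛ := lit 1 ⨾ forLoop vᵛ (var nᵛ) rowBody ⨾ branch (var xᵛ) (tᵛ := var wᵛ +ᴱ lit 1) skip) τ
                    (suc (n * (2 + 4) + 2)) (λ τ′ → Found v rep (suc i) (vars τ′ tᵛ))
        body i τ i<N b same w= found =
          var-then 1 b refl 1≤M λ b →
          do-for n n (λ w τ → Flag (Differ i) 1 0 w (vars τ xᵛ)) refl b ≤-refl 1≤n (≤n⇒≤M ≤-refl)
            (λ ρ same′ → n= (baseρ ρ same′)) (inj₁ (refl , λ _ ()))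
            (λ w ρ w<n b same′ v= flag → do-if (near v w xor near (rep (suc i)) w) b
              (xor-eval ρ (closedCell (var uᵛ) (var vᵛ)) (closedCell (repᵃ ⁅ var wᵛ +ᴱ lit 1 ⁆) (var vᵛ))
                (closed-eval (var uᵛ) (var vᵛ) (baseρ ρ same′) (trans (var= same′ uᵛ refl) (trans (var= same uᵛ refl) u=)) v= w<n)
                (closed-eval (repᵃ ⁅ var wᵛ +ᴱ lit 1 ⁆) (var vᵛ) (baseρ ρ same′)
                  (trans (arr= same′ repᵃ refl _) (trans (arr= same repᵃ refl _)
                    (cong rep (trans (+-comm _ 1) (cong suc (trans (var= same′ wᵛ refl) w=)))))) v= w<n))
              (λ differ → do-var 0 b refl z≤n (inj₂ (refl , w , w<n , differ)))
              (λ ¬differ → do-skip b (next w ¬differ flag)))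
          then λ ρ b same′ flag →
          do-branch b (matched ρ b same′ flag) (unmatched ρ b same′ flag)
          where
          baseρ : ∀ ρ → Same (forLoop vᵛ (var nᵛ) rowBody) (setVar xᵛ 1 τ) ρ → Base ρ
          baseρ ρ same′ = keep same′ refl refl (record { n= = n= baseτ ; r= = r= baseτ ; cells = cells baseτ })
            where
            baseτ : Base τ
            baseτ = keep same refl refl (record { n= = n= base ; r= = r= base ; cells = cells base })
          next : ∀ w {f} → near v w xor near (rep (suc i)) w ≡ false → Flag (Differ i) 1 0 w f → Flag (Differ i) 1 0 (suc w) f
          next w ¬differ (inj₂ found) = inj₂ found
          next w ¬differ (inj₁ (e , none)) = inj₁ (e , λ x x<1+w d → case <-suc x<1+w of λ
            { (inj₁ x<w) → none x x<w d ; (inj₂ refl) → case trans (sym d) ¬differ of λ () })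
          matched : ∀ ρ → Bounded M ρ → Same (forLoop vᵛ (var nᵛ) rowBody) (setVar xᵛ 1 τ) ρ → Flag (Differ i) 1 0 n (vars ρ xᵛ) → vars ρ xᵛ ≢ 0 →
                    Runs (tᵛ := var wᵛ +ᴱ lit 1) ρ 1 (λ τ′ → Found v rep (suc i) (vars τ′ tᵛ))
          matched ρ b same′ (inj₂ (x≡0 , _)) x≢0 = ⊥-elim (x≢0 x≡0)
          matched ρ b same′ (inj₁ (_ , none)) _ =
            do-var (suc i) b (trans (+-comm _ 1) (cong suc (trans (var= same′ wᵛ refl) w=))) (≤6k⇒≤M (≤-trans i<N N≤))
              (inj₂ (s≤s z≤n , ≤-refl , λ w w<n → xor-agree (none w w<n)))
          unmatched : ∀ ρ → Bounded M ρ → Same (forLoop vᵛ (var nᵛ) rowBody) (setVar xᵛ 1 τ) ρ → Flag (Differ i) 1 0 n (vars ρ xᵛ) → vars ρ xᵛ ≡ 0 →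
                      Runs skip ρ 1 (λ τ′ → Found v rep (suc i) (vars τ′ tᵛ))
          unmatched ρ b same′ (inj₁ (x≡1 , _)) x≡0 = case trans (sym x≡1) x≡0 of λ ()
          unmatched ρ b same′ (inj₂ (_ , w , w<n , d)) _ =
            do-skip b (subst (Found v rep (suc i)) (sym (var= same′ tᵛ refl)) (extend-found found))
            where
            extend-found : ∀ {t} → Found v rep i t → Found v rep (suc i) t
            extend-found (inj₂ (1≤t , t≤i , same-row)) = inj₂ (1≤t , m≤n⇒m≤1+n t≤i , same-row)
            extend-found (inj₁ (e , differ)) = inj₁ (e , λ j 1≤j j≤1+i → case m≤n⇒m<n∨m≡n j≤1+i of λ
              { (inj₁ j<1+i) → differ j 1≤j (s≤s⁻¹ j<1+i)
              ; (inj₂ refl) → w , w<n , λ e → case trans (sym d) (trans (cong (_xor near (rep (suc i)) w) e) (xor-same (near (rep (suc i)) w))) of λ () })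

      -- Each vertex opens at most one class. During the pass over Y, which has at most 2 r
      -- vertices, this keeps N below the cap, so that the vertices of Y are never turned away.
      Inserted : (ℕ → Bool) → State → Set
      Inserted done τ = Tab done τ × vars τ Nᵛ ≤ count n done

      insert-time : ℕ
      insert-time = suc (n * (2 + 4)) + suc (findClass-time + (5 + 4))

      insert-run : ∀ {σ} v done → Bounded M σ → Context σ → vars σ uᵛ ≡ v → v < n → done v ≡ false → Inserted done σ →
                   (Y v ≡ true → vars σ Nᵛ < cap) → Runs insert σ insert-time (Inserted (done △ ⟦ v ⟧))
      insert-run {σ} v done b ctx u= v<n ¬done (tab , few) room =
        isolated-run v b (base ctx) u= then λ τ b same flag →
        do-branch b (nonisolated τ b same flag) (isolated τ b same flag)
        where
        grown : count n (done △ ⟦ v ⟧) ≡ suc (count n done)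
        grown = count-insert n v v<n ¬done
        isolated : ∀ τ → Bounded M τ → Same testIsolated σ τ → Flag (λ w → a v w ≡ true) 0 1 n (vars τ sᵛ) → vars τ sᵛ ≡ 0 →
                   Runs skip τ (findClass-time + (5 + 4)) (Inserted (done △ ⟦ v ⟧))
        isolated τ b same (inj₂ (s≡1 , _)) s≡0 = case trans (sym s≡1) s≡0 of λ ()
        isolated τ b same (inj₁ (_ , none)) _ = slower (s≤s z≤n) (do-skip b
          ( keep-tab same refl (leave tab v<n ¬done
              (λ { i Ii refl → let w , w<n , e = Partial.rep-nonisolated tab i Ii in none w w<n e })
              (inj₁ iso) (λ _ → iso))
          , ≤-trans (≤-reflexive (var= same Nᵛ refl)) (≤-trans few (≤-trans (n≤1+n _) (≤-reflexive (sym grown)))) ))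
          where
          iso : Isolated v
          iso w w<n with a v w in e
          ... | false = refl
          ... | true  = ⊥-elim (none w w<n e)
        Ready : State → Set
        Ready ρ = vars ρ uᵛ ≡ v ×
          ( (vars ρ tᵛ ≡ 0 × Inserted (done △ ⟦ v ⟧) ρ)
          ⊎ (Index (vars ρ Nᵛ) (vars ρ tᵛ) × (∀ w → w < n → near v w ≡ near (arrs ρ repᵃ (vars ρ tᵛ)) w)
             × Tab done ρ × vars ρ Nᵛ ≤ suc (count n done)) )
        finish : ∀ ρ → Bounded M ρ → Ready ρ → Runs (branch (var tᵛ) joinClass skip) ρ 4 (Inserted (done △ ⟦ v ⟧))
        finish ρ b (u= , inj₁ (t≡0 , inserted)) = do-branch b (λ t≢0 → ⊥-elim (t≢0 t≡0)) (λ _ → slower (s≤s z≤n) (do-skip b inserted))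
        finish ρ b (u= , inj₂ (It , same-row , tab , few)) = do-branch b
          (λ _ → arr-then v t b u= refl (var≤ b tᵛ) λ b → arr-then v (size t) b u= refl (arr≤ b sizeᵃ t) λ b →
            do-arr t (suc (size t)) b refl (+-comm _ 1) size<M
              ( join tab v<n ¬done t It same-row , ≤-trans few (≤-reflexive (sym grown)) ))
          (λ t≡0 → case subst (1 ≤_) t≡0 (proj₁ It) of λ ())
          where
          t = vars ρ tᵛ
          size = arrs ρ sizeᵃ
          size<M : suc (size t) ≤ M
          size<M = ≤-<-trans (≤-trans (≤-reflexive (Partial.size-count tab t It)) (count-≤ n _)) n<M
        nonisolated : ∀ τ → Bounded M τ → Same testIsolated σ τ → Flag (λ w → a v w ≡ true) 0 1 n (vars τ sᵛ) → vars τ sᵛ ≢ 0 →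
          Runs (findClass ⨾ branch (var tᵛ) skip (branch (var Nᵛ <ᴱ var capᵛ) openClass skip) ⨾ branch (var tᵛ) joinClass skip)
               τ (findClass-time + (5 + 4)) (Inserted (done △ ⟦ v ⟧))
        nonisolated τ b same (inj₁ (s≡0 , _)) s≢0 = ⊥-elim (s≢0 s≡0)
        nonisolated τ b same (inj₂ (_ , neighbour)) _ =
          findClass-run v b (base ctxτ) (trans (var= same uᵛ refl) u=) (Partial.N≤cap tabτ) then λ ρ b same′ found →
          choose ρ b (trans (var= same′ uᵛ refl) (trans (var= same uᵛ refl) u=)) (keep-context same′ refl refl refl ctxτ)
            (keep-tab same′ refl tabτ) (trans (var= same′ Nᵛ refl) (var= same Nᵛ refl))
            (subst₂ (λ rep N → Found v rep N (vars ρ tᵛ)) (sym (arr≡ same′ repᵃ refl)) (sym (var= same′ Nᵛ refl)) found)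
          then λ ρ b _ ready → finish ρ b ready
          where
          tabτ : Tab done τ
          tabτ = keep-tab same refl tab
          ctxτ : Context τ
          ctxτ = keep-context same refl refl refl ctx
          choose : ∀ ρ → Bounded M ρ → vars ρ uᵛ ≡ v → Context ρ → Tab done ρ → vars ρ Nᵛ ≡ vars σ Nᵛ →
                   Found v (arrs ρ repᵃ) (vars ρ Nᵛ) (vars ρ tᵛ) →
                   Runs (branch (var tᵛ) skip (branch (var Nᵛ <ᴱ var capᵛ) openClass skip)) ρ 5 Ready
          choose ρ b u= ctx tab N= (inj₂ (1≤t , t≤N , same-row)) = do-branch b
            (λ _ → slower (s≤s z≤n) (do-skip b (u= , inj₂ ((1≤t , t≤N) , same-row , tab ,
              ≤-trans (≤-trans (≤-reflexive N=) few) (n≤1+n _)))))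
            (λ t≡0 → case subst (1 ≤_) t≡0 1≤t of λ ())
          choose ρ b u= ctx tab N= (inj₁ (t≡0 , differ)) = do-branch b (λ t≢0 → ⊥-elim (t≢0 t≡0)) λ _ →
            do-if (vars ρ Nᵛ <ᵇ cap) b (cong (λ c → bit (vars ρ Nᵛ <ᵇ c)) (cap= ctx)) open-new full
            where
            rep≢v : ∀ i → Index (vars ρ Nᵛ) i → arrs ρ repᵃ i ≢ v
            rep≢v i (1≤i , i≤N) e with w , _ , ne ← differ i 1≤i i≤N = ne (cong (λ u → near u w) (sym e))
            full : (vars ρ Nᵛ <ᵇ cap) ≡ false → Runs skip ρ 3 Ready
            full ¬room = slower (s≤s z≤n) (do-skip b (u= , inj₁ (t≡0 ,
              leave tab v<n ¬done rep≢v (inj₂ N≡cap) (λ Yv → ⊥-elim (<-irrefl N≡cap (subst (_< cap) (sym N=) (room Yv)))) ,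
              ≤-trans (≤-trans (≤-reflexive N=) few) (≤-trans (n≤1+n _) (≤-reflexive (sym grown))))))
              where
              N≡cap : vars ρ Nᵛ ≡ cap
              N≡cap = ≤-antisym (Partial.N≤cap tab) (≮⇒≥ λ N<cap → subst T ¬room (<⇒<ᵇ N<cap))
            open-new : (vars ρ Nᵛ <ᵇ cap) ≡ true → Runs openClass ρ 3 Ready
            open-new N<ᵇcap =
              var-then (suc (vars ρ Nᵛ)) b (+-comm _ 1) N≤M λ b →
              var-then (suc (vars ρ Nᵛ)) b refl N≤M λ b →
              do-arr (suc (vars ρ Nᵛ)) v b refl u= (≤n⇒≤M (<⇒≤ v<n))
                ( u= , inj₂ ( (s≤s z≤n , ≤-refl)
                            , (λ w _ → cong (λ u → near u w) (sym (array-at (arrs ρ repᵃ) {suc (vars ρ Nᵛ)} v)))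
                            , new-class tab v<n ¬done (let w , w<n , e = neighbour in w , w<n , e) N<cap distinct
                            , s≤s (≤-trans (≤-reflexive N=) few) ) )
              where
              N<cap : vars ρ Nᵛ < cap
              N<cap = <ᵇ⇒< (vars ρ Nᵛ) cap (subst T (sym N<ᵇcap) tt)
              N≤M : suc (vars ρ Nᵛ) ≤ M
              N≤M = ≤6k⇒≤M (≤-trans N<cap (+-monoʳ-≤ (6 * r) (n≤1+n 5)))
              distinct : ∀ i → Index (vars ρ Nᵛ) i → Distinct (arrs ρ repᵃ i) v
              distinct i Ii@(1≤i , i≤N) with w , w<n , ne ← differ i 1≤i i≤N = rep≢v i Ii , w , w<n , ne ∘ sym

      -- A pass skips the vertices whose removal mark equals its number, so pass 0 handles Y and
      -- pass 1 the others. The value 2 is reached after both.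
      processed : ℕ → ℕ → ℕ → Bool
      processed 0             i v = Y v ∧ (v <ᵇ i)
      processed 1             i v = Y v ∨ (v <ᵇ i)
      processed (suc (suc _)) i v = true

      Inserted-cong : ∀ {done done′ τ} → done ≐ done′ → Inserted done τ → Inserted done′ τ
      Inserted-cong same (tab , few) = Partial-cong same tab , ≤-trans few (≤-reflexive (count-cong n same))

      processed-next : ∀ p i → p < 2 → (bit (Y i) ≡ᵇ p) ≡ false → processed p i △ ⟦ i ⟧ ≐ processed p (suc i)
      processed-next 0 i _ e v _ with v ≟ i
      ... | yes refl rewrite <ᵇ-false (n≮n v) | <ᵇ-true (n<1+n v) | ≡ᵇ-refl v with Y v
      ...   | true = refl
      processed-next 0 i _ e v _ | no v≢i rewrite ≢⇒≡ᵇ {v} {i} v≢i =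
        trans (xor-identityʳ _) (cong (Y v ∧_) (sym (trans (<ᵇ-suc v i) (trans (cong ((v <ᵇ i) xor_) (≢⇒≡ᵇ {v} {i} v≢i)) (xor-identityʳ _)))))
      processed-next 1 i _ e v _ with v ≟ i
      ... | yes refl rewrite <ᵇ-false (n≮n v) | <ᵇ-true (n<1+n v) | ≡ᵇ-refl v with Y v
      ...   | false = refl
      processed-next 1 i _ e v _ | no v≢i rewrite ≢⇒≡ᵇ {v} {i} v≢i =
        trans (xor-identityʳ _) (cong (Y v ∨_) (sym (trans (<ᵇ-suc v i) (trans (cong ((v <ᵇ i) xor_) (≢⇒≡ᵇ {v} {i} v≢i)) (xor-identityʳ _)))))
      processed-next (suc (suc _)) i (s≤s (s≤s ()))

      processed-skip : ∀ p i → p < 2 → (bit (Y i) ≡ᵇ p) ≡ true → processed p i ≐ processed p (suc i)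
      processed-skip (suc (suc _)) i (s≤s (s≤s ()))
      processed-skip 0 i _ e v _ with v ≟ i
      processed-skip 0 i _ e v _ | yes refl with Y v
      ... | false = refl
      processed-skip 0 i _ e v _ | no v≢i =
        cong (Y v ∧_) (sym (trans (<ᵇ-suc v i) (trans (cong ((v <ᵇ i) xor_) (≢⇒≡ᵇ {v} {i} v≢i)) (xor-identityʳ _))))
      processed-skip 1 i _ e v _ with v ≟ i
      processed-skip 1 i _ e v _ | yes refl with Y v
      ... | true = refl
      processed-skip 1 i _ e v _ | no v≢i =
        cong (Y v ∨_) (sym (trans (<ᵇ-suc v i) (trans (cong ((v <ᵇ i) xor_) (≢⇒≡ᵇ {v} {i} v≢i)) (xor-identityʳ _))))

      processed-turn : ∀ p → p < 2 → processed p n ≐ processed (suc p) 0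
      processed-turn 0 _ v v<n with Y v
      ... | true  = <ᵇ-true v<n
      ... | false = refl
      processed-turn 1 _ v v<n with Y v
      ... | true  = refl
      ... | false = <ᵇ-true v<n
      processed-turn (suc (suc _)) (s≤s (s≤s ()))

      unprocessed : ∀ p i → p < 2 → (bit (Y i) ≡ᵇ p) ≡ false → processed p i i ≡ false
      unprocessed 0 i _ e rewrite <ᵇ-false (n≮n i) = ∧-zeroʳ (Y i)
      unprocessed 1 i _ e rewrite <ᵇ-false (n≮n i) with Y i
      ... | false = refl
      unprocessed (suc (suc _)) i (s≤s (s≤s ()))

      classify-time : ℕ
      classify-time = 2 * (n * (suc insert-time + 4) + 4)

      classify-run : ∀ {σ} → Bounded M σ → Context σ → (∀ v → v < n → arrs σ remᵃ v ≡ bit (Y v)) → count n Y ≤ 2 * r →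
        vars σ Nᵛ ≡ 0 → (∀ v → arrs σ itemᵃ v ≡ 0) → arrs σ repᵃ 0 ≡ n → dbl r < arrs σ sizeᵃ 0 → (∀ j → 1 ≤ j → arrs σ sizeᵃ j ≡ 0) →
        Runs classify σ classify-time
          (λ τ → Table cap r Y (vars τ Nᵛ) (arrs τ itemᵃ) (arrs τ rankᵃ) (arrs τ repᵃ) (arrs τ sizeᵃ))
      classify-run {σ} b ctx rem= few N≡0 items rep0 size0 sizes =
        weaken ≤-refl (λ τ _ _ (tab , _) → finished tab λ _ _ → refl)
          (do-for 2 2 (λ p → Inserted (processed p 0)) refl b ≤-refl (s≤s z≤n) (≤-trans (s≤s (s≤s z≤n)) 8≤M)
            (λ _ _ → refl)
            ( subst (λ N → Partial (processed 0 0) N (arrs σ itemᵃ) (arrs σ rankᵃ) (arrs σ repᵃ) (arrs σ sizeᵃ)) (sym N≡0)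
                (empty-table (λ v _ → ∧-zeroʳ (Y v)) items rep0 size0 sizes)
            , ≤-trans (≤-reflexive N≡0) z≤n )
            λ p τ p<2 b same p= inv → weaken ≤-refl (λ ρ _ _ (tab , l) → Inserted-cong {τ = ρ} (processed-turn p p<2) (tab , l))
              (do-for n n (λ i → Inserted (processed p i)) refl b ≤-refl 1≤n (≤n⇒≤M ≤-refl)
                (λ ρ same′ → trans (var= same′ nᵛ refl) (trans (var= same nᵛ refl) (n= (base ctx)))) inv
                (λ i ρ i<n b same′ u= inv → weaken ≤-refl (λ _ _ _ q → q) (one p i ρ p<2 i<n b
                   (keep-context same′ refl refl refl (keep-context same refl refl refl
                     (record { base = record { n= = n= (base ctx) ; r= = r= (base ctx) ; cells = cells (base ctx) } ; cap= = cap= ctx })))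
                   u= (trans (var= same′ iᵛ refl) p=)
                   (trans (arr= same′ remᵃ refl i) (trans (arr= same remᵃ refl i) (rem= i i<n))) inv))))
        where
        one : ∀ p i ρ → p < 2 → i < n → Bounded M ρ → Context ρ → vars ρ uᵛ ≡ i → vars ρ iᵛ ≡ p → arrs ρ remᵃ i ≡ bit (Y i) →
              Inserted (processed p i) ρ →
              Runs (branch (remᵃ ⁅ var uᵛ ⁆ =ᴱ var iᵛ) skip insert) ρ (suc insert-time) (Inserted (processed p (suc i)))
        one p i ρ p<2 i<n b ctx u= p= rem-i inv =
          do-if (bit (Y i) ≡ᵇ p) b (cong₂ (λ x y → bit (x ≡ᵇ y)) (trans (cong (arrs ρ remᵃ) u=) rem-i) p=)
            (λ e → slower (s≤s z≤n) (do-skip b (Inserted-cong {τ = ρ} (processed-skip p i p<2 e) inv)))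
            (λ e → weaken ≤-refl (λ τ _ _ → Inserted-cong {τ = τ} (processed-next p i p<2 e))
              (insert-run i (processed p i) b ctx u= i<n (unprocessed p i p<2 e) inv (room p e p<2 inv)))
          where
          room : ∀ p → (bit (Y i) ≡ᵇ p) ≡ false → p < 2 → Inserted (processed p i) ρ → Y i ≡ true → vars ρ Nᵛ < cap
          room 0 e p<2 (_ , few′) Yi = begin-strict
            vars ρ Nᵛ                     ≤⟨ few′ ⟩
            count n (processed 0 i)       <⟨ ≤-reflexive (sym (count-insert n i i<n (unprocessed 0 i p<2 e))) ⟩
            count n (processed 0 i △ ⟦ i ⟧) ≤⟨ count-⊆ n within ⟩
            count n Y                     ≤⟨ few ⟩
            2 * r                         ≤⟨ *-monoˡ-≤ r (s≤s (s≤s (z≤n {4}))) ⟩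
            6 * r                         ≤⟨ m≤m+n (6 * r) 5 ⟩
            cap                           ∎
            where
            open ≤-Reasoning
            within : ∀ v → v < n → (processed 0 i △ ⟦ i ⟧) v ≡ true → Y v ≡ true
            within v v<n e′ = proj₁ (∧-true (trans (sym (processed-next 0 i p<2 e v v<n)) e′))
          room 1 e _ _ Yi = case trans (sym (cong (λ y → bit y ≡ᵇ 1) Yi)) e of λ ()
          room (suc (suc _)) e (s≤s (s≤s ()))

    -- The exhaustive search and the output

    module SearchPhase (Y : ℕ → Bool) {N : ℕ} {item rank rep size : ℕ → ℕ}
      (table : Table (6 * r + 5) r Y N item rank rep size) where

      open Table table
      open Numeral N

      record Context (σ : State) : Set where
        field
          base      : Base σ
          N=        : vars σ Nᵛ ≡ N
          D=        : vars σ Dᵛ ≡ dbl r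
          item=     : arrs σ itemᵃ ≡ item
          rank=     : arrs σ rankᵃ ≡ rank
          rep=      : arrs σ repᵃ ≡ rep
          size=     : arrs σ sizeᵃ ≡ size
          deg=      : ∀ v → v < n → arrs σ degᵃ v ≡ bit (deg everything v)
          deg-dummy : arrs σ degᵃ n ≡ 0

      open Context

      any : (ℕ → Bool) → ℕ → Bool
      any f zero    = false
      any f (suc m) = any f m ∨ f m

      any-false : ∀ f m → any f m ≡ false → ∀ i → i < m → f i ≡ false
      any-false f (suc m) e i i<1+m with <-suc i<1+m
      ... | inj₁ i<m  = any-false f m (proj₁ (∨-false e)) i i<m
      ... | inj₂ refl = proj₂ (∨-false {any f m} e)

      -- Only variables from goᵛ on and the arrays outᵃ and digᵃ are written.
      Harmless : Cmd → Set
      Harmless c = any (writesVar c) 6 ∨ (writesArr c adjᵃ ∨ any (λ i → writesArr c (4 + i)) 4 ∨ writesArr c degᵃ) ≡ false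

      keep-context : ∀ {c σ τ} → Same c σ τ → Harmless c → Context σ → Context τ
      keep-context {c} {σ} {τ} same h ctx = record
        { base = record { n= = trans (v= 0 (s≤s z≤n)) (n= (base ctx)) ; r= = trans (v= 2 (s≤s (s≤s (s≤s z≤n)))) (r= (base ctx))
                        ; cells = λ u v v<n → trans (arr= same adjᵃ w₀ _) (cells (base ctx) u v v<n) }
        ; N= = trans (v= 4 (s≤s (s≤s (s≤s (s≤s (s≤s z≤n)))))) (N= ctx)
        ; D= = trans (v= 3 (s≤s (s≤s (s≤s (s≤s z≤n))))) (D= ctx)
        ; item= = trans (a= 0 (s≤s z≤n)) (item= ctx) ; rank= = trans (a= 1 (s≤s (s≤s z≤n))) (rank= ctx)
        ; rep= = trans (a= 2 (s≤s (s≤s (s≤s z≤n)))) (rep= ctx) ; size= = trans (a= 3 (s≤s (s≤s (s≤s (s≤s z≤n))))) (size= ctx)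
        ; deg= = λ v v<n → trans (arr= same degᵃ w₉ v) (deg= ctx v v<n)
        ; deg-dummy = trans (arr= same degᵃ w₉ n) (deg-dummy ctx) }
        where
        hv = proj₁ (∨-false {any (writesVar c) 6} h)
        ha = proj₂ (∨-false {any (writesVar c) 6} h)
        w₀ = proj₁ (∨-false {writesArr c adjᵃ} ha)
        hr = proj₂ (∨-false {writesArr c adjᵃ} ha)
        hi = proj₁ (∨-false {any (λ i → writesArr c (4 + i)) 4} hr)
        w₉ = proj₂ (∨-false {any (λ i → writesArr c (4 + i)) 4} hr)
        v= : ∀ x → x < 6 → vars τ x ≡ vars σ x
        v= x x<6 = var= same x (any-false (writesVar c) 6 hv x x<6)
        a= : ∀ i → i < 4 → arrs τ (4 + i) ≡ arrs σ (4 + i)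
        a= i i<4 = arr≡ same (4 + i) (any-false (λ i → writesArr c (4 + i)) 4 hi i i<4)

      N≤6k : N < 6 * r + 6
      N≤6k = ≤-<-trans N≤cap (+-monoʳ-< (6 * r) (n<1+n 5))

      dbl≤M : ∀ {m} → m ≤ dbl r → m ≤ M
      dbl≤M {m} m≤ = ≤6k⇒≤M (begin
        m             ≤⟨ m≤ ⟩
        dbl r         ≡⟨ trans (dbl≡+ r) (cong (r +_) (sym (+-identityʳ r))) ⟩
        2 * r         ≤⟨ *-monoˡ-≤ r (s≤s (s≤s (z≤n {4}))) ⟩
        6 * r         ≤⟨ m≤m+n (6 * r) 6 ⟩
        6 * r + 6     ∎)
        where open ≤-Reasoning

      rep-degree : ∀ {σ} → Context σ → ∀ j → j ≤ N → arrs σ degᵃ (arrs σ repᵃ j) ≡ bit (deg everything (rep j))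
      rep-degree {σ} ctx j j≤N = trans (cong (λ f → arrs σ degᵃ (f j)) (rep= ctx)) (value-at j j≤N)
        where
        value-at : ∀ j → j ≤ N → arrs σ degᵃ (rep j) ≡ bit (deg everything (rep j))
        value-at zero    _   = trans (cong (arrs σ degᵃ) rep-dummy) (trans (deg-dummy ctx)
          (sym (cong bit (trans (cong (deg everything) rep-dummy) (deg-ghost everything n ≤-refl)))))
        value-at (suc j) j≤N = deg= ctx (rep (suc j)) (rep<n (suc j) (s≤s z≤n , j≤N))

      -- For the dummy digit y the column would be n, and the address that of the first cell of the
      -- next row. The factor `0 < y` discards what is read there.
      linked-eval : ∀ {σ} e₁ e₂ {x y} → Context σ → eval σ e₁ ≡ x → eval σ e₂ ≡ y → y ≤ N →
                    eval σ (linked e₁ e₂) ≡ bit (closed table x y)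
      linked-eval {σ} e₁ e₂ {x} {zero} ctx v₁ v₂ y≤N =
        trans (cong (λ y → eval σ (closedCell (repᵃ ⁅ e₁ ⁆) (repᵃ ⁅ e₂ ⁆)) * bit (0 <ᵇ y)) v₂)
              (trans (*-zeroʳ (eval σ (closedCell (repᵃ ⁅ e₁ ⁆) (repᵃ ⁅ e₂ ⁆)))) (cong bit (sym (∧-zeroʳ (near (rep x) (rep 0))))))
      linked-eval {σ} e₁ e₂ {x} {suc y} ctx v₁ v₂ y≤N =
        trans (cong₂ _*_ (closed-eval (repᵃ ⁅ e₁ ⁆) (repᵃ ⁅ e₂ ⁆) (base ctx)
                           (trans (cong (arrs σ repᵃ) v₁) (cong (λ f → f x) (rep= ctx)))
                           (trans (cong (arrs σ repᵃ) v₂) (cong (λ f → f (suc y)) (rep= ctx)))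
                           (rep<n (suc y) (s≤s z≤n , y≤N)))
                         (cong (λ y → bit (0 <ᵇ y)) v₂))
              (mul-bit (near (rep x) (rep (suc y))) true)

      Digits≤ : (ℕ → ℕ) → Set
      Digits≤ d = ∀ m → m < dbl r → d m ≤ N

      checkBody-time : ℕ
      checkBody-time = 2 * suc r * (3 + 4)

      Prefix : (ℕ → ℕ) → ℕ → ℕ → ℕ → State → Set
      Prefix d x y m τ = vars τ zᵛ ≡ bit (par table d x m xor par table d y m)
                       × vars τ sᵛ ≡ occ table d x m × vars τ tᵛ ≡ occ table d y m

      checkBody-run : ∀ {σ} d l x y → Bounded M σ → Context σ → arrs σ digᵃ ≡ d → Digits≤ d → l < r → vars σ uᵛ ≡ l →
                      vars σ xᵛ ≡ x → vars σ yᵛ ≡ y → Prefix d x y 0 σ → Runs checkBody σ checkBody-time (Prefix d x y (dbl l))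
      checkBody-run {σ} d l x y b ctx dig d≤N l<r u= x= y= start =
        do-for (dbl l) (2 * suc r) (Prefix d x y) refl b 2l≤ (s≤s z≤n) (dbl≤M (dbl-mono-≤ (<⇒≤ l<r)))
          (λ τ same → trans (cong₂ _+_ (trans (var= same uᵛ refl) u=) (trans (var= same uᵛ refl) u=)) (sym (dbl≡+ l)))
          start body
        where
        2l≤ : dbl l ≤ 2 * suc r
        2l≤ = ≤-trans (dbl-mono-≤ (≤-trans (<⇒≤ l<r) (n≤1+n r)))
                      (≤-reflexive (trans (dbl≡+ (suc r)) (cong (suc r +_) (sym (+-identityʳ (suc r))))))
        body : ∀ m τ → m < dbl l → Bounded M τ → Same checkBody σ τ → vars τ vᵛ ≡ m → Prefix d x y m τ →
               Runs _ τ 3 (λ τ′ → Prefix d x y (suc m) (setVar vᵛ (suc m) τ′))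
        body m τ m<2l b same v= (z= , s= , t=) =
          var-then _ b
            (xor-eval τ (var zᵛ) (xorᴱ (linked (var xᵛ) (digᵃ ⁅ var vᵛ ⁆)) (linked (var yᵛ) (digᵃ ⁅ var vᵛ ⁆))) z=
              (xor-eval τ (linked (var xᵛ) (digᵃ ⁅ var vᵛ ⁆)) (linked (var yᵛ) (digᵃ ⁅ var vᵛ ⁆))
                (linked-eval (var xᵛ) (digᵃ ⁅ var vᵛ ⁆) ctxτ xτ dm (d≤N m m<2r))
                (linked-eval (var yᵛ) (digᵃ ⁅ var vᵛ ⁆) ctxτ yτ dm (d≤N m m<2r))))
            (bit≤M _) λ b →
          var-then (occ table d x (suc m)) b (cong₂ _+_ s= (cong₂ (λ p q → bit (p ≡ᵇ q)) dm xτ)) (occ≤ x) λ b →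
          do-var (occ table d y (suc m)) b (cong₂ _+_ t= (cong₂ (λ p q → bit (p ≡ᵇ q)) dm yτ)) (occ≤ y)
            (cong bit (regroup (deg everything (rep x)) (deg everything (rep y)) _ _ _ _) , refl , refl)
          where
          ctxτ = keep-context same refl ctx
          xτ : vars τ xᵛ ≡ x
          xτ = trans (var= same xᵛ refl) x=
          yτ : vars τ yᵛ ≡ y
          yτ = trans (var= same yᵛ refl) y=
          dm : arrs τ digᵃ (vars τ vᵛ) ≡ d m
          dm = trans (cong (arrs τ digᵃ) v=) (cong (λ f → f m) (trans (arr≡ same digᵃ refl) dig))
          m<2r : m < dbl r
          m<2r = <-≤-trans m<2l (dbl-mono-≤ (<⇒≤ l<r))
          occ≤ : ∀ x → occ table d x (suc m) ≤ M
          occ≤ x = dbl≤M (≤-trans (count-≤ (suc m) _) m<2r)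
          regroup : ∀ p q s t c e → ((p xor s) xor (q xor t)) xor (c xor e) ≡ (p xor (s xor c)) xor (q xor (t xor e))
          regroup p q s t c e = trans (xor-interchange (p xor s) (q xor t) c e) (cong₂ _xor_ (xor-assoc p s c) (xor-assoc q t e))

      validᵇ : (ℕ → ℕ) → ℕ → Bool
      validᵇ d l = (par table d x (dbl l) xor par table d y (dbl l)) ∧ ((occ table d x (dbl l) <ᵇ size x) ∧ (occ table d y (dbl l) <ᵇ size y))
        where
        x = d (dbl l)
        y = d (suc (dbl l))

      validᵇ-sound : ∀ d l → validᵇ d l ≡ true → ValidAt table d l
      validᵇ-sound d l e with odd , rest ← ∧-true e with left , right ← ∧-true rest = record
        { odd = odd ; left = <ᵇ⇒< (occ table d x (dbl l)) (size x) (subst T (sym left) tt)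
        ; right = <ᵇ⇒< (occ table d y (dbl l)) (size y) (subst T (sym right) tt) }
        where
        x = d (dbl l)
        y = d (suc (dbl l))

      validᵇ-complete : ∀ d l → ValidAt table d l → validᵇ d l ≡ true
      validᵇ-complete d l v = cong₂ _∧_ odd (cong₂ _∧_ (<ᵇ-true left) (<ᵇ-true right))
        where
        open ValidAt v

      Checked : (ℕ → ℕ) → ℕ → ℕ → Set
      Checked d l ok = (ok ≡ 1 × (∀ l′ → l′ < l → ValidAt table d l′)) ⊎ (ok ≡ 0 × ∃[ l′ ] l′ < r × ¬ ValidAt table d l′)

      check-time : ℕ
      check-time = suc (suc r * (5 + (checkBody-time + 2) + 4))

      check-run : ∀ {σ} d → Bounded M σ → Context σ → arrs σ digᵃ ≡ d → Digits≤ d →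
                  Runs check σ check-time (λ τ → Checked d r (vars τ okᵛ))
      check-run {σ} d b ctx dig d≤N =
        var-then 1 b refl 1≤M λ b →
        do-for r (suc r) (λ l τ → Checked d l (vars τ okᵛ)) refl b (n≤1+n r) (s≤s z≤n)
          (≤6k⇒≤M (≤-trans (m≤m+n r (5 * r)) (m≤m+n (6 * r) 6)))
          (λ τ same → trans (var= same rᵛ refl) (r= (base ctx))) (inj₁ (refl , λ _ ())) body
        where
        σ₁ = setVar okᵛ 1 σ
        ctx₁ : Context σ₁
        ctx₁ = keep-context (Same-var {okᵛ} {lit 1} {σ = σ}) refl ctx
        body : ∀ l τ → l < r → Bounded M τ → Same _ σ₁ τ → vars τ uᵛ ≡ l → Checked d l (vars τ okᵛ) →
               Runs _ τ (5 + (checkBody-time + 2)) (λ τ′ → Checked d (suc l) (vars τ′ okᵛ))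
        body l τ l<r b same u= checked =
          var-then x b dx (digit≤M x≤N) λ b →
          var-then y b dy (digit≤M y≤N) λ b →
          var-then (bit (deg everything (rep x) xor deg everything (rep y))) b
            (xor-eval (setVar yᵛ y (setVar xᵛ x τ)) (degᵃ ⁅ repᵃ ⁅ var xᵛ ⁆ ⁆) (degᵃ ⁅ repᵃ ⁅ var yᵛ ⁆ ⁆) (rep-degree {τ} ctxτ x x≤N) (rep-degree {τ} ctxτ y y≤N))
            (bit≤M _) λ b →
          var-then 0 b refl z≤n λ b →
          var-then 0 b refl z≤n λ b →
          checkBody-run d l x y b
            ctx₂
            digτ d≤N l<r u= refl refl
            (cong bit (sym (cong₂ _xor_ (xor-identityʳ (deg everything (rep x))) (xor-identityʳ (deg everything (rep y))))) , refl , refl)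
          then λ ρ b same′ (z= , s= , t=) →
          let ctxρ = keep-context same′ refl ctx₂
              size-at : ∀ v j → vars ρ v ≡ j → arrs ρ sizeᵃ (vars ρ v) ≡ size j
              size-at v j v= = trans (cong (arrs ρ sizeᵃ) v=) (cong (λ f → f j) (size= ctxρ))
          in do-if (validᵇ d l) b
            (trans (cong₂ _*_ z= (trans (cong₂ _*_
                      (cong₂ (λ p q → bit (p <ᵇ q)) s= (size-at xᵛ x (var= same′ xᵛ refl)))
                      (cong₂ (λ p q → bit (p <ᵇ q)) t= (size-at yᵛ y (var= same′ yᵛ refl))))
                    (mul-bit (occ table d x (dbl l) <ᵇ size x) (occ table d y (dbl l) <ᵇ size y))))
                   (mul-bit (par table d x (dbl l) xor par table d y (dbl l)) _))
            (λ good → do-skip b (subst (Checked d (suc l)) (sym (var= same′ okᵛ refl)) (extend-checked good checked)))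
            (λ bad → do-var 0 b refl z≤n (inj₂ (refl , l , l<r , λ v → case trans (sym bad) (validᵇ-complete d l v) of λ ())))
          where
          x = d (dbl l)
          y = d (suc (dbl l))
          2l<2r : suc (dbl l) < dbl r
          2l<2r = dbl-mono-≤ l<r
          x≤N : x ≤ N
          x≤N = d≤N (dbl l) (<⇒≤ 2l<2r)
          y≤N : y ≤ N
          y≤N = d≤N (suc (dbl l)) 2l<2r
          digit≤M : ∀ {j} → j ≤ N → j ≤ M
          digit≤M j≤N = ≤6k⇒≤M (≤-trans j≤N (<⇒≤ N≤6k))
          ctxτ : Context τ
          ctxτ = keep-context same refl ctx₁
          zval = bit (deg everything (rep x) xor deg everything (rep y))
          ctx₂ : Context (setVar tᵛ 0 (setVar sᵛ 0 (setVar zᵛ zval (setVar yᵛ y (setVar xᵛ x τ)))))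
          ctx₂ = record
            { base = record { n= = n= (base ctxτ) ; r= = r= (base ctxτ) ; cells = cells (base ctxτ) }
            ; N= = N= ctxτ ; D= = D= ctxτ ; item= = item= ctxτ ; rank= = rank= ctxτ ; rep= = rep= ctxτ ; size= = size= ctxτ
            ; deg= = deg= ctxτ ; deg-dummy = deg-dummy ctxτ }
          digτ : arrs τ digᵃ ≡ d
          digτ = trans (arr≡ same digᵃ refl) dig
          2l= : vars τ uᵛ + vars τ uᵛ ≡ dbl l
          2l= = trans (cong₂ _+_ u= u=) (sym (dbl≡+ l))
          dx : arrs τ digᵃ (vars τ uᵛ + vars τ uᵛ) ≡ x
          dx = trans (cong (arrs τ digᵃ) 2l=) (cong (λ f → f (dbl l)) digτ)
          dy : arrs τ digᵃ (vars τ uᵛ + vars τ uᵛ + 1) ≡ y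
          dy = trans (cong (arrs τ digᵃ) (trans (+-comm _ 1) (cong suc 2l=))) (cong (λ f → f (suc (dbl l))) digτ)
          extend-checked : ∀ {ok} → validᵇ d l ≡ true → Checked d l ok → Checked d (suc l) ok
          extend-checked good (inj₂ bad) = inj₂ bad
          extend-checked good (inj₁ (e , all)) = inj₁ (e , λ l′ l′<1+l → case <-suc l′<1+l of λ
            { (inj₁ l′<l) → all l′ l′<l ; (inj₂ refl) → validᵇ-sound d l good })

      b : ℕ
      b = suc N

      -- After l steps the first l digits, together with the carry, represent the
      -- successor of the number represented by the first l digits of d.
      record Carried (d : ℕ → ℕ) (l : ℕ) (carry : Bool) (d′ : ℕ → ℕ) : Set where
        field
          total : value l d′ + bit carry * b ^ l ≡ value l d + 1
          later : ∀ m → l ≤ m → d′ m ≡ d m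
          small : Digits≤ d′

      Incremented : (ℕ → ℕ) → ℕ → State → Set
      Incremented d l τ = ∃[ carry ] vars τ goᵛ ≡ bit carry × Carried d l carry (arrs τ digᵃ)

      increment-time : ℕ
      increment-time = suc (suc (2 * r) * (4 + 4) + 1)

      Next : (ℕ → ℕ) → State → Set
      Next d τ = Digits≤ (arrs τ digᵃ) × ((vars τ goᵛ ≡ 1 × value (dbl r) (arrs τ digᵃ) ≡ suc (value (dbl r) d))
                                         ⊎ (vars τ goᵛ ≡ 0 × b ^ dbl r ≤ suc (value (dbl r) d)))

      increment-run : ∀ {σ} d → Bounded M σ → Context σ → arrs σ digᵃ ≡ d → Digits≤ d →
                      Runs increment σ increment-time (Next d)
      increment-run {σ} d bd ctx dig d≤N =
        var-then 1 bd refl 1≤M λ bd →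
        do-for (dbl r) (suc (2 * r)) (Incremented d) refl bd 2r≤ (s≤s z≤n) (dbl≤M ≤-refl)
          (λ τ same → trans (var= same Dᵛ refl) (D= ctx))
          (true , refl , record { total = refl ; later = λ m _ → cong (λ f → f m) dig ; small = λ m m< → subst (_≤ N) (sym (cong (λ f → f m) dig)) (d≤N m m<) })
          (λ l τ l<D bd same u= (carry , go= , carried) → body l τ l<D bd (keep-context same refl ctx₁) u= carry go= carried)
        then λ τ bd same (carry , go= , carried) →
        do-var (bit (not carry)) bd (trans (cong (λ x → bit (x ≡ᵇ 0)) go=) (not-bit carry)) (bit≤M _) (finish carry carried)
        where
        2r≤ : dbl r ≤ suc (2 * r)
        2r≤ = ≤-trans (≤-reflexive (trans (dbl≡+ r) (cong (r +_) (sym (+-identityʳ r))))) (n≤1+n _)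
        ctx₁ : Context (setVar goᵛ 1 σ)
        ctx₁ = keep-context (Same-var {goᵛ} {lit 1} {σ = σ}) refl ctx
        finish : ∀ carry {d′} → Carried d (dbl r) carry d′ →
          Digits≤ d′ × ((bit (not carry) ≡ 1 × value (dbl r) d′ ≡ suc (value (dbl r) d))
                       ⊎ (bit (not carry) ≡ 0 × b ^ dbl r ≤ suc (value (dbl r) d)))
        finish false {d′} c = Carried.small c , inj₁ (refl , trans (sym (+-identityʳ _)) (trans (Carried.total c) (+-comm _ 1)))
        finish true  {d′} c = Carried.small c , inj₂ (refl , (begin
          b ^ dbl r                       ≡⟨ sym (*-identityˡ (b ^ dbl r)) ⟩
          1 * b ^ dbl r                   ≤⟨ m≤n+m _ (value (dbl r) d′) ⟩
          value (dbl r) d′ + 1 * b ^ dbl r ≡⟨ Carried.total c ⟩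
          value (dbl r) d + 1             ≡⟨ +-comm _ 1 ⟩
          suc (value (dbl r) d)           ∎))
          where open ≤-Reasoning
        body : ∀ l τ → l < dbl r → Bounded M τ → Context τ → vars τ uᵛ ≡ l → ∀ carry → vars τ goᵛ ≡ bit carry →
               Carried d l carry (arrs τ digᵃ) → Runs _ τ 4 (λ τ′ → Incremented d (suc l) (setVar uᵛ (suc l) τ′))
        body l τ l<D bd ctx u= carry go= c =
          do-if carry bd go= (λ e → carrying (trans go= (cong bit e)) (subst (λ c → Carried d l c d′) e c)) (λ e → slower (s≤s z≤n) (do-skip bd (carry-done e)))
          where
          open Carried c
          d′ : ℕ → ℕ
          d′ = arrs τ digᵃ
          at-l : d′ l ≡ d l
          at-l = later l ≤-refl
          carry-done : carry ≡ false → Incremented d (suc l) (setVar uᵛ (suc l) τ)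
          carry-done refl = false , go= , record
            { total = begin
                value l d′ + d′ l * b ^ l + 0     ≡⟨ +-identityʳ _ ⟩
                value l d′ + d′ l * b ^ l         ≡⟨ cong₂ _+_ (trans (sym (+-identityʳ _)) total) (cong (_* b ^ l) at-l) ⟩
                value l d + 1 + d l * b ^ l       ≡⟨ move (value l d) (d l * b ^ l) ⟩
                value l d + d l * b ^ l + 1       ∎
            ; later = λ m l<m → later m (<⇒≤ l<m) ; small = small }
            where
            open ≡-Reasoning
            move : ∀ p q → p + 1 + q ≡ p + q + 1
            move = solve-∀
          carrying : vars τ goᵛ ≡ 1 → Carried d l true d′ →
            Runs (digᵃ ⁅ var uᵛ ⁆:= (digᵃ ⁅ var uᵛ ⁆) +ᴱ lit 1 ⨾ branch (var Nᵛ <ᴱ digᵃ ⁅ var uᵛ ⁆) (digᵃ ⁅ var uᵛ ⁆:= lit 0) (goᵛ := lit 0))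
                 τ 3 (λ τ′ → Incremented d (suc l) (setVar uᵛ (suc l) τ′))
          carrying go≡1 c₁ = arr-then l (suc (d l)) bd u= (trans (+-comm _ 1) (cong suc (trans (cong d′ u=) at-l)))
              (≤6k⇒≤M (≤-trans (s≤s (d≤N l l<D)) N≤6k)) λ bd →
            do-if (N <ᵇ suc (d l)) bd (cong₂ (λ p q → bit (p <ᵇ q)) (N= ctx) (trans (cong (update d′ l (suc (d l))) u=) (array-at d′ {l} (suc (d l)))))
              (λ over → do-arr l 0 bd u= refl z≤n (true , go≡1 , wrap over))
              (λ under → do-var 0 bd refl z≤n (false , refl , stop under))
            where
            wrap : (N <ᵇ suc (d l)) ≡ true → Carried d (suc l) true (update (update d′ l (suc (d l))) l 0)
            wrap over = record { total = total′ ; later = later′ ; small = small′ }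
              where
              d″ = update (update d′ l (suc (d l))) l 0
              off : ∀ m → m ≢ l → d″ m ≡ d′ m
              off m m≢l = trans (array-off (update d′ l (suc (d l))) {l} {m} 0 m≢l) (array-off d′ {l} {m} (suc (d l)) m≢l)
              at : d″ l ≡ 0
              at = array-at (update d′ l (suc (d l))) {l} 0
              dl≡N : d l ≡ N
              dl≡N = ≤-antisym (d≤N l l<D) (s≤s⁻¹ (<ᵇ⇒< N (suc (d l)) (subst T (sym over) tt)))
              later′ : ∀ m → suc l ≤ m → d″ m ≡ d m
              later′ m l<m = trans (off m λ { refl → <-irrefl refl l<m }) (Carried.later c₁ m (<⇒≤ l<m))
              small′ : Digits≤ d″
              small′ m m< with m ≟ l
              ... | yes refl = ≤-trans (≤-reflexive at) z≤n
              ... | no m≢l   = ≤-trans (≤-reflexive (off m m≢l)) (Carried.small c₁ m m<)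
              total′ : value l d″ + d″ l * b ^ l + 1 * b ^ suc l ≡ value l d + d l * b ^ l + 1
              total′ = begin
                value l d″ + d″ l * b ^ l + 1 * (b * b ^ l)
                  ≡⟨ cong₂ (λ p q → p + q * b ^ l + 1 * (b * b ^ l)) (value-cong l λ i i<l → off i (<⇒≢ i<l)) at ⟩
                value l d′ + 0 + 1 * (b * b ^ l)  ≡⟨ rearrange (value l d′) N (b ^ l) ⟩
                (value l d′ + 1 * b ^ l) + N * b ^ l ≡⟨ cong₂ (λ p q → p + q * b ^ l) (Carried.total c₁) (sym dl≡N) ⟩
                value l d + 1 + d l * b ^ l       ≡⟨ move (value l d) (d l * b ^ l) ⟩
                value l d + d l * b ^ l + 1       ∎
                where
                open ≡-Reasoning
                rearrange : ∀ v N p → v + 0 + 1 * (suc N * p) ≡ (v + 1 * p) + N * p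
                rearrange = solve-∀
                move : ∀ p q → p + 1 + q ≡ p + q + 1
                move = solve-∀
            stop : (N <ᵇ suc (d l)) ≡ false → Carried d (suc l) false (update d′ l (suc (d l)))
            stop under = record { total = total′ ; later = later′ ; small = small′ }
              where
              d″ = update d′ l (suc (d l))
              off : ∀ m → m ≢ l → d″ m ≡ d′ m
              off m m≢l = array-off d′ {l} {m} (suc (d l)) m≢l
              at : d″ l ≡ suc (d l)
              at = array-at d′ {l} (suc (d l))
              later′ : ∀ m → suc l ≤ m → d″ m ≡ d m
              later′ m l<m = trans (off m λ { refl → <-irrefl refl l<m }) (Carried.later c₁ m (<⇒≤ l<m))
              small′ : Digits≤ d″
              small′ m m< with m ≟ l
              ... | yes refl = ≤-trans (≤-reflexive at) (≮⇒≥ λ N<1+d → subst T under (<⇒<ᵇ N<1+d))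
              ... | no m≢l   = ≤-trans (≤-reflexive (off m m≢l)) (Carried.small c₁ m m<)
              total′ : value l d″ + d″ l * b ^ l + 0 * b ^ suc l ≡ value l d + d l * b ^ l + 1
              total′ = begin
                value l d″ + d″ l * b ^ l + 0     ≡⟨ +-identityʳ _ ⟩
                value l d″ + d″ l * b ^ l
                  ≡⟨ cong₂ (λ p q → p + q * b ^ l) (value-cong l λ i i<l → off i (<⇒≢ i<l)) at ⟩
                value l d′ + suc (d l) * b ^ l    ≡⟨ rearrange (value l d′) (d l) (b ^ l) ⟩
                (value l d′ + 1 * b ^ l) + d l * b ^ l ≡⟨ cong (_+ d l * b ^ l) (Carried.total c₁) ⟩
                value l d + 1 + d l * b ^ l       ≡⟨ move (value l d) (d l * b ^ l) ⟩
                value l d + d l * b ^ l + 1       ∎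
                where
                open ≡-Reasoning
                rearrange : ∀ v x p → v + suc x * p ≡ (v + 1 * p) + x * p
                rearrange = solve-∀
                move : ∀ p q → p + 1 + q ≡ p + q + 1
                move = solve-∀

      Searched : (ℕ → ℕ) → Set
      Searched d = ∀ d′ → Digits≤ d′ → value (dbl r) d′ < value (dbl r) d → ¬ Valid table d′

      -- Sequences of equal value agree only below `dbl r`; validity inspects no other digits.
      Valid-cong : ∀ {d d′} → (∀ m → m < dbl r → d m ≡ d′ m) → Valid table d → Valid table d′
      Valid-cong {d} {d′} same valid l l<r = validᵇ-sound d′ l (trans (sym same-check) (validᵇ-complete d l (valid l l<r)))
        where
        2l<2r : suc (dbl l) < dbl r
        2l<2r = dbl-mono-≤ l<r
        below : ∀ m → m < dbl l → d m ≡ d′ m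
        below m m<2l = same m (<-trans m<2l (<⇒≤ 2l<2r))
        par-cong : ∀ x → par table d x (dbl l) ≡ par table d′ x (dbl l)
        par-cong x = cong (deg everything (rep x) xor_) (⨁-cong (dbl l) λ m m< → cong (closed table x) (below m m<))
        occ-cong : ∀ x → occ table d x (dbl l) ≡ occ table d′ x (dbl l)
        occ-cong x = count-cong (dbl l) λ m m< → cong (_≡ᵇ x) (below m m<)
        same-check : validᵇ d l ≡ validᵇ d′ l
        same-check rewrite same (dbl l) (<⇒≤ 2l<2r) | same (suc (dbl l)) 2l<2r
          | par-cong (d′ (dbl l)) | par-cong (d′ (suc (dbl l))) | occ-cong (d′ (dbl l)) | occ-cong (d′ (suc (dbl l))) = refl

      Result : State → Set
      Result τ = Digits≤ (arrs τ digᵃ) ×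
                 ((vars τ okᵛ ≡ 1 × Valid table (arrs τ digᵃ)) ⊎ (vars τ okᵛ ≡ 0 × (∀ d → Digits≤ d → ¬ Valid table d)))

      iteration-time : ℕ
      iteration-time = check-time + suc (suc increment-time)

      enumerate-time : ℕ
      enumerate-time = suc (b ^ dbl r * (iteration-time + 1) + 1)

      enumerate-run : ∀ {σ} → Bounded M σ → Context σ → (∀ m → arrs σ digᵃ m ≡ 0) → Runs enumerate σ enumerate-time (λ τ → Result τ)
      enumerate-run {σ} bd ctx zeros =
        var-then 1 bd refl 1≤M λ bd →
        search (b ^ dbl r) (setVar goᵛ 1 σ) bd (keep-context (Same-var {goᵛ} {lit 1} {σ = σ}) refl ctx) refl
          (λ m _ → ≤-trans (≤-reflexive (zeros m)) z≤n)
          (m≤n+m (b ^ dbl r) (value (dbl r) (arrs σ digᵃ)))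
          (λ d′ _ lt → case subst (value (dbl r) d′ <_) (value-zero (dbl r)) lt of λ ())
        where
        value-zero : ∀ m → value m (arrs σ digᵃ) ≡ 0
        value-zero zero    = refl
        value-zero (suc m) = cong₂ (λ p q → p + q * b ^ m) (value-zero m) (zeros m)
        covered : ∀ d → Digits≤ d → ¬ Valid table d → Searched d →
                  ∀ d′ → Digits≤ d′ → value (dbl r) d′ ≤ value (dbl r) d → ¬ Valid table d′
        covered d d≤N ¬valid searched d′ d′≤N le with m≤n⇒m<n∨m≡n le
        ... | inj₁ lt = searched d′ d′≤N lt
        ... | inj₂ eq = λ valid → ¬valid (Valid-cong (value-injective (dbl r) d′≤N d≤N eq) valid)
        loopBody : Cmd
        loopBody = check ⨾ branch (var okᵛ) (goᵛ := lit 0) increment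
        Iterated : (ℕ → ℕ) → State → Set
        Iterated d τ = Digits≤ (arrs τ digᵃ) ×
          ( (vars τ goᵛ ≡ 0 × ((vars τ okᵛ ≡ 1 × Valid table (arrs τ digᵃ)) ⊎ (vars τ okᵛ ≡ 0 × (∀ d′ → Digits≤ d′ → ¬ Valid table d′))))
          ⊎ (vars τ goᵛ ≡ 1 × value (dbl r) (arrs τ digᵃ) ≡ suc (value (dbl r) d) × Searched (arrs τ digᵃ)) )
        iterate : ∀ τ → Bounded M τ → Context τ → Digits≤ (arrs τ digᵃ) → Searched (arrs τ digᵃ) →
                  Runs loopBody τ iteration-time (Iterated (arrs τ digᵃ))
        iterate τ bd ctx d≤N searched =
          check-run δ bd ctx refl d≤N then λ ρ bd same checked →
          do-branch bd (accept ρ bd same checked) (reject ρ bd same checked)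
          where
          δ = arrs τ digᵃ
          accept : ∀ ρ → Bounded M ρ → Same check τ ρ → Checked δ r (vars ρ okᵛ) → vars ρ okᵛ ≢ 0 →
                   Runs (goᵛ := lit 0) ρ (suc increment-time) (Iterated δ)
          accept ρ bd same (inj₂ (ok≡0 , _)) ok≢0 = ⊥-elim (ok≢0 ok≡0)
          accept ρ bd same (inj₁ (ok≡1 , valid)) _ = slower (s≤s z≤n) (do-var 0 bd refl z≤n
            ( subst Digits≤ (sym (arr≡ same digᵃ refl)) d≤N
            , inj₁ (refl , inj₁ (ok≡1 , subst (Valid table) (sym (arr≡ same digᵃ refl)) valid)) ))
          reject : ∀ ρ → Bounded M ρ → Same check τ ρ → Checked δ r (vars ρ okᵛ) → vars ρ okᵛ ≡ 0 →
                   Runs increment ρ (suc increment-time) (Iterated δ)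
          reject ρ bd same (inj₁ (ok≡1 , _)) ok≡0 = case trans (sym ok≡1) ok≡0 of λ ()
          reject ρ bd same (inj₂ (_ , l , l<r , bad)) ok≡0 =
            weaken (n≤1+n _) done (increment-run δ bd (keep-context same refl ctx) (arr≡ same digᵃ refl) d≤N)
            where
            ruled-out : ∀ d′ → Digits≤ d′ → value (dbl r) d′ ≤ value (dbl r) δ → ¬ Valid table d′
            ruled-out = covered δ d≤N (λ valid → bad (valid l l<r)) searched
            done : ∀ ρ′ → Bounded M ρ′ → Same increment ρ ρ′ → Next δ ρ′ → Iterated δ ρ′
            done ρ′ _ same′ (d′≤N , inj₁ (go≡1 , eq)) = d′≤N , inj₂ (go≡1 , eq ,
              λ d″ d″≤N lt → ruled-out d″ d″≤N (s≤s⁻¹ (subst (value (dbl r) d″ <_) eq lt)))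
            done ρ′ _ same′ (d′≤N , inj₂ (go≡0 , full)) = d′≤N , inj₁ (go≡0 , inj₂ (trans (var= same′ okᵛ refl) ok≡0 ,
              λ d″ d″≤N → ruled-out d″ d″≤N (s≤s⁻¹ (≤-trans (value< (dbl r) d″≤N) full))))
        search : ∀ fuel τ → Bounded M τ → Context τ → vars τ goᵛ ≡ 1 → Digits≤ (arrs τ digᵃ) →
                 b ^ dbl r ≤ value (dbl r) (arrs τ digᵃ) + fuel → Searched (arrs τ digᵃ) →
                 Runs (while (var goᵛ) loopBody) τ (fuel * (iteration-time + 1) + 1) Result
        -- The current value plus the fuel is at least the number of all sequences, and each step
        -- moves one unit from the fuel to the value. So the fuel cannot run out while the value is
        -- still that of a sequence.
        search zero τ bd ctx go≡1 d≤N enough searched =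
          ⊥-elim (<⇒≱ (value< (dbl r) d≤N) (≤-trans enough (≤-reflexive (+-identityʳ _))))
        search (suc fuel) τ bd ctx go≡1 d≤N enough searched =
          slower (≤-reflexive (arith iteration-time (fuel * (iteration-time + 1))))
            (while-step bd (λ go≡0 → case trans (sym go≡1) go≡0 of λ ()) (iterate τ bd ctx d≤N searched) continue)
          where
          arith : ∀ t x → suc (t + (x + 1)) ≡ t + 1 + x + 1
          arith = solve-∀
          continue : ∀ ρ → Bounded M ρ → Same loopBody τ ρ → Iterated (arrs τ digᵃ) ρ →
                     Runs (while (var goᵛ) loopBody) ρ (fuel * (iteration-time + 1) + 1) Result
          continue ρ bd same (d′≤N , inj₁ (go≡0 , outcome)) = slower (m≤n+m 1 _) (while-stop bd go≡0 (d′≤N , outcome))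
          continue ρ bd same (d′≤N , inj₂ (go≡1 , eq , searched′)) =
            search fuel ρ bd (keep-context same refl ctx) go≡1 d′≤N
              (≤-trans enough (≤-reflexive (trans (+-suc _ fuel) (cong (_+ fuel) (sym eq))))) searched′

      output-time : ℕ
      output-time = n * (suc (suc (suc r * (2 + 4))) + 4)

      output-run : ∀ {σ} d → Bounded M σ → Context σ → arrs σ digᵃ ≡ d → (∀ v → arrs σ outᵃ v ≡ 0) →
                   Runs output σ output-time (λ τ → ∀ v → v < n → arrs τ outᵃ v ≡ classOf table d v)
      output-run {σ} d bd ctx dig zeros =
        weaken ≤-refl (λ τ _ _ (done , _) → done)
          (do-for n n Inv refl bd ≤-refl 1≤n (≤n⇒≤M ≤-refl) (λ τ same → trans (var= same nᵛ refl) (n= (base ctx)))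
            ((λ v ()) , λ v _ → zeros v) body)
        where
        Inv : ℕ → State → Set
        Inv u τ = (∀ v → v < u → arrs τ outᵃ v ≡ classOf table d v) × (∀ v → u ≤ v → arrs τ outᵃ v ≡ 0)
        body : ∀ u τ → u < n → Bounded M τ → Same output σ τ → vars τ uᵛ ≡ u → Inv u τ →
               Runs _ τ (suc (suc (suc r * (2 + 4)))) (λ τ′ → Inv (suc u) (setVar uᵛ (suc u) τ′))
        body u τ u<n bd same u= (done , todo) = do-branch bd
          (λ item≢0 → var-then 0 bd refl z≤n λ bd →
            weaken ≤-refl (λ ρ _ same′ inner → finish ρ inner)
              (do-for r (suc r) Inner refl bd (n≤1+n r) (s≤s z≤n) (dbl≤M (≤-trans (m≤m+n r r) (≤-reflexive (sym (dbl≡+ r)))))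
                (λ ρ same′ → trans (var= same′ rᵛ refl) (r= (base ctxτ)))
                (refl , todo u ≤-refl , λ v _ → refl)
                (λ l ρ l<r bd same′ v= inner → step l ρ l<r bd
                   (keep-context same′ refl (keep-context (Same-var {sᵛ} {lit 0} {σ = τ}) refl ctxτ))
                   (trans (arr≡ same′ digᵃ refl) digτ) (trans (var= same′ uᵛ refl) u=) v= (positive item≢0) inner)))
          (λ item≡0 → slower (s≤s z≤n) (do-skip bd (skipped item≡0)))
          where
          i = item u
          ctxτ : Context τ
          ctxτ = keep-context same refl ctx
          digτ : arrs τ digᵃ ≡ d
          digτ = trans (arr≡ same digᵃ refl) dig
          item-u : arrs τ itemᵃ (vars τ uᵛ) ≡ i
          item-u = trans (cong (arrs τ itemᵃ) u=) (cong (λ f → f u) (item= ctxτ))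
          positive : arrs τ itemᵃ (vars τ uᵛ) ≢ 0 → (0 <ᵇ i) ≡ true
          positive ≢0 with item u | item-u
          ... | zero  | e = ⊥-elim (≢0 e)
          ... | suc _ | _ = refl
          Inner : ℕ → State → Set
          Inner l ρ = vars ρ sᵛ ≡ occ table d i (dbl l)
                    × arrs ρ outᵃ u ≡ count l (λ l → removed table d (dbl (suc l)) u)
                    × (∀ v → v ≢ u → arrs ρ outᵃ v ≡ arrs τ outᵃ v)
          step : ∀ l ρ → l < r → Bounded M ρ → Context ρ → arrs ρ digᵃ ≡ d → vars ρ uᵛ ≡ u → vars ρ vᵛ ≡ l → (0 <ᵇ i) ≡ true → Inner l ρ →
                 Runs _ ρ 2 (λ ρ′ → Inner (suc l) (setVar vᵛ (suc l) ρ′))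
          step l ρ l<r bd ctx dig u= v= pos (s= , out= , others) =
            var-then (occ table d i (dbl (suc l))) bd
              (cong₂ _+_ (cong₂ _+_ s= (cong₂ (λ p q → bit (p ≡ᵇ q)) (trans (cong (arrs ρ digᵃ) 2l=) (cong (λ f → f (dbl l)) dig)) iρ))
                         (cong₂ (λ p q → bit (p ≡ᵇ q)) (trans (cong (arrs ρ digᵃ) (trans (+-comm _ 1) (cong suc 2l=))) (cong (λ f → f (suc (dbl l))) dig)) iρ))
              (dbl≤M (≤-trans (count-≤ (dbl (suc l)) _) (dbl-mono-≤ l<r))) λ bd →
            do-arr u (count (suc l) (λ l → removed table d (dbl (suc l)) u)) bd u=
              (cong₂ _+_ (trans (cong (arrs ρ outᵃ) u=) out=)
                 (cong bit (trans (cong (_<ᵇ occ table d i (dbl (suc l))) (trans (cong (arrs ρ rankᵃ) u=) (cong (λ f → f u) (rank= ctx))))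
                                  (sym (cong (_∧ (rank u <ᵇ occ table d i (dbl (suc l)))) pos)))))
              (dbl≤M (≤-trans (count-≤ (suc l) _) (≤-trans l<r (≤-trans (m≤m+n r r) (≤-reflexive (sym (dbl≡+ r)))))))
              ( refl , array-at (arrs ρ outᵃ) {u} _ , λ v v≢u → trans (array-off (arrs ρ outᵃ) {u} {v} _ v≢u) (others v v≢u) )
            where
            2l= : vars ρ vᵛ + vars ρ vᵛ ≡ dbl l
            2l= = trans (cong₂ _+_ v= v=) (sym (dbl≡+ l))
            iρ : arrs ρ itemᵃ (vars ρ uᵛ) ≡ i
            iρ = trans (cong (arrs ρ itemᵃ) u=) (cong (λ f → f u) (item= ctx))
          finish : ∀ ρ → Inner r ρ → Inv (suc u) (setVar uᵛ (suc u) ρ)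
          finish ρ (_ , out= , others) =
            (λ v v<1+u → case <-suc v<1+u of λ { (inj₁ v<u) → trans (others v (<⇒≢ v<u)) (done v v<u) ; (inj₂ refl) → out= })
            , λ v u<v → trans (others v λ { refl → <-irrefl refl u<v }) (todo v (<⇒≤ u<v))
          skipped : arrs τ itemᵃ (vars τ uᵛ) ≡ 0 → Inv (suc u) (setVar uᵛ (suc u) τ)
          skipped item≡0 =
            (λ v v<1+u → case <-suc v<1+u of λ { (inj₁ v<u) → done v v<u ; (inj₂ refl) → trans (todo v ≤-refl) (sym none) })
            , λ v u<v → todo v (<⇒≤ u<v)
            where
            none : classOf table d u ≡ 0
            none = count-zero r λ l _ → cong (λ j → (0 <ᵇ j) ∧ (rank u <ᵇ occ table d i (dbl (suc l)))) (trans (sym item-u) item≡0)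

    -- The phases put together

    σ₀ : State
    σ₀ = input G (suc r)

    σ₁ : State
    σ₁ = setArr sizeᵃ 0 (suc (dbl r)) (setArr repᵃ 0 n (setVar capᵛ (6 * r + 5) (setVar Dᵛ (dbl r) (setVar rᵛ r σ₀))))

    r≤6k : r ≤ 6 * r + 6
    r≤6k = ≤-trans (m≤m+n r (5 * r)) (m≤m+n (6 * r) 6)

    input-bounded : Bounded M σ₀
    input-bounded = record
      { var≤ = λ x → if-≤ (x ≡ᵇ 0) (<⇒≤ n<M) (if-≤ (x ≡ᵇ 1) (≤6k⇒≤M k≤6k) z≤n)
      ; arr≤ = λ x i → array-bound x i (x ≡ᵇ 0) }
      where
      k≤6k : suc r ≤ 6 * r + 6
      k≤6k = ≤-trans (≤-reflexive (+-comm 1 r)) (+-mono-≤ (m≤m+n r (5 * r)) (s≤s z≤n))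
      cell≤1 : ∀ m → adjacencyMatrix G m ≤ 1
      cell≤1 m with m <? n * n
      ... | no _  = z≤n
      ... | yes _ = bit≤1 _
      array-bound : ∀ x i p → (if p then adjacencyMatrix G else (λ _ → 0)) i ≤ M
      array-bound x i true  = ≤-trans (cell≤1 i) 1≤M
      array-bound x i false = z≤n

    base₁ : Base σ₁
    base₁ = record { n= = refl ; r= = refl ; cells = matrix-cell }

    initialise-run : Runs initialise σ₀ 5 (_≡ σ₁)
    initialise-run =
      var-then r input-bounded refl (≤6k⇒≤M r≤6k) λ bd →
      var-then (dbl r) bd (sym (dbl≡+ r)) 2r≤M λ bd →
      var-then (6 * r + 5) bd refl (≤6k⇒≤M (+-monoʳ-≤ (6 * r) (n≤1+n 5))) λ bd →
      arr-then 0 n bd refl refl (<⇒≤ n<M) λ bd →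
      do-arr 0 (suc (dbl r)) bd refl (+-comm (dbl r) 1) 2r<M refl
      where
      2r<6k : dbl r < 6 * r + 6
      2r<6k = begin-strict
        dbl r         ≡⟨ trans (dbl≡+ r) (cong (r +_) (sym (+-identityʳ r))) ⟩
        2 * r         ≤⟨ *-monoˡ-≤ r (s≤s (s≤s (z≤n {4}))) ⟩
        6 * r         <⟨ ≤-reflexive (+-comm 1 (6 * r)) ⟩
        6 * r + 1     ≤⟨ +-monoʳ-≤ (6 * r) (s≤s z≤n) ⟩
        6 * r + 6     ∎
        where open ≤-Reasoning
      2r≤M : dbl r ≤ M
      2r≤M = ≤6k⇒≤M (<⇒≤ 2r<6k)
      2r<M : suc (dbl r) ≤ M
      2r<M = ≤6k⇒≤M 2r<6k

    search-run : ∀ {σ} Y (table : Table (6 * r + 5) r Y (vars σ Nᵛ) (arrs σ itemᵃ) (arrs σ rankᵃ) (arrs σ repᵃ) (arrs σ sizeᵃ)) →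
      Bounded M σ → SearchPhase.Context Y table σ →
      (∀ m → arrs σ digᵃ m ≡ 0) → (∀ v → arrs σ outᵃ v ≡ 0) → Outcome r Y → count n Y ≤ 2 * r →
      Runs (enumerate ⨾ output ⨾ nᵛ := var okᵛ) σ ((search-bound r) + (n * (suc (suc (suc r * 6)) + 4) + 1)) (Correct G (suc r))
    search-run {σ} Y table bd ctx digits outs outcome few =
      slower-search (enumerate-run bd ctx digits) then λ τ bd same (small , result) →
      output-run (arrs τ digᵃ) bd (keep-context same refl ctx) refl (λ v → trans (arr= same outᵃ refl v) (outs v)) then λ ρ bd same′ classes →
      finish τ ρ bd (var= same′ okᵛ refl) classes small result
      where
      open SearchPhase Y table
      slower-search : ∀ {Q} → Runs enumerate σ enumerate-time Q → Runs enumerate σ (search-bound r) Q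
      slower-search = slower (s≤s (+-monoˡ-≤ 1 (*-monoˡ-≤ (iteration-bound r + 1) (^-monoˡ-≤ (dbl r) b≤))))
        where
        b≤ : suc (vars σ Nᵛ) ≤ 6 * suc r
        b≤ = ≤-trans N≤6k (≤-reflexive (trans (+-comm (6 * r) 6) (sym (*-suc 6 r))))
      finish : ∀ τ ρ → Bounded M ρ → vars ρ okᵛ ≡ vars τ okᵛ → (∀ v → v < n → arrs ρ outᵃ v ≡ classOf table (arrs τ digᵃ) v) →
               Digits≤ (arrs τ digᵃ) →
               (vars τ okᵛ ≡ 1 × Valid table (arrs τ digᵃ)) ⊎ (vars τ okᵛ ≡ 0 × (∀ d → Digits≤ d → ¬ Valid table d)) →
               Runs (nᵛ := var okᵛ) ρ 1 (Correct G (suc r))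
      finish τ ρ bd ok= classes small (inj₁ (ok≡1 , valid)) =
        do-var 1 bd (trans ok= ok≡1) 1≤M (inj₂ (refl , P , good , λ v → trans (classes (toℕ v) (toℕ<n v)) (named v)))
        where
        sound = Soundness.good-classes table (arrs τ digᵃ) small valid
        partition = classes⇒partition r 1≤n (classOf table (arrs τ digᵃ)) (proj₁ sound) (proj₂ sound)
        P = proj₁ partition
        good = proj₁ (proj₂ partition)
        named = proj₂ (proj₂ partition)
      finish τ ρ bd ok= classes small (inj₂ (ok≡0 , none)) =
        do-var 0 bd (trans ok= ok≡0) z≤n (inj₁ (refl , λ (P , good) →
          let d , d≤N , valid = digits-exist table outcome few (partition⇒chain r P good)
          in none d (λ m _ → d≤N m) valid))

    algorithm-run : Runs algorithm σ₀ (total-time n r) (Correct G (suc r))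
    algorithm-run = initialise-run then λ { _ bd _ refl →
      degrees-run bd base₁ then λ τ bd same (degrees , dummy) →
      greedy-run bd (keep same refl refl base₁) (λ v v<n → proj₁ (degrees v v<n)) (arr= same remᵃ refl) then λ ρ bd same′ result →
      let Y = GreedyResult.Y result
          same″ : Same (computeDegrees ⨾ greedy) σ₁ ρ
          same″ = Same-trans (Same-ˡ {computeDegrees} {greedy} same) (Same-ʳ {computeDegrees} {greedy} same′)
      in ClassifyPhase.classify-run Y bd
           (record { base = keep same″ refl refl base₁ ; cap= = var= same″ capᵛ refl })
           (GreedyResult.rem= result) (GreedyResult.few result) (var= same″ Nᵛ refl)
           (arr= same″ itemᵃ refl) (arr= same″ repᵃ refl 0)
           (≤-reflexive (sym (arr= same″ sizeᵃ refl 0)))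
           (λ { (suc j) _ → arr= same″ sizeᵃ refl (suc j) })
      then λ π bd same₃ table →
      let same₄ : Same ((computeDegrees ⨾ greedy) ⨾ classify) σ₁ π
          same₄ = Same-trans (Same-ˡ {computeDegrees ⨾ greedy} {classify} same″) (Same-ʳ {computeDegrees ⨾ greedy} {classify} same₃)
          same₅ : Same (greedy ⨾ classify) τ π
          same₅ = Same-trans (Same-ˡ {greedy} {classify} same′) (Same-ʳ {greedy} {classify} same₃)
      in search-run Y table bd
           (record { base = keep same₄ refl refl base₁ ; N= = refl ; D= = var= same₄ Dᵛ refl
                   ; item= = refl ; rank= = refl ; rep= = refl ; size= = refl
                   ; deg= = λ v v<n → trans (arr= same₅ degᵃ refl v) (proj₂ (degrees v v<n))
                   ; deg-dummy = trans (arr= same₅ degᵃ refl n) dummy })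
           (arr= same₄ digᵃ refl) (arr= same₄ outᵃ refl) (GreedyResult.outcome result) (GreedyResult.few result) }

-- The final time bound and the word size

time : ℕ → ℕ → ℕ
time n k = 500 * (k ^ 2 * n ^ 2 + (6 * k) ^ (2 * k))

-- An inequality stated as an identity for the ring solver: the summand in parentheses is the slack.
-- Writing n as m + 1 and k as r + 1 makes all its coefficients positive. `iteration-part` has the
-- same form.
polynomial-part : ∀ m r →
  5 + (suc m * (suc m * 5 + 3 + 4) + (suc r * ((3 + suc m * (suc m * 9 + 4)) + suc (suc (suc (suc m * 5) + suc (suc m * 5))) + 4)
    + (2 * (suc m * (suc (suc (suc m * 6) + suc (suc ((6 * r + 6) * (suc (suc m * 6 + 2) + 4)) + 9)) + 4) + 4)
    + (suc m * (suc (suc (suc r * 6)) + 4) + 1))))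
  + (300 * (m * m * (r * r)) + 600 * (m * (r * r)) + 300 * (r * r) + 519 * (m * m * r) + 934 * (m * r) + 404 * r
     + 202 * (m * m) + 253 * m + 26)
  ≡ 300 * ((suc r * (suc r * 1)) * (suc m * (suc m * 1)))
polynomial-part = solve-∀

iteration-part : ∀ r →
  suc (suc r * (5 + (2 * suc r * 7 + 2) + 4)) + suc (suc (suc (suc (2 * r) * 8 + 1))) + 1 + (46 * (r * r) + 65 * r + 21)
  ≡ 60 * (suc r * suc r)
iteration-part = solve-∀

-- There are at most (6 k) ^ (2 k - 2) sequences, each costing at most 60 k ^ 2 steps. The two
-- missing factors 6 k of the bound pay for the k ^ 2.
search-part : ∀ r i → i ≤ 60 * (suc r * suc r) →
              suc ((6 * suc r) ^ dbl r * i + 1) ≤ 62 * (6 * suc r) ^ (2 * suc r)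
search-part r i i≤ = begin
  suc (E * i + 1)                     ≤⟨ s≤s (+-monoˡ-≤ 1 (*-monoʳ-≤ E i≤)) ⟩
  suc (E * (60 * (k * k)) + 1)        ≡⟨ regroup E k ⟩
  60 * (k * (k * E)) + 2              ≤⟨ +-mono-≤ (*-monoʳ-≤ 60 (*-mono-≤ k≤6k (*-monoˡ-≤ E k≤6k))) (*-monoʳ-≤ 2 1≤F) ⟩
  60 * F + 2 * F                      ≡⟨ sym (*-distribʳ-+ F 60 2) ⟩
  62 * F                              ≡⟨ cong (λ e → 62 * (6 * k) ^ e) (trans (dbl≡+ k) (cong (k +_) (sym (+-identityʳ k)))) ⟩
  62 * (6 * k) ^ (2 * k)              ∎
  where
  open ≤-Reasoning
  k = suc r
  E = (6 * k) ^ dbl r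
  F = 6 * k * (6 * k * E)
  k≤6k : k ≤ 6 * k
  k≤6k = m≤m+n k (5 * k)
  1≤F : 1 ≤ F
  1≤F = m^n>0 (6 * k) (suc (suc (dbl r)))
  regroup : ∀ E k → suc (E * (60 * (k * k)) + 1) ≡ 60 * (k * (k * E)) + 2
  regroup = solve-∀

add-up : ∀ A B C S O {X F} → 5 + (A + (B + (C + (O + 1)))) ≤ 300 * X → S ≤ 62 * F →
         5 + (A + (B + (C + (S + (O + 1))))) ≤ 500 * (X + F)
add-up A B C S O {X} {F} poly search = begin
  5 + (A + (B + (C + (S + (O + 1)))))   ≡⟨ move A B C S O ⟩
  5 + (A + (B + (C + (O + 1)))) + S     ≤⟨ +-mono-≤ poly search ⟩
  300 * X + 62 * F                      ≤⟨ m≤m+n _ (200 * X + 438 * F) ⟩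
  300 * X + 62 * F + (200 * X + 438 * F) ≡⟨ collect X F ⟩
  500 * (X + F)                         ∎
  where
  open ≤-Reasoning
  move : ∀ A B C S O → 5 + (A + (B + (C + (S + (O + 1))))) ≡ 5 + (A + (B + (C + (O + 1)))) + S
  move = solve-∀
  collect : ∀ X F → 300 * X + 62 * F + (200 * X + 438 * F) ≡ 500 * (X + F)
  collect = solve-∀

time-bound : ∀ n r → 1 ≤ n → total-time n r ≤ time n (suc r)
time-bound (suc m) r _ =
  add-up (suc m * (suc m * 5 + 3 + 4)) (greedy-bound (suc m) r) (classify-bound (suc m) r) (search-bound r) (output-bound (suc m) r)
    {suc r ^ 2 * suc m ^ 2} {(6 * suc r) ^ (2 * suc r)} (≤-trans (m≤m+n _ _) (≤-reflexive (polynomial-part m r)))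
    (search-part r (iteration-bound r + 1) (≤-trans (m≤m+n _ _) (≤-reflexive (iteration-part r))))

-- For s ≥ 2 the factor 8 is at most s ^ 3, so 8 s ≤ s ^ 4. The exponent 80 is 4 times the 20 that
-- bounds the leaves of an expression.
word-bound : ∀ s → 2 ≤ s → (8 * s) ^ 20 ≤ s ^ 80
word-bound s 2≤s = begin
  (8 * s) ^ 20    ≤⟨ ^-monoˡ-≤ 20 8s≤ ⟩
  (s ^ 4) ^ 20    ≡⟨ ^-*-assoc s 4 20 ⟩
  s ^ 80          ∎
  where
  open ≤-Reasoning
  8s≤ : 8 * s ≤ s ^ 4
  8s≤ = begin
    8 * s      ≤⟨ *-monoˡ-≤ s (^-monoˡ-≤ 3 2≤s) ⟩
    s ^ 3 * s  ≡⟨ *-comm (s ^ 3) s ⟩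
    s ^ 4      ∎

-- With s = n + k, the bound 8 s on stored values exceeds n, is at least 6 k, and is at least 8, as
-- the literals of small expressions demand.
solution : ∀ {n} (G : Graph n) → 1 ≤ n → ∀ r W s → s ≡ n + suc r → (8 * s) ^ 20 ≤ W →
           ∃[ σ ] ∃[ t ] (Run W algorithm (input G (suc r)) σ t × t ≤ time n (suc r) × Correct G (suc r) σ)
solution {n} G 1≤n r W s refl M^20≤W =
  extract (Interface.Verification.algorithm-run G 1≤n r W (8 * s) 8≤M M^20≤W n<M 6k≤M)
  where
  8≤M : 8 ≤ 8 * s
  8≤M = *-monoʳ-≤ 8 (≤-trans 1≤n (m≤m+n n (suc r)))
  n<M : n < 8 * s
  n<M = <-≤-trans (m<m+n n (s≤s z≤n)) (m≤m+n s (7 * s))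
  6k≤M : 6 * r + 6 ≤ 8 * s
  6k≤M = begin
    6 * r + 6    ≡⟨ trans (+-comm (6 * r) 6) (sym (*-suc 6 r)) ⟩
    6 * suc r    ≤⟨ *-mono-≤ (m≤m+n 6 2) (m≤n+m (suc r) n) ⟩
    8 * s        ∎
    where open ≤-Reasoning
  extract : Machine.Runs W (8 * s) 8≤M M^20≤W algorithm (input G (suc r)) (total-time n r) (Correct G (suc r)) →
            ∃[ σ ] ∃[ t ] (Run W algorithm (input G (suc r)) σ t × t ≤ time n (suc r) × Correct G (suc r) σ)
  extract (Machine.runs run time≤ _ correct) = _ , _ , run , ≤-trans time≤ (time-bound n r 1≤n) , correct

within-time : FindsGoodPartitionWithin algorithm time
within-time = 80 , λ
  { zero    k       G → ⊥-elim (≢-nonZero⁻¹ 0 refl)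
  ; (suc m) zero    G → ⊥-elim (≢-nonZero⁻¹ 0 refl)
  ; (suc m) (suc r) G → solution G (s≤s z≤n) r ((suc m + suc r) ^ 80) (suc m + suc r) refl
                          (word-bound (suc m + suc r) (≤-trans (s≤s (s≤s z≤n)) (+-mono-≤ (s≤s (z≤n {m})) (s≤s (z≤n {r})))))
  }

-- Since n is positive, the search term may be multiplied by n ^ 2 as well, which puts the whole
-- dependence on k into one factor.
fixed-parameter : FixedParameterTractable time
fixed-parameter = (λ k → 500 * (k ^ 2 + (6 * k) ^ (2 * k))) , 2 , λ
  { zero    k → ⊥-elim (≢-nonZero⁻¹ 0 refl)
  ; (suc m) k → bound (suc m) k (m^n>0 (suc m) 2) }
  where
  bound : ∀ n k → 1 ≤ n ^ 2 → time n k ≤ 500 * (k ^ 2 + (6 * k) ^ (2 * k)) * n ^ 2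
  bound n k 1≤n² = begin
    500 * (k ^ 2 * n ^ 2 + F)           ≤⟨ *-monoʳ-≤ 500 (+-monoʳ-≤ (k ^ 2 * n ^ 2) (≤-trans (≤-reflexive (sym (*-identityʳ F))) (*-monoʳ-≤ F 1≤n²))) ⟩
    500 * (k ^ 2 * n ^ 2 + F * n ^ 2)   ≡⟨ cong (500 *_) (sym (*-distribʳ-+ (n ^ 2) (k ^ 2) F)) ⟩
    500 * ((k ^ 2 + F) * n ^ 2)         ≡⟨ sym (*-assoc 500 (k ^ 2 + F) (n ^ 2)) ⟩
    500 * (k ^ 2 + F) * n ^ 2           ∎
    where
    open ≤-Reasoning
    F = (6 * k) ^ (2 * k)

corollary37 : Σ[ algorithm ∈ Cmd ] Σ[ T ∈ (ℕ → ℕ → ℕ) ]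
    ( FindsGoodPartitionWithin algorithm T
    × FixedParameterTractable T
    × T ∈O (λ n k → k ^ 2 * n ^ 2 + (6 * k) ^ (2 * k)) )
corollary37 = algorithm , time , within-time , fixed-parameter , 500 , λ n k → ≤-refl
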